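{- For any $\ell\ge 3$, there is an algorithm for oracle $\ell$-matroid intersection which runs in time $2^{n-\Omega(\log^2(n))}$, where $n$ is the size of the ground set.
   Context: Here $\ell$ is an integer and $\log$ is the logarithm in base $2$. A matroid is a pair $(E,\mathcal{I})$, where $E$ is a finite set and $\mathcal{I}\subseteq 2^E$ is the family of independent sets, such that (i) $\emptyset\in\mathcal{I}$; (ii) for all $A\in\mathcal{I}$ and $B\subseteq A$ it holds that $B\in\mathcal{I}$; and (iii) for all $A,B\in\mathcal{I}$ with $|A|>|B|$ there is $e\in A\setminus B$ such that $B\cup\{e\}\in\mathcal{I}$. A basis is an inclusion-wise maximal independent set. Oracle $\ell$-matroid intersection ($\ell$-MI): an instance is $(E,\mathcal{I}_1,\ldots,\mathcal{I}_\ell)$ such that $(E,\mathcal{I}_i)$ is a matroid for every $i\in\{1,\ldots,\ell\}$. The objective is to decide whether the $\ell$ matroids have a common basis. The ground set $E$ is given explicitly in the input, while each $\mathcal{I}_i$ is accessible only via a membership oracle, which in a single query on a set $S\subseteq E$ determines whether $S\in\mathcal{I}_i$. Running time $2^{n-\Omega(\log^2(n))}$ means running time at most $2^{n-h(n)}$ for some function $h$ with $h(n)=\Omega(\log^2(n))$. -}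

module Defs where

open import Data.Bool.Base using (Bool; true; false; not; if_then_else_)
open import Data.Fin.Base using (Fin; toℕ)
open import Data.Fin.Subset using (Subset; ⊥; ⁅_⁆; _∈_; _∉_; _⊆_; _∪_; ∣_∣)
open import Data.Integer.Base using (ℤ; +_; -[1+_])
import Data.Integer.Base as ℤ
open import Data.Nat.Base using (ℕ; zero; suc; pred; _+_; _*_; _^_; _≤_; _<_; _≡ᵇ_)
open import Data.Nat.Logarithm using (⌊log₂_⌋)
open import Data.Product.Base using (∃-syntax; _×_)
open import Data.Sum.Base using (_⊎_)
open import Data.Vec.Base using (tabulate)
open import Level using (0ℓ)
open import Relation.Binary.PropositionalEquality using (_≡_; _≢_)
open import Relation.Nullary.Decidable using (does)
open import Relation.Nullary.Negation using (¬_)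
open import Relation.Unary using (Pred; Decidable)

-- The ground set of size n is Fin n.  Independence is decidable because
-- a membership oracle answers with a boolean.
record Matroid (n : ℕ) : Set₁ where
  field
    Indep        : Pred (Subset n) 0ℓ
    indep?       : Decidable Indep
    ⊥-indep      : Indep ⊥
    ⊆-indep      : ∀ {A B} → Indep A → B ⊆ A → Indep B
    augmentation : ∀ {A B} → Indep A → Indep B → ∣ B ∣ < ∣ A ∣ →
                   ∃[ e ] (e ∈ A × e ∉ B × Indep (B ∪ ⁅ e ⁆))

  IsBasis : Pred (Subset n) 0ℓ
  IsBasis B = Indep B × (∀ {C} → Indep C → B ⊆ C → C ≡ B)

Instance : ℕ → ℕ → Set₁
Instance ℓ n = Fin ℓ → Matroid n

HasCommonBasis : ∀ {ℓ n} → Instance ℓ n → Set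
HasCommonBasis M = ∃[ B ] (∀ i → Matroid.IsBasis (M i) B)

-- The machine has registers and an addressable memory, both holding
-- natural numbers.  The only arithmetic is successor and predecessor, so
-- in time t no cell exceeds the initial maximum and the constants of the
-- program by more than t.  Unit cost therefore hides no large-number
-- arithmetic, and agrees with the word RAM and with logarithmic cost up
-- to factors polynomial in n for running times 2^O(n).

Reg : Set
Reg = ℕ

infix  7 _≔const_ _≔copy_ _≔load[_] store[_]≔_
infixr 5 _⨾_

data Program (ℓ : ℕ) : Set where
  skip       : Program ℓ
  _≔const_   : Reg → ℕ → Program ℓ
  _≔copy_    : Reg → Reg → Program ℓ
  inc dec    : Reg → Program ℓ
  _≔load[_]  : Reg → Reg → Program ℓ
  store[_]≔_ : Reg → Reg → Program ℓ
  -- query x i p asks oracle i about the set whose characteristic vector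
  -- is in memory from the address held in p on; the answer goes to x.
  query      : Reg → Fin ℓ → Reg → Program ℓ
  _⨾_        : Program ℓ → Program ℓ → Program ℓ
  if_then_else_fi : Reg → Program ℓ → Program ℓ → Program ℓ
  while_loop_end  : Reg → Program ℓ → Program ℓ

record State : Set where
  constructor ⟪_,_⟫
  field
    reg : Reg → ℕ
    mem : ℕ → ℕ

open State public

_[_↦_] : (ℕ → ℕ) → ℕ → ℕ → (ℕ → ℕ)
(f [ x ↦ v ]) y = if y ≡ᵇ x then v else f y

setReg : State → Reg → ℕ → State
setReg s x v = ⟪ reg s [ x ↦ v ] , mem s ⟫

setMem : State → ℕ → ℕ → State
setMem s a v = ⟪ reg s , mem s [ a ↦ v ] ⟫

subsetAt : ∀ n → State → ℕ → Subset n
subsetAt n s a = tabulate λ e → not (mem s (a + toℕ e) ≡ᵇ 0)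

bit : Bool → ℕ
bit b = if b then 1 else 0

Oracles : ℕ → ℕ → Set
Oracles ℓ n = Fin ℓ → Subset n → Bool

-- O ⊢ P , s ⇓[ t ] s′ : with oracles O, program P started in state s
-- halts in state s′ after t steps.  Tests hold when the register is
-- nonzero.  The relation is deterministic in t and s′.
infix 4 _⊢_,_⇓[_]_

data _⊢_,_⇓[_]_ {ℓ n} (O : Oracles ℓ n) :
     Program ℓ → State → ℕ → State → Set where

  ⇓skip  : ∀ {s} → O ⊢ skip , s ⇓[ 1 ] s

  ⇓const : ∀ {s x k} → O ⊢ x ≔const k , s ⇓[ 1 ] setReg s x k

  ⇓copy  : ∀ {s x y} → O ⊢ x ≔copy y , s ⇓[ 1 ] setReg s x (reg s y)

  ⇓inc   : ∀ {s x} → O ⊢ inc x , s ⇓[ 1 ] setReg s x (suc (reg s x))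

  ⇓dec   : ∀ {s x} → O ⊢ dec x , s ⇓[ 1 ] setReg s x (pred (reg s x))

  ⇓load  : ∀ {s x p} →
           O ⊢ x ≔load[ p ] , s ⇓[ 1 ] setReg s x (mem s (reg s p))

  ⇓store : ∀ {s p y} →
           O ⊢ store[ p ]≔ y , s ⇓[ 1 ] setMem s (reg s p) (reg s y)

  ⇓query : ∀ {s x i p} →
           O ⊢ query x i p , s
             ⇓[ 1 ] setReg s x (bit (O i (subsetAt n s (reg s p))))

  ⇓seq   : ∀ {P Q s s′ s″ t u} →
           O ⊢ P , s ⇓[ t ] s′ → O ⊢ Q , s′ ⇓[ u ] s″ →
           O ⊢ P ⨾ Q , s ⇓[ t + u ] s″

  ⇓then  : ∀ {x P Q s s′ t} → reg s x ≢ 0 →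
           O ⊢ P , s ⇓[ t ] s′ →
           O ⊢ if x then P else Q fi , s ⇓[ suc t ] s′

  ⇓else  : ∀ {x P Q s s′ t} → reg s x ≡ 0 →
           O ⊢ Q , s ⇓[ t ] s′ →
           O ⊢ if x then P else Q fi , s ⇓[ suc t ] s′

  ⇓done  : ∀ {x P s} → reg s x ≡ 0 →
           O ⊢ while x loop P end , s ⇓[ 1 ] s

  ⇓loop  : ∀ {x P s s′ s″ t u} → reg s x ≢ 0 →
           O ⊢ P , s ⇓[ t ] s′ → O ⊢ while x loop P end , s′ ⇓[ u ] s″ →
           O ⊢ while x loop P end , s ⇓[ suc (t + u) ] s″

-- Register 0 holds n on start and the verdict on termination.
initial : ℕ → State
initial n = ⟪ (λ _ → 0) [ 0 ↦ n ] , (λ _ → 0) ⟫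

oracles : ∀ {ℓ n} → Instance ℓ n → Oracles ℓ n
oracles M i S = does (Matroid.indep? (M i) S)

Verdict : ∀ {ℓ n} → Instance ℓ n → ℕ → Set
Verdict M v = (HasCommonBasis M × v ≡ 1) ⊎ (¬ HasCommonBasis M × v ≡ 0)

-- A single program serves all n; Within n t says that t is an admissible
-- number of steps on ground sets of size n.
SolvesMI : ∀ {ℓ} → Program ℓ → (Within : ℕ → ℕ → Set) → Set₁
SolvesMI {ℓ} P Within =
  ∀ n (M : Instance ℓ n) →
  ∃[ t ] ∃[ s ] (oracles M ⊢ P , initial n ⇓[ t ] s
                 × Within n t
                 × Verdict M (reg s 0))

-- t ≤2^ z is t ≤ 2 ^ z for an integer exponent z.
infix 4 _≤2^_

_≤2^_ : ℕ → ℤ → Set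
t ≤2^ (+ m)    = t ≤ 2 ^ m
t ≤2^ -[1+ m ] = t * 2 ^ suc m ≤ 1

-- h n ≥ (1/k) · g n for all large n; constants of the form 1/k suffice.
infix 4 _∈Ω_

_∈Ω_ : (ℕ → ℤ) → (ℕ → ℕ) → Set
h ∈Ω g = ∃[ k ] ∃[ n₀ ] (0 < k × (∀ n → n₀ ≤ n → + g n ℤ.≤ + k ℤ.* h n))

-- Rounding does not affect Ω: ⌊log₂ n⌋ ≤ log₂ n ≤ 2 ⌊log₂ n⌋ for n ≥ 2.
log² : ℕ → ℕ
log² n = ⌊log₂ n ⌋ ^ 2

{-# OPTIONS --safe #-}

-- Let k be of order log n.  A common basis B is encoded by n - k² bits, and the
-- algorithm decodes all such strings in polynomial time each.  The ground set
-- contains k blocks of 2 ^ s disjoint groups of g = k s elements, where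
-- s = (ℓ² + 1) k.  If B misses a group, omitting the bits of this group
-- suffices.  Otherwise one element can be deleted from B in each block so that
-- the rest is a codeword of a Hamming-like code: s further bits of every block,
-- which we call its check bits, are determined by the labels of the groups of
-- odd parity.  This saves k s bits.  The k deleted elements are replaced one by
-- one, at the cost of ℓ² k² bits of advice in total.  To replace d in a common
-- basis B, keep sets S i that are independent in the i-th matroid and lie in the
-- hyperplane spanned by B - d; as d fits all of them, some e ∉ S i with
-- S i + e independent for all i is found.  Either B - d + e is again a common
-- basis, or e lies in some of the hyperplanes and, as ℓ bits of advice tell,
-- enlarges the corresponding S i.  The rank bounds how often this happens.

module Submission where

open import Defs
open import Data.Bool.Base using (Bool; true; false; not; _∧_; _∨_; _xor_; if_then_else_; T)
open import Data.Bool.Properties using (∧-assoc; ∧-comm; ∧-identityʳ; ∧-zeroʳ; ∧-distribʳ-xor; ∨-assoc; ∨-identityʳ; ∨-zeroʳ; xor-assoc; xor-comm; xor-identityʳ; xor-same)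
open import Data.Empty using (⊥; ⊥-elim)
open import Data.Fin.Base using (Fin; zero; suc; toℕ; fromℕ<)
open import Data.Fin.Properties using (toℕ<n; toℕ-fromℕ<; toℕ-injective) renaming (_≟_ to _≟ᶠ_)
open import Data.Fin.Subset using (Subset; ∣_∣; _∈_; _∉_; _⊆_; _∪_; ⁅_⁆)
open import Data.Fin.Subset.Properties using (p⊆q⇒∣p∣≤∣q∣; ∪-identityʳ)
open import Data.Integer.Base using (ℤ; +_; _-_)
import Data.Integer.Base as ℤ
import Data.Integer.Properties as ℤ
open import Data.Integer.Tactic.RingSolver using () renaming (solve-∀ to solveℤ-∀)
open import Data.Nat.Base
open import Data.Nat.GeneralisedArithmetic using (iterate)
open import Data.Nat.Logarithm using (⌊log₂_⌋; ⌊log₂⌋-mono-≤; ⌊log₂[2^n]⌋≡n)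
open import Data.Nat.Properties
open import Data.Nat.Tactic.RingSolver using (solve-∀)
open import Data.Product.Base hiding (swap)
open import Data.Sum.Base using (_⊎_; inj₁; inj₂; swap)
open import Data.Unit.Base using (⊤; tt)
open import Data.Vec.Base using ([]; _∷_; tabulate; here; there)
open import Data.Vec.Properties using (tabulate-cong)
open import Function.Base using (_∘_)
open import Relation.Binary.PropositionalEquality
open import Relation.Nullary.Decidable.Core using (yes; no; does)
open import Relation.Nullary.Negation using (¬_; contradiction)

-- The 2 ^ s groups of a block have to fit into n elements, so s and k are at most of order log n,
-- and the gain k² is of order log² n. The same constraint is the obstacle: naming a deleted element
-- outright takes about log n bits, more than the s bits that its block saves. Hence B itself is not
-- restored. Any common basis containing the remaining set will do, and the advice only steers a
-- search in which the next element tried depends on the current sets alone. The sets S i restart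
-- from the known part T of the basis, which lacks at most k elements; so their total deficit is at
-- most ℓ k when a replacement begins, and it drops in every round that does not complete the
-- replacement. This gives k · ℓ k rounds of ℓ bits each, and s is chosen so that k² bits remain
-- after paying for them. No bit tells which of the two encodings a string uses, and most strings
-- mean nothing: every result is tested as a common basis, so wrong strings are harmless. The
-- polynomial time per string is a factor 2 ^ O(k), which the gain absorbs for large n.

-- Boolean tests, register numbers and cell addresses.

dbl : ℕ → ℕ
dbl zero    = zero
dbl (suc x) = suc (suc (dbl x))

dbl-≡ᵇ : ∀ x y → (dbl x ≡ᵇ dbl y) ≡ (x ≡ᵇ y)
dbl-≡ᵇ zero    zero    = refl
dbl-≡ᵇ zero    (suc y) = refl
dbl-≡ᵇ (suc x) zero    = refl
dbl-≡ᵇ (suc x) (suc y) = dbl-≡ᵇ x y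

even≢ᵇodd : ∀ x y → (dbl x ≡ᵇ suc (dbl y)) ≡ false
even≢ᵇodd zero    y       = refl
even≢ᵇodd (suc x) zero    = refl
even≢ᵇodd (suc x) (suc y) = even≢ᵇodd x y

odd≢ᵇeven : ∀ x y → (suc (dbl x) ≡ᵇ dbl y) ≡ false
odd≢ᵇeven x       zero    = refl
odd≢ᵇeven zero    (suc y) = refl
odd≢ᵇeven (suc x) (suc y) = odd≢ᵇeven x y

≡ᵇ-refl : ∀ x → (x ≡ᵇ x) ≡ true
≡ᵇ-refl zero    = refl
≡ᵇ-refl (suc x) = ≡ᵇ-refl x

≢⇒≡ᵇ-false : ∀ x y → x ≢ y → (x ≡ᵇ y) ≡ false
≢⇒≡ᵇ-false zero    zero    p = contradiction refl p
≢⇒≡ᵇ-false zero    (suc y) p = refl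
≢⇒≡ᵇ-false (suc x) zero    p = refl
≢⇒≡ᵇ-false (suc x) (suc y) p = ≢⇒≡ᵇ-false x y (p ∘ cong suc)

≡ᵇ-true⇒≡ : ∀ x y → (x ≡ᵇ y) ≡ true → x ≡ y
≡ᵇ-true⇒≡ zero    zero    p = refl
≡ᵇ-true⇒≡ (suc x) (suc y) p = cong suc (≡ᵇ-true⇒≡ x y p)

≡ᵇ-false⇒≢ : ∀ x y → (x ≡ᵇ y) ≡ false → x ≢ y
≡ᵇ-false⇒≢ x .x p refl with () ← trans (sym p) (≡ᵇ-refl x)

<⇒<ᵇ-true : ∀ {x y} → x < y → (x <ᵇ y) ≡ true
<⇒<ᵇ-true {zero}  {suc y} p       = refl
<⇒<ᵇ-true {suc x} {suc y} (s≤s p) = <⇒<ᵇ-true p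

≥⇒<ᵇ-false : ∀ {x y} → y ≤ x → (x <ᵇ y) ≡ false
≥⇒<ᵇ-false {x}     {zero}  p       = refl
≥⇒<ᵇ-false {suc x} {suc y} (s≤s p) = ≥⇒<ᵇ-false p

∑ : ∀ {m} → (Fin m → ℕ) → ℕ
∑ {zero}  f = 0
∑ {suc m} f = f zero + ∑ (f ∘ suc)

-- Uniqueness of quotient and remainder. It keeps the arrays apart in memory, and likewise the
-- groups and blocks of the code.
cell-unique : ∀ {n} j j′ {y y′} → y < n → y′ < n → j * n + y ≡ j′ * n + y′ → j ≡ j′ × y ≡ y′
cell-unique zero zero y< y′< e = refl , e
cell-unique {n} zero (suc j′) {y} {y′} y< y′< e = contradiction y< (≤⇒≯ (≤-trans
  (≤-trans (m≤m+n n (j′ * n)) (m≤m+n _ y′)) (≤-reflexive (sym e))))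
cell-unique {n} (suc j) zero {y} {y′} y< y′< e = contradiction y′< (≤⇒≯ (≤-trans
  (≤-trans (m≤m+n n (j * n)) (m≤m+n _ y)) (≤-reflexive e)))
cell-unique {n} (suc j) (suc j′) {y} {y′} y< y′< e with
  p , q ← cell-unique j j′ y< y′< (+-cancelˡ-≡ n _ _
    (trans (sym (+-assoc n (j * n) y)) (trans e (+-assoc n (j′ * n) y′)))) = cong suc p , q

-- Structured programs, their meaning and their cost.

-- A language of programs over variables and arrays of length n; a store out
-- of range has no effect.

infix  7 _:=#_ _:=_ _←_[_] _[_]←_
infixr 5 _∙_

data Com (ℓ : ℕ) : Set where
  nop       : Com ℓ
  _:=#_     : ℕ → ℕ → Com ℓ
  _:=_      : ℕ → ℕ → Com ℓ
  incr decr : ℕ → Com ℓ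
  _←_[_]   : ℕ → ℕ → ℕ → Com ℓ
  _[_]←_   : ℕ → ℕ → ℕ → Com ℓ
  ask       : ℕ → Fin ℓ → ℕ → Com ℓ
  _∙_       : Com ℓ → Com ℓ → Com ℓ
  cond      : ℕ → Com ℓ → Com ℓ → Com ℓ
  loop      : ℕ → Com ℓ → Com ℓ
  each      : (Fin ℓ → Com ℓ) → Com ℓ

record Store : Set where
  constructor ⟨_,_⟩
  field
    var : ℕ → ℕ
    arr : ℕ → ℕ → ℕ

open Store public

branch : ∀ {A : Set} → ℕ → A → A → A
branch zero    a b = b
branch (suc _) a b = a

upd : (ℕ → ℕ → ℕ) → ℕ → (ℕ → ℕ) → ℕ → ℕ → ℕ
upd f j a j′ = if j′ ≡ᵇ j then a else f j′

put : ℕ → (ℕ → ℕ) → ℕ → ℕ → ℕ → ℕ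
put n a y v y′ = if (y′ ≡ᵇ y) ∧ (y′ <ᵇ n) then v else a y′

⟦_⟧ : ∀ {n} → (ℕ → ℕ) → Subset n
⟦ a ⟧ = tabulate λ e → not (a (toℕ e) ≡ᵇ 0)

fold-each : ∀ {A : Set} {m} → (Fin m → A → A) → A → A
fold-each {m = zero}  f s = s
fold-each {m = suc m} f s = fold-each (f ∘ suc) (f zero s)

module _ {ℓ n : ℕ} (O : Oracles ℓ n) where

  exec : Com ℓ → Store → Store
  exec nop           s = s
  exec (x :=# k)     s = ⟨ var s [ x ↦ k ] , arr s ⟩
  exec (x := y)      s = ⟨ var s [ x ↦ var s y ] , arr s ⟩
  exec (incr x)      s = ⟨ var s [ x ↦ suc (var s x) ] , arr s ⟩
  exec (decr x)      s = ⟨ var s [ x ↦ pred (var s x) ] , arr s ⟩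
  exec (x ← j [ y ]) s = ⟨ var s [ x ↦ arr s j (var s y) ] , arr s ⟩
  exec (j [ y ]← x) s = ⟨ var s , upd (arr s) j (put n (arr s j) (var s y) (var s x)) ⟩
  exec (ask x i j)   s = ⟨ var s [ x ↦ bit (O i ⟦ arr s j ⟧) ] , arr s ⟩
  exec (c ∙ d)       s = exec d (exec c s)
  exec (cond x c d)  s = branch (var s x) (exec c s) (exec d s)
  -- The number of rounds is cut off at n, so that running times are
  -- bounded by the nesting of the loops.
  exec (loop x c)    s = iterate (exec c) s (var s x ⊓ n)
  exec (each c)      s = fold-each (λ i → exec (c i)) s

-- A conditional is charged for both branches and a loop for n rounds: the compiled loop always
-- makes n rounds, idle ones once its count is exhausted. An array access finds `n ∸ y` and the
-- address by counting, which is linear in n.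
cost : ∀ {ℓ} → ℕ → Com ℓ → ℕ
cost n nop           = 1
cost n (x :=# k)     = 1
cost n (x := y)      = 1
cost n (incr x)      = 1
cost n (decr x)      = 1
cost n (x ← j [ y ]) = (n * 5 + 4) + suc (1 + (j * (2 + n * 3) + 1 + 1))
cost n (j [ y ]← x) = (n * 5 + 4) + suc (1 + (j * (2 + n * 3) + 1 + 1))
cost n (ask x i j)   = 1 + (j * (2 + n * 3) + 1 + 1)
cost n (c ∙ d)       = cost n c + cost n d
cost n (cond x c d)  = suc (cost n c + cost n d)
cost n (loop x c)    = 3 + n * (4 + cost n c)
cost n (each c)      = suc (∑ λ i → cost n (c i))

-- Compilation to the register machine.

-- Variable x lives in register 2x.  The odd registers hold n (register 1),
-- address calculations (3, 5, 7) and the counters of nested loops.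

pattern rn = 1
pattern ra = 3
pattern rb = 5
pattern rc = 7

ctr : ℕ → ℕ
ctr d = suc (dbl (4 + d))

seqs : ∀ {ℓ m} → (Fin m → Program ℓ) → Program ℓ
seqs {m = zero}  P = skip
seqs {m = suc m} P = P zero ⨾ seqs (P ∘ suc)

drain : ∀ {ℓ} → ℕ → Program ℓ → Program ℓ
drain x P = while x loop dec x ⨾ P end

-- Leaves n ∸ y in register rc, to test whether y is a legal index.
range : ∀ {ℓ} → ℕ → Program ℓ
range y = rc ≔copy rn ⨾ ra ≔copy dbl y ⨾ rb ≔copy rn ⨾
          drain rb (if ra then (dec ra ⨾ dec rc) else skip fi)

offset : ∀ {ℓ} → ℕ → Program ℓ
offset zero    = skip
offset (suc j) = rb ≔copy rn ⨾ drain rb (inc ra) ⨾ offset j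

-- The number d is the first free counter. A loop takes two of them, one for the n machine rounds
-- and one for the rounds that still have to act, so its body is compiled at `2 + d`.
compile : ∀ {ℓ} → ℕ → Com ℓ → Program ℓ
compile d nop           = skip
compile d (x :=# k)     = dbl x ≔const k
compile d (x := y)      = dbl x ≔copy dbl y
compile d (incr x)      = inc (dbl x)
compile d (decr x)      = dec (dbl x)
compile d (x ← j [ y ]) = range y ⨾
  if rc then (ra ≔copy dbl y ⨾ offset j ⨾ dbl x ≔load[ ra ]) else dbl x ≔const 0 fi
compile d (j [ y ]← x) = range y ⨾
  if rc then (ra ≔copy dbl y ⨾ offset j ⨾ store[ ra ]≔ dbl x) else skip fi
compile d (ask x i j)   = ra ≔const 0 ⨾ offset j ⨾ query (dbl x) i ra
compile d (c ∙ c′)      = compile d c ⨾ compile d c′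
compile d (cond x c c′) = if dbl x then compile d c else compile d c′ fi
compile d (loop x c)    = ctr d ≔copy rn ⨾ ctr (suc d) ≔copy dbl x ⨾
  drain (ctr d) (if ctr (suc d) then (dec (ctr (suc d)) ⨾ compile (2 + d) c) else skip fi)
compile d (each c)      = seqs (λ i → compile d (c i))

-- Correctness and running time of compiled programs.

module _ {ℓ n : ℕ} (O : Oracles ℓ n) where

  -- Only an upper bound on the time is recorded, so that branches of different length can be
  -- joined.
  record Runs (P : Program ℓ) (s : State) (b : ℕ) (Q : State → Set) : Set where
    constructor runs
    field
      {time}  : ℕ
      {final} : State
      steps   : O ⊢ P , s ⇓[ time ] final
      time≤   : time ≤ b
      post    : Q final

  weaken : ∀ {P s b b′ Q Q′} → b ≤ b′ → (∀ {s′} → Q s′ → Q′ s′) →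
           Runs P s b Q → Runs P s b′ Q′
  weaken b≤ f (runs p t q) = runs p (≤-trans t b≤) (f q)

  then-run : ∀ {P P′ s b b′ Q R} → Runs P s b Q →
             (∀ {s′} → Q s′ → Runs P′ s′ b′ R) → Runs (P ⨾ P′) s (b + b′) R
  then-run (runs p t q) f with runs p′ t′ r ← f q = runs (⇓seq p p′) (+-mono-≤ t t′) r

  if-run : ∀ {x P P′ s b Q} → (reg s x ≢ 0 → Runs P s b Q) → (reg s x ≡ 0 → Runs P′ s b Q) →
           Runs (if x then P else P′ fi) s (suc b) Q
  if-run {x} {s = s} f g with reg s x in eq
  ... | zero  with runs p t q ← g refl = runs (⇓else eq p) (s≤s t) q
  ... | suc v with runs p t q ← f (λ ()) =
    runs (⇓then (λ z → 1+n≢0 (trans (sym eq) z)) p) (s≤s t) q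

  drain-run : ∀ {x P b} (I : ℕ → State → Set) →
    (∀ {m s} → reg s x ≡ suc m → I (suc m) s →
       Runs P (setReg s x m) b (λ s′ → reg s′ x ≡ m × I m s′)) →
    ∀ m {s} → reg s x ≡ m → I m s → Runs (drain x P) s (1 + m * (2 + b)) (I 0)
  drain-run I f zero    e i = runs (⇓done e) (s≤s z≤n) i
  drain-run {x} {b = b} I f (suc m) {s} e i
    with runs {t} {s′} p t≤ (e′ , i′) ← f e i
    with runs {u} q u≤ j ← drain-run I f m e′ i′ =
    runs (⇓loop (λ z → 1+n≢0 (trans (sym e) z))
                (⇓seq ⇓dec (subst (λ v → O ⊢ _ , setReg s x v ⇓[ t ] s′) (sym (cong pred e)) p)) q)
         (s≤s (≤-trans (+-mono-≤ (s≤s t≤) u≤)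
                (≤-reflexive (+-suc (suc b) (m * (2 + b)))))) j

  -- Array j occupies the n memory cells from `j * n` on. By `out`, reading beyond the range gives
  -- 0, as the compiled load does.
  record Models (c : Store) (s : State) : Set where
    field
      vars  : ∀ x → reg s (dbl x) ≡ var c x
      size  : reg s rn ≡ n
      cells : ∀ j y → y < n → State.mem s (j * n + y) ≡ arr c j y
      out   : ∀ j y → n ≤ y → arr c j y ≡ 0

  open Models

  -- The counters of enclosing loops survive; the induction for `loop` rests on this.
  record Keeps (d : ℕ) (s s′ : State) : Set where
    constructor keeps
    field
      kept : ∀ {r} → r < d → reg s′ (ctr r) ≡ reg s (ctr r)

  open Keeps

  set-odd : ∀ {c s v} m → Models c s → Models c (setReg s (suc (dbl (suc m))) v)
  set-odd {c} {s} m r .vars x rewrite even≢ᵇodd x (suc m) = vars r x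
  set-odd m r .size  = size r
  set-odd m r .cells = cells r
  set-odd m r .out   = out r

  set-var : ∀ {c s v} x → Models c s → Models ⟨ var c [ x ↦ v ] , arr c ⟩ (setReg s (dbl x) v)
  set-var x r .vars y rewrite dbl-≡ᵇ y x with y ≡ᵇ x
  ... | true  = refl
  ... | false = vars r y
  set-var x r .size rewrite odd≢ᵇeven 0 x = size r
  set-var x r .cells = cells r
  set-var x r .out   = out r

  keeps-var : ∀ {s v} x d → Keeps d s (setReg s (dbl x) v)
  kept (keeps-var x d) {r} _ rewrite odd≢ᵇeven (4 + r) x = refl

  AddressIs : Store → ℕ → State → State → Set
  AddressIs c v s₀ s = Models c s × reg s ra ≡ v × (∀ d → Keeps d s₀ s)

  offset-run : ∀ {c v s₀ s} j → AddressIs c v s₀ s →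
               Runs (offset j) s (j * (2 + n * 3) + 1) (AddressIs c (v + j * n) s₀)
  offset-run {v = v} zero (r , a , k) =
    runs ⇓skip ≤-refl (r , trans a (sym (+-identityʳ v)) , k)
  offset-run {c} {v} {s₀} (suc j) (r , a , k) =
    weaken (≤-reflexive (sym (cong (_+_ 2) (+-assoc (n * 3) (j * (2 + n * 3)) 1))))
      (λ (r , a , k) → r , trans a (+-assoc v n (j * n)) , k)
      (then-run {Q = λ s → Models c s × reg s rb ≡ n × reg s ra ≡ v × (∀ d → Keeps d s₀ s)}
        {R = AddressIs c (v + n + j * n) s₀}
        (runs ⇓copy ≤-refl (set-odd 1 r , size r , a , λ d → keeps (kept (k d))))
        λ (r , b , a , k) →
          then-run
            (drain-run (λ m s → Models c s × reg s ra + m ≡ v + n × (∀ d → Keeps d s₀ s))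
              (λ {m} {s} b (r , a , k) → runs ⇓inc ≤-refl
                (refl , set-odd 0 (set-odd 1 r) , trans (sym (+-suc (reg s ra) m)) a , λ d → keeps (kept (k d))))
              n b (r , cong (_+ n) a , k))
            λ {s} (r , a , k) → offset-run j (r , trans (sym (+-identityʳ (reg s ra))) a , k))

  range-run : ∀ {c s} y → Models c s →
    Runs (range y) s (n * 5 + 4) (λ s′ → Models c s′ × reg s′ rc ≡ n ∸ var c y × (∀ d → Keeps d s s′))
  range-run {c} {s₀} y r =
    weaken (≤-reflexive (+-comm 4 (n * 5))) (λ q → q)
      (then-run {Q = λ s → Models c s × reg s rc ≡ n × (∀ d → Keeps d s₀ s)}
        (runs ⇓copy ≤-refl (set-odd 2 r , size r , λ d → keeps λ _ → refl))
        λ (r , c≡ , k) → then-run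
          {Q = λ s → Models c s × reg s ra ≡ var c y × reg s rc ≡ n × (∀ d → Keeps d s₀ s)}
          (runs ⇓copy ≤-refl (set-odd 0 r , vars r y , c≡ , λ d → keeps (kept (k d))))
          λ (r , a , c≡ , k) → then-run
            {Q = λ s → Models c s × reg s rb ≡ n × reg s ra ≡ var c y × reg s rc ≡ n ×
                       (∀ d → Keeps d s₀ s)}
            (runs ⇓copy ≤-refl (set-odd 1 r , size r , a , c≡ , λ d → keeps (kept (k d))))
            λ (r , b , a , c≡ , k) → weaken ≤-refl finish
              (drain-run I round n b (r , inj₂ c≡ , cong₂ _∸_ c≡ a , k)))
    where
    -- Both registers are counted down as long as `ra` is nonzero. After n rounds either y is used
    -- up, or `rc` went down every time and is 0, which is then the truncated difference.
    I : ℕ → State → Set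
    I m s = Models c s × (reg s ra ≡ 0 ⊎ reg s rc ≡ m) × reg s rc ∸ reg s ra ≡ n ∸ var c y ×
            (∀ d → Keeps d s₀ s)

    finish : ∀ {s} → I 0 s → Models c s × reg s rc ≡ n ∸ var c y × (∀ d → Keeps d s₀ s)
    finish {s} (r , inj₁ z , e , k) rewrite z = r , e , k
    finish {s} (r , inj₂ z , e , k) rewrite z = r , trans (sym (0∸n≡0 (reg s ra))) e , k

    round : ∀ {m s} → reg s rb ≡ suc m → I (suc m) s →
      Runs (if ra then (dec ra ⨾ dec rc) else skip fi) (setReg s rb m) 3
           (λ s′ → reg s′ rb ≡ m × I m s′)
    round {m} {s} b (r , z , e , k) = if-run
      (λ a≢ → runs (⇓seq ⇓dec ⇓dec) ≤-refl (refl , set-odd 2 (set-odd 0 (set-odd 1 r)) ,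
                down (reg s ra) z a≢ , trans (down′ (reg s ra) (reg s rc) a≢) e , λ d → keeps (kept (k d))))
      (λ a≡ → runs ⇓skip (s≤s z≤n) (refl , set-odd 1 r , inj₁ a≡ , e , λ d → keeps (kept (k d))))
      where
      down : ∀ a {c} → a ≡ 0 ⊎ c ≡ suc m → a ≢ 0 → pred a ≡ 0 ⊎ pred c ≡ m
      down a (inj₁ z) a≢ = contradiction z a≢
      down a (inj₂ z) a≢ = inj₂ (cong pred z)
      down′ : ∀ a c → a ≢ 0 → pred c ∸ pred a ≡ c ∸ a
      down′ zero    c       a≢ = contradiction refl a≢
      down′ (suc a) zero    a≢ = 0∸n≡0 a
      down′ (suc a) (suc c) a≢ = refl

  Outcome : ℕ → Com ℓ → Store → State → Set
  Outcome d c st s =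
    Runs (compile d c) s (cost n c) (λ s′ → Models (exec O c st) s′ × Keeps d s s′)

  put-out : ∀ a y v {y′} → n ≤ y′ → put n a y v y′ ≡ a y′
  put-out a y v {y′} le rewrite ≥⇒<ᵇ-false le | ∧-zeroʳ (y′ ≡ᵇ y) = refl

  set-cell : ∀ {c s v} j y → y < n → Models c s →
             Models ⟨ var c , upd (arr c) j (put n (arr c j) y v) ⟩ (setMem s (y + j * n) v)
  set-cell j y y< r .vars = vars r
  set-cell j y y< r .size = size r
  set-cell {c} {s} {v} j y y< r .cells j′ y′ y′< with j′ ≡ᵇ j in ej
  ... | true with refl ← ≡ᵇ-true⇒≡ j′ j ej rewrite <⇒<ᵇ-true y′< | ∧-comm (y′ ≡ᵇ y) true
    with y′ ≡ᵇ y in ey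
  ...   | true with refl ← ≡ᵇ-true⇒≡ y′ y ey rewrite +-comm (j * n) y | ≡ᵇ-refl (y + j * n) = refl
  ...   | false rewrite ≢⇒≡ᵇ-false (j * n + y′) (y + j * n) (λ e →
            ≡ᵇ-false⇒≢ y′ y ey (proj₂ (cell-unique j j y′< y< (trans e (+-comm y (j * n))))))
          = cells r j y′ y′<
  set-cell {c} {s} {v} j y y< r .cells j′ y′ y′< | false
    rewrite ≢⇒≡ᵇ-false (j′ * n + y′) (y + j * n) (λ e →
            ≡ᵇ-false⇒≢ j′ j ej (proj₁ (cell-unique j′ j y′< y< (trans e (+-comm y (j * n))))))
          = cells r j′ y′ y′<
  set-cell {c} {v = v} j y y< r .out j′ y′ le with j′ ≡ᵇ j in ej
  ... | true with refl ← ≡ᵇ-true⇒≡ j′ j ej = trans (put-out (arr c j) y v le) (out r j y′ le)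
  ... | false = out r j′ y′ le

  put-illegal : ∀ a y v → n ≤ y → ∀ y′ → put n a y v y′ ≡ a y′
  put-illegal a y v le y′ with y′ ≡ᵇ y in ey
  ... | true with refl ← ≡ᵇ-true⇒≡ y′ y ey rewrite ≥⇒<ᵇ-false le = refl
  ... | false = refl

  no-cell : ∀ {c s v} j y → n ≤ y → Models c s →
            Models ⟨ var c , upd (arr c) j (put n (arr c j) y v) ⟩ s
  no-cell j y le r .vars = vars r
  no-cell j y le r .size = size r
  no-cell {c} {v = v} j y le r .cells j′ y′ y′< with j′ ≡ᵇ j in ej
  ... | true with refl ← ≡ᵇ-true⇒≡ j′ j ej =
    trans (cells r j y′ y′<) (sym (put-illegal (arr c j) y v le y′))
  ... | false = cells r j′ y′ y′<
  no-cell {c} {v = v} j y le r .out j′ y′ le′ with j′ ≡ᵇ j in ej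
  ... | true with refl ← ≡ᵇ-true⇒≡ j′ j ej = trans (put-out (arr c j) y v le′) (out r j y′ le′)
  ... | false = out r j′ y′ le′

  keeps-trans : ∀ {d s s′ s″} → Keeps d s s′ → Keeps d s′ s″ → Keeps d s s″
  keeps-trans k k′ = keeps λ p → trans (kept k′ p) (kept k p)

  subset-models : ∀ {c s} j → Models c s → subsetAt n s (j * n) ≡ ⟦ arr c j ⟧
  subset-models j r = tabulate-cong λ e → cong (λ v → not (v ≡ᵇ 0)) (cells r j (toℕ e) (toℕ<n e))

  set-ctr : ∀ {c s v} d → Models c s → Models c (setReg s (ctr d) v)
  set-ctr d = set-odd (3 + d)

  ctr-other : ∀ {s v} r d → r < d → reg (setReg s (ctr d) v) (ctr r) ≡ reg s (ctr r)
  ctr-other r d p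
    rewrite dbl-≡ᵇ r d | ≢⇒≡ᵇ-false r d (<⇒≢ p) = refl

  ctr-other′ : ∀ {s v} d → reg (setReg s (ctr d) v) (ctr (suc d)) ≡ reg s (ctr (suc d))
  ctr-other′ d
    rewrite dbl-≡ᵇ (suc d) d | ≢⇒≡ᵇ-false (suc d) d 1+n≢n = refl

  ctr-same : ∀ {s v} d → reg (setReg s (ctr d) v) (ctr d) ≡ v
  ctr-same d rewrite ≡ᵇ-refl (dbl d) = refl

  compile-correct : ∀ d c {st s} → Models st s → Outcome d c st s
  compile-correct d nop r = runs ⇓skip ≤-refl (r , keeps λ _ → refl)
  compile-correct d (x :=# k) r = runs ⇓const ≤-refl (set-var x r , keeps-var x d)
  compile-correct d (x := y) {st} {s} r = runs ⇓copy ≤-refl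
    (subst (λ v → Models ⟨ var st [ x ↦ v ] , arr st ⟩ _) (vars r y) (set-var x r) , keeps-var x d)
  compile-correct d (incr x) {st} {s} r = runs ⇓inc ≤-refl
    (subst (λ v → Models ⟨ var st [ x ↦ suc v ] , arr st ⟩ _) (vars r x) (set-var x r) , keeps-var x d)
  compile-correct d (decr x) {st} {s} r = runs ⇓dec ≤-refl
    (subst (λ v → Models ⟨ var st [ x ↦ pred v ] , arr st ⟩ _) (vars r x) (set-var x r) , keeps-var x d)
  compile-correct d (x ← j [ y ]) {st} {s} r =
    then-run (range-run y r) λ (r , c≡ , k) → if-run
      (λ nz → let y< = m<n∸o⇒o+m<n′ c≡ nz in
        then-run (runs ⇓copy ≤-refl (set-odd 0 r , vars r y , λ d → keeps (kept (k d))))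
          λ a → then-run (offset-run j a)
            λ {s′} (r , a , k) → runs ⇓load ≤-refl
              ( subst (λ v → Models ⟨ var st [ x ↦ v ] , arr st ⟩ (setReg s′ (dbl x) (State.mem s′ (reg s′ ra))))
                  (trans (cong (State.mem s′) (trans a (+-comm (var st y) (j * n)))) (cells r j (var st y) y<))
                  (set-var x r)
              , keeps-trans {d} (k d) (keeps-var x d)))
      (λ z → runs ⇓const (s≤s z≤n)
         ( subst (λ v → Models ⟨ var st [ x ↦ v ] , arr st ⟩ _) (sym (out r j (var st y) (m∸n≡0⇒m≤n (trans (sym c≡) z))))
             (set-var x r)
         , keeps-trans {d} (k d) (keeps-var x d)))
    where
    m<n∸o⇒o+m<n′ : ∀ {v w} → v ≡ n ∸ w → v ≢ 0 → w < n
    m<n∸o⇒o+m<n′ {v} {w} e nz = ≰⇒> λ le → nz (trans e (m≤n⇒m∸n≡0 le))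
  compile-correct d (j [ y ]← x) {st} {s} r =
    then-run (range-run y r) λ (r , c≡ , k) → if-run
      (λ nz → let y< = ≰⇒> λ le → nz (trans c≡ (m≤n⇒m∸n≡0 le)) in
        then-run (runs ⇓copy ≤-refl (set-odd 0 r , vars r y , λ d → keeps (kept (k d))))
          λ a → then-run (offset-run {s₀ = s} j a)
            λ {s′} (r , a , k) → runs ⇓store ≤-refl
              ( subst₂ (λ p v → Models ⟨ var st , upd (arr st) j (put n (arr st j) (var st y) (var st x)) ⟩ (setMem s′ p v))
                  (sym a) (sym (vars r x)) (set-cell j (var st y) y< r)
              , keeps (kept (k d))))
      (λ z → runs ⇓skip (s≤s z≤n)
         (no-cell j (var st y) (m∸n≡0⇒m≤n (trans (sym c≡) z)) r , k d))
  compile-correct d (ask x i j) {st} {s} r =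
    then-run (runs ⇓const ≤-refl (set-odd 0 r , refl , λ d → keeps λ _ → refl)) λ a →
      then-run (offset-run j a)
        λ {s′} (r , a , k) → runs ⇓query ≤-refl
          ( subst (λ v → Models ⟨ var st [ x ↦ v ] , arr st ⟩ (setReg s′ (dbl x) (bit (O i (subsetAt n s′ (reg s′ ra))))))
              (cong (bit ∘ O i) (trans (cong (subsetAt n s′) a) (subset-models j r)))
              (set-var x r)
          , keeps-trans {d} (k d) (keeps-var x d))
  compile-correct d (c ∙ c′) r =
    then-run (compile-correct d c r) λ (r , k) →
      weaken ≤-refl (λ (r , k′) → r , keeps-trans {d} k k′) (compile-correct d c′ r)
  compile-correct d (cond x c c′) {st} {s} r with var st x in e
  ... | zero  = if-run (λ nz → contradiction (trans (vars r x) e) nz)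
                       (λ _ → weaken (m≤n+m _ _) (λ q → q) (compile-correct d c′ r))
  ... | suc _ = if-run (λ _ → weaken (m≤m+n _ _) (λ q → q) (compile-correct d c r))
                       (λ z → contradiction (trans (sym e) (trans (sym (vars r x)) z)) λ ())
  compile-correct d (loop x c) {st} {s₀} r =
    then-run
      {Q = λ s → Models st s × reg s (ctr d) ≡ n × Keeps d s₀ s}
      (runs ⇓copy ≤-refl (set-ctr d r , trans (ctr-same {s₀} d) (size r) , keeps λ {q} p → ctr-other {s₀} q d p))
      λ {s} (r , e , k) → then-run
        {Q = λ s → reg s (ctr d) ≡ n × I n s}
        (runs ⇓copy ≤-refl ( trans (ctr-other {s} d (suc d) ≤-refl) e , _ , set-ctr (suc d) r
                           , cong (λ v → iterate (exec O c) st (v ⊓ n)) (trans (ctr-same {s} (suc d)) (vars r x))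
                           , keeps λ {q} p → trans (ctr-other {s} q (suc d) (m≤n⇒m≤1+n p)) (kept k p)))
        λ (e , i) → weaken ≤-refl (λ {s} (st′ , r , e , k) →
             subst (λ st → Models st s)
               (trans (cong (iterate (exec O c) st′) (sym (⊓-zeroʳ (reg s (ctr (suc d)))))) e) r , k)
          (drain-run I round n e i)
    where
    final′ : Store
    final′ = iterate (exec O c) st (var st x ⊓ n)
    -- With m machine rounds left, the second counter cut off at m says how many of them still
    -- execute c. For m = n this is the cut-off in the semantics of `loop`.
    I : ℕ → State → Set
    I m s = ∃[ st′ ] (Models st′ s × iterate (exec O c) st′ (reg s (ctr (suc d)) ⊓ m) ≡ final′ × Keeps d s₀ s)
    round : ∀ {m s} → reg s (ctr d) ≡ suc m → I (suc m) s →
      Runs (if ctr (suc d) then (dec (ctr (suc d)) ⨾ compile (2 + d) c) else skip fi)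
           (setReg s (ctr d) m) (2 + cost n c) (λ s′ → reg s′ (ctr d) ≡ m × I m s′)
    round {m} {s} e (st′ , r , f , k) = if-run
      (λ nz → then-run {b = 1}
        {Q = λ s′ → Models st′ s′ × reg s′ (ctr d) ≡ m ×
                    reg s′ (ctr (suc d)) ≡ pred (reg s (ctr (suc d))) × Keeps d s₀ s′}
        (runs ⇓dec ≤-refl
          ( set-ctr (suc d) (set-ctr d r)
          , trans (ctr-other {setReg s (ctr d) m} d (suc d) ≤-refl) (ctr-same {s} d)
          , trans (ctr-same {setReg s (ctr d) m} (suc d)) (cong pred (ctr-other′ {s} {m} d))
          , keeps λ {q} p → trans (ctr-other {setReg s (ctr d) m} q (suc d) (m≤n⇒m≤1+n p)) (trans (ctr-other {s} {m} q d p) (kept k p))))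
        λ (r , e , g , k) → weaken ≤-refl
          (λ (r , k′) → trans (kept k′ (m≤n⇒m≤1+n ≤-refl)) e , _ , r
             , trans (cong (λ v → iterate (exec O c) (exec O c st′) (v ⊓ m)) (trans (kept k′ ≤-refl) g))
                 (trans (step (reg s (ctr (suc d))) (λ z → nz (trans (ctr-other′ {s} d) z))) f)
             , keeps λ p → trans (kept k′ (m≤n⇒m≤1+n (m≤n⇒m≤1+n p))) (kept k p))
          (compile-correct (2 + d) c r))
      (λ z → runs ⇓skip (s≤s z≤n)
        ( ctr-same {s} d , st′ , set-ctr d r
        , trans (cong (λ v → iterate (exec O c) st′ (v ⊓ m)) z)
            (trans (cong (λ v → iterate (exec O c) st′ (v ⊓ suc m)) (sym (trans (sym (ctr-other′ {s} d)) z))) f)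
        , keeps λ {q} p → trans (ctr-other {s} q d p) (kept k p)))
      where
      step : ∀ v → v ≢ 0 → iterate (exec O c) (exec O c st′) (pred v ⊓ m) ≡ iterate (exec O c) st′ (v ⊓ suc m)
      step zero    nz = contradiction refl nz
      step (suc v) nz = refl
  compile-correct d (each c) r = all-run c (λ i → compile-correct d (c i)) r
    where
    all-run : ∀ {m} (f : Fin m → Com ℓ) → (∀ i {st s} → Models st s → Outcome d (f i) st s) →
      ∀ {st s} → Models st s →
      Runs (seqs (λ i → compile d (f i))) s (suc (∑ λ i → cost n (f i)))
           (λ s′ → Models (fold-each (λ i → exec O (f i)) st) s′ × Keeps d s s′)
    all-run {zero}  f h r = runs ⇓skip ≤-refl (r , keeps λ _ → refl)
    all-run {suc m} f h r = weaken (≤-reflexive (+-suc _ _)) (λ q → q)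
      (then-run (h zero r) λ (r , k) →
        weaken ≤-refl (λ (r , k′) → r , keeps-trans {d} k k′) (all-run (f ∘ suc) (h ∘ suc) r))

-- Framing, and induction over loops.

-- Both predicates compute, so that they are inferred for concrete programs.

SparesVar : ∀ {ℓ} → Com ℓ → ℕ → Set
SparesVar nop           y = ⊤
SparesVar (x :=# k)     y = T (not (y ≡ᵇ x))
SparesVar (x := z)      y = T (not (y ≡ᵇ x))
SparesVar (incr x)      y = T (not (y ≡ᵇ x))
SparesVar (decr x)      y = T (not (y ≡ᵇ x))
SparesVar (x ← j [ z ]) y = T (not (y ≡ᵇ x))
SparesVar (j [ z ]← x) y = ⊤
SparesVar (ask x i j)   y = T (not (y ≡ᵇ x))
SparesVar (c ∙ d)       y = SparesVar c y × SparesVar d y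
SparesVar (cond x c d)  y = SparesVar c y × SparesVar d y
SparesVar (loop x c)    y = SparesVar c y
SparesVar (each c)      y = ∀ i → SparesVar (c i) y

SparesArr : ∀ {ℓ} → Com ℓ → ℕ → Set
SparesArr (j′ [ z ]← x) j = T (not (j ≡ᵇ j′))
SparesArr (c ∙ d)        j = SparesArr c j × SparesArr d j
SparesArr (cond x c d)   j = SparesArr c j × SparesArr d j
SparesArr (loop x c)     j = SparesArr c j
SparesArr (each c)       j = ∀ i → SparesArr (c i) j
SparesArr _              j = ⊤

module _ {A : Set} where

  -- `iterate` unwinds at the front, so the induction has to start at a variable index o.
  iterate-ind : (P : ℕ → A → Set) (f : A → A) → ∀ o m {s} →
    (∀ i s → i < o + m → P i s → P (suc i) (f s)) → P o s → P (o + m) (iterate f s m)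
  iterate-ind P f o zero {s} h p = subst (λ k → P k s) (sym (+-identityʳ o)) p
  iterate-ind P f o (suc m) {s} h p = subst (λ k → P k (iterate f (f s) m)) (sym (+-suc o m))
    (iterate-ind P f (suc o) m (λ i s lt → h i s (≤-trans lt (≤-reflexive (sym (+-suc o m)))))
      (h o _ (m<m+n o z<s) p))

  each-ind : ∀ {m} (P : ℕ → A → Set) (f : Fin m → A → A) {s} →
    (∀ i s → P (toℕ i) s → P (suc (toℕ i)) (f i s)) → P 0 s → P m (fold-each f s)
  each-ind {zero}  P f h p = p
  each-ind {suc m} P f h p = each-ind (P ∘ suc) (f ∘ suc) (h ∘ suc) (h zero _ p)

T-not⇒≡false : ∀ {b} → T (not b) → b ≡ false
T-not⇒≡false {false} _ = refl

module _ {ℓ n : ℕ} (O : Oracles ℓ n) where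

  loop-unfold : ∀ x c s {m} → var s x ≡ m → m ≤ n → exec O (loop x c) s ≡ iterate (exec O c) s m
  loop-unfold x c s e m≤n = cong (iterate (exec O c) s) (trans (cong (_⊓ n) e) (m≤n⇒m⊓n≡m m≤n))

  loop-ind : (P : ℕ → Store → Set) → ∀ x c s {m} → var s x ≡ m → m ≤ n →
    (∀ i s → i < m → P i s → P (suc i) (exec O c s)) → P 0 s → P m (exec O (loop x c) s)
  loop-ind P x c s {m} e m≤n h p =
    subst (P m) (sym (loop-unfold x c s e m≤n)) (iterate-ind P (exec O c) 0 m h p)

  frame : ∀ (c : Com ℓ) {y} s → SparesVar c y → var (exec O c s) y ≡ var s y
  frame nop           s p = refl
  frame (x :=# k)     s p rewrite T-not⇒≡false p = refl
  frame (x := z)      s p rewrite T-not⇒≡false p = refl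
  frame (incr x)      s p rewrite T-not⇒≡false p = refl
  frame (decr x)      s p rewrite T-not⇒≡false p = refl
  frame (x ← j [ z ]) s p rewrite T-not⇒≡false p = refl
  frame (j [ z ]← x) s p = refl
  frame (ask x i j)   s p rewrite T-not⇒≡false p = refl
  frame (c ∙ d)       s (p , q) = trans (frame d (exec O c s) q) (frame c s p)
  frame (cond x c d)  s (p , q) with var s x
  ... | zero  = frame d s q
  ... | suc _ = frame c s p
  frame (loop x c) {y} s p =
    iterate-ind (λ _ s′ → var s′ y ≡ var s y) (exec O c) 0 (var s x ⊓ n)
      (λ _ s′ _ e → trans (frame c s′ p) e) refl
  frame (each c) {y} s p =
    each-ind (λ _ s′ → var s′ y ≡ var s y) (λ i → exec O (c i))
      (λ i s′ e → trans (frame (c i) s′ (p i)) e) refl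

  frame-arr : ∀ (c : Com ℓ) {j} s → SparesArr c j → arr (exec O c s) j ≡ arr s j
  frame-arr nop           s p = refl
  frame-arr (x :=# k)     s p = refl
  frame-arr (x := z)      s p = refl
  frame-arr (incr x)      s p = refl
  frame-arr (decr x)      s p = refl
  frame-arr (x ← j [ z ]) s p = refl
  frame-arr (j [ z ]← x) s p rewrite T-not⇒≡false p = refl
  frame-arr (ask x i j)   s p = refl
  frame-arr (c ∙ d)       s (p , q) = trans (frame-arr d (exec O c s) q) (frame-arr c s p)
  frame-arr (cond x c d)  s (p , q) with var s x
  ... | zero  = frame-arr d s q
  ... | suc _ = frame-arr c s p
  frame-arr (loop x c) {y} s p =
    iterate-ind (λ _ s′ → arr s′ y ≡ arr s y) (exec O c) 0 (var s x ⊓ n)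
      (λ _ s′ _ e → trans (frame-arr c s′ p) e) refl
  frame-arr (each c) {y} s p =
    each-ind (λ _ s′ → arr s′ y ≡ arr s y) (λ i → exec O (c i))
      (λ i s′ e → trans (frame-arr (c i) s′ (p i)) e) refl

-- Polynomial bounds.

-- The base is at least 2 even for n = 0, so that constants and sums are absorbed by the exponent.
PolyBounded : (ℕ → ℕ) → Set
PolyBounded f = ∃[ d ] (∀ n → f n ≤ (2 + n) ^ d)

2*-double : ∀ x → 2 * x ≡ x + x
2*-double x = cong (_+_ x) (+-identityʳ x)

m<2^m : ∀ m → m < 2 ^ m
m<2^m zero    = s≤s z≤n
m<2^m (suc m) rewrite 2*-double (2 ^ m) = +-mono-≤ (m^n>0 2 m) (m<2^m m)

poly-const : ∀ k → PolyBounded (λ _ → k)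
poly-const k = k , λ n → ≤-trans (<⇒≤ (m<2^m k)) (^-monoˡ-≤ k (m≤m+n 2 n))

poly-+ : ∀ {f g} → PolyBounded f → PolyBounded g → PolyBounded (λ n → f n + g n)
poly-+ (a , p) (b , q) = suc (a + b) , λ n → ≤-trans
  (+-mono-≤ (≤-trans (p n) (^-monoʳ-≤ (2 + n) (m≤m+n a b)))
            (≤-trans (q n) (^-monoʳ-≤ (2 + n) (m≤n+m b a))))
  (+-monoʳ-≤ ((2 + n) ^ (a + b)) (m≤m+n _ _))

poly-* : ∀ {f g} → PolyBounded f → PolyBounded g → PolyBounded (λ n → f n * g n)
poly-* (a , p) (b , q) = a + b , λ n → ≤-trans (*-mono-≤ (p n) (q n))
  (≤-reflexive (sym (^-distribˡ-+-* (2 + n) a b)))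

poly-id : PolyBounded (λ n → n)
poly-id = 1 , λ n → ≤-trans (m≤n+m n 2) (≤-reflexive (sym (*-identityʳ (2 + n))))

poly-∑ : ∀ {m} (f : Fin m → ℕ → ℕ) → (∀ i → PolyBounded (f i)) → PolyBounded (λ n → ∑ λ i → f i n)
poly-∑ {zero}  f h = poly-const 0
poly-∑ {suc m} f h = poly-+ (h zero) (poly-∑ (f ∘ suc) (h ∘ suc))

cost-poly : ∀ {ℓ} (c : Com ℓ) → PolyBounded (λ n → cost n c)
cost-poly nop           = poly-const 1
cost-poly (x :=# k)     = poly-const 1
cost-poly (x := y)      = poly-const 1
cost-poly (incr x)      = poly-const 1
cost-poly (decr x)      = poly-const 1
cost-poly (x ← j [ y ]) = poly-+ (poly-+ (poly-* poly-id (poly-const 5)) (poly-const 4))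
  (poly-+ (poly-const 2) (poly-+ (poly-+ (poly-* (poly-const j)
    (poly-+ (poly-const 2) (poly-* poly-id (poly-const 3)))) (poly-const 1)) (poly-const 1)))
cost-poly {ℓ} (j [ y ]← x) = cost-poly {ℓ} (0 ← j [ 0 ])
cost-poly (ask x i j)   = poly-+ (poly-const 1) (poly-+ (poly-+ (poly-* (poly-const j)
    (poly-+ (poly-const 2) (poly-* poly-id (poly-const 3)))) (poly-const 1)) (poly-const 1))
cost-poly (c ∙ d)       = poly-+ (cost-poly c) (cost-poly d)
cost-poly (cond x c d)  = poly-+ (poly-const 1) (poly-+ (cost-poly c) (cost-poly d))
cost-poly (loop x c)    =
  poly-+ (poly-const 3) (poly-* poly-id (poly-+ (poly-const 4) (cost-poly c)))
cost-poly (each c)      =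
  poly-+ (poly-const 1) (poly-∑ (λ i n → cost n (c i)) (λ i → cost-poly (c i)))

-- Finite sets, sums and finite quantifiers.

-- Subsets of Fin n, with elements given as natural numbers.

has : ∀ {n} → Subset n → ℕ → Bool
has []      e       = false
has (b ∷ S) zero    = b
has (b ∷ S) (suc e) = has S e

infixl 6 _⊕_ _⊖_

_⊕_ _⊖_ : ∀ {n} → Subset n → ℕ → Subset n
[]      ⊕ e     = []
(b ∷ S) ⊕ zero  = true ∷ S
(b ∷ S) ⊕ suc e = b ∷ (S ⊕ e)

[]      ⊖ e     = []
(b ∷ S) ⊖ zero  = false ∷ S
(b ∷ S) ⊖ suc e = b ∷ (S ⊖ e)

infix 4 _⊑_
record _⊑_ {n} (S S′ : Subset n) : Set where
  constructor within
  field at : ∀ e → has S e ≡ true → has S′ e ≡ true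
open _⊑_

has⇒< : ∀ {n} (S : Subset n) {e} → has S e ≡ true → e < n
has⇒< (b ∷ S) {zero}  p = z<s
has⇒< (b ∷ S) {suc e} p = s≤s (has⇒< S p)

has-⊕ : ∀ {n} (S : Subset n) {e} → e < n → has (S ⊕ e) e ≡ true
has-⊕ (b ∷ S) {zero}  p       = refl
has-⊕ (b ∷ S) {suc e} (s≤s p) = has-⊕ S p

has-⊕-≢ : ∀ {n} (S : Subset n) {e x} → x ≢ e → has (S ⊕ e) x ≡ has S x
has-⊕-≢ []      p = refl
has-⊕-≢ (b ∷ S) {zero}  {zero}  p = contradiction refl p
has-⊕-≢ (b ∷ S) {zero}  {suc x} p = refl
has-⊕-≢ (b ∷ S) {suc e} {zero}  p = refl
has-⊕-≢ (b ∷ S) {suc e} {suc x} p = has-⊕-≢ S (p ∘ cong suc)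

has-⊖ : ∀ {n} (S : Subset n) e → has (S ⊖ e) e ≡ false
has-⊖ []      e       = refl
has-⊖ (b ∷ S) zero    = refl
has-⊖ (b ∷ S) (suc e) = has-⊖ S e

has-⊖-≢ : ∀ {n} (S : Subset n) {e x} → x ≢ e → has (S ⊖ e) x ≡ has S x
has-⊖-≢ []      p = refl
has-⊖-≢ (b ∷ S) {zero}  {zero}  p = contradiction refl p
has-⊖-≢ (b ∷ S) {zero}  {suc x} p = refl
has-⊖-≢ (b ∷ S) {suc e} {zero}  p = refl
has-⊖-≢ (b ∷ S) {suc e} {suc x} p = has-⊖-≢ S (p ∘ cong suc)

has-ext : ∀ {n} {S S′ : Subset n} → (∀ e → e < n → has S e ≡ has S′ e) → S ≡ S′
has-ext {S = []}    {[]}     h = refl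
has-ext {S = b ∷ S} {b′ ∷ S′} h =
  cong₂ _∷_ (h 0 z<s) (has-ext λ e e< → h (suc e) (s≤s e<))

has-⟦⟧ : ∀ {n} a {e} → e < n → has {n} ⟦ a ⟧ e ≡ not (a e ≡ᵇ 0)
has-⟦⟧ {suc n} a {zero}  p       = refl
has-⟦⟧ {suc n} a {suc e} (s≤s p) = has-⟦⟧ (a ∘ suc) p

∣⊕∣ : ∀ {n} (S : Subset n) {e} → e < n → has S e ≡ false → ∣ S ⊕ e ∣ ≡ suc ∣ S ∣
∣⊕∣ (false ∷ S) {zero}  p       q = refl
∣⊕∣ (true  ∷ S) {suc e} (s≤s p) q = cong suc (∣⊕∣ S p q)
∣⊕∣ (false ∷ S) {suc e} (s≤s p) q = ∣⊕∣ S p q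

∣⊖∣ : ∀ {n} (S : Subset n) {e} → has S e ≡ true → suc ∣ S ⊖ e ∣ ≡ ∣ S ∣
∣⊖∣ (true  ∷ S) {zero}  q = refl
∣⊖∣ (true  ∷ S) {suc e} q = cong suc (∣⊖∣ S q)
∣⊖∣ (false ∷ S) {suc e} q = ∣⊖∣ S q

∈⇒has : ∀ {n} {S : Subset n} {e : Fin n} → e ∈ S → has S (toℕ e) ≡ true
∈⇒has here      = refl
∈⇒has (there p) = ∈⇒has p

has⇒∈ : ∀ {n} (S : Subset n) (e : Fin n) → has S (toℕ e) ≡ true → e ∈ S
has⇒∈ (true ∷ S) zero    p = here
has⇒∈ (b ∷ S)    (suc e) p = there (has⇒∈ S e p)

⊑⇒⊆ : ∀ {n} {S S′ : Subset n} → S ⊑ S′ → S ⊆ S′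
⊑⇒⊆ {S′ = S′} h {e} p = has⇒∈ S′ e (at h (toℕ e) (∈⇒has p))

⊆⇒⊑ : ∀ {n} {S S′ : Subset n} → S ⊆ S′ → S ⊑ S′
⊆⇒⊑ {n} {S} {S′} h .at e p = subst (λ x → has S′ x ≡ true) (toℕ-fromℕ< e<)
  (∈⇒has (h (has⇒∈ S (fromℕ< e<) (subst (λ x → has S x ≡ true) (sym (toℕ-fromℕ< e<)) p))))
  where e< = has⇒< S p

∉⇒has : ∀ {n} (S : Subset n) {e : Fin n} → e ∉ S → has S (toℕ e) ≡ false
∉⇒has S {e} p with has S (toℕ e) in eq
... | true  = contradiction (has⇒∈ S e eq) p
... | false = refl

∪⁅⁆≡⊕ : ∀ {n} (S : Subset n) (e : Fin n) → S ∪ ⁅ e ⁆ ≡ S ⊕ toℕ e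
∪⁅⁆≡⊕ (true  ∷ S) zero    = cong (true ∷_) (∪-identityʳ S)
∪⁅⁆≡⊕ (false ∷ S) zero    = cong (true ∷_) (∪-identityʳ S)
∪⁅⁆≡⊕ (b ∷ S)     (suc e) = cong₂ _∷_ (∨-identityʳ b) (∪⁅⁆≡⊕ S e)

⊑-⊕ : ∀ {n} (S : Subset n) e → S ⊑ S ⊕ e
⊑-⊕ S e .at x p with x ≟ e
... | yes refl = has-⊕ S (has⇒< S p)
... | no x≢e   = trans (has-⊕-≢ S x≢e) p

⊖-⊑ : ∀ {n} (S : Subset n) e → S ⊖ e ⊑ S
⊖-⊑ S e .at x p with x ≟ e
... | yes refl with () ← trans (sym p) (has-⊖ S e)
... | no x≢e   = trans (sym (has-⊖-≢ S x≢e)) p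

⊕-⊑ : ∀ {n} {S S′ : Subset n} {e} → S ⊑ S′ → has S′ e ≡ true → S ⊕ e ⊑ S′
⊕-⊑ {S = S} {e = e} h q .at x p with x ≟ e
... | yes refl = q
... | no x≢e   = at h x (trans (sym (has-⊕-≢ S x≢e)) p)

⊑-trans : ∀ {n} {S S′ S″ : Subset n} → S ⊑ S′ → S′ ⊑ S″ → S ⊑ S″
⊑-trans h h′ .at e p = at h′ e (at h e p)

⊕-mono-⊑ : ∀ {n} {S S′ : Subset n} {e} → S ⊑ S′ → S ⊕ e ⊑ S′ ⊕ e
⊕-mono-⊑ {S = S} {S′} {e} h .at x p with x ≟ e
... | yes refl = has-⊕ S′ (has⇒< (S ⊕ e) p)
... | no x≢e   = trans (has-⊕-≢ S′ x≢e) (at h x (trans (sym (has-⊕-≢ S x≢e)) p))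

⊑-⊖ : ∀ {n} {S S′ : Subset n} {d} → S ⊑ S′ → has S d ≡ false → S ⊑ S′ ⊖ d
⊑-⊖ {S′ = S′} {d} h q .at x p with x ≟ d
... | yes refl with () ← trans (sym p) q
... | no x≢d   = trans (has-⊖-≢ S′ x≢d) (at h x p)

⊖⊕ : ∀ {n} (S : Subset n) {d} → has S d ≡ true → S ⊖ d ⊕ d ≡ S
⊖⊕ (true ∷ S) {zero}  p = refl
⊖⊕ (b ∷ S)    {suc d} p = cong (b ∷_) (⊖⊕ S p)

⊕⊖ : ∀ {n} (S : Subset n) {d} → has S d ≡ false → S ⊕ d ⊖ d ≡ S
⊕⊖ []          p = refl
⊕⊖ (false ∷ S) {zero}  p = refl
⊕⊖ (b ∷ S)     {suc d} p = cong (b ∷_) (⊕⊖ S p)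

⊑⇒∣≤∣ : ∀ {n} {S S′ : Subset n} → S ⊑ S′ → ∣ S ∣ ≤ ∣ S′ ∣
⊑⇒∣≤∣ h = p⊆q⇒∣p∣≤∣q∣ (⊑⇒⊆ h)

∣<∣⇒∃ : ∀ {n} (S S′ : Subset n) → ∣ S ∣ < ∣ S′ ∣ → ∃[ d ] (has S′ d ≡ true × has S d ≡ false)
∣<∣⇒∃ (true  ∷ S) (true  ∷ S′) (s≤s p) = map suc (λ q → q) (∣<∣⇒∃ S S′ p)
∣<∣⇒∃ (true  ∷ S) (false ∷ S′) p       = map suc (λ q → q) (∣<∣⇒∃ S S′ (<-trans (n<1+n _) p))
∣<∣⇒∃ (false ∷ S) (true  ∷ S′) p       = 0 , refl , refl
∣<∣⇒∃ (false ∷ S) (false ∷ S′) p       = map suc (λ q → q) (∣<∣⇒∃ S S′ p)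

⊑-∣≥∣⇒≡ : ∀ {n} {S S′ : Subset n} → S ⊑ S′ → ∣ S′ ∣ ≤ ∣ S ∣ → S ≡ S′
⊑-∣≥∣⇒≡ {n} {S} {S′} h le = has-ext same
  where
  same : ∀ e → e < n → has S e ≡ has S′ e
  same e e< with has S e in p | has S′ e in q
  ... | true  | true  = refl
  ... | false | false = refl
  ... | true  | false with () ← trans (sym (at h e p)) q
  ... | false | true  = contradiction (⊑⇒∣≤∣ (⊕-⊑ {e = e} h q))
    (<⇒≱ (≤-trans (s≤s le) (≤-reflexive (sym (∣⊕∣ S e< p)))))

∑-mono : ∀ {m} {f g : Fin m → ℕ} → (∀ i → f i ≤ g i) → ∑ f ≤ ∑ g
∑-mono {zero}  h = z≤n
∑-mono {suc m} h = +-mono-≤ (h zero) (∑-mono (h ∘ suc))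

∑-mono-< : ∀ {m} {f g : Fin m → ℕ} → (∀ i → f i ≤ g i) → ∀ i → f i < g i → ∑ f < ∑ g
∑-mono-< h zero    lt = +-mono-≤ lt (∑-mono (h ∘ suc))
∑-mono-< h (suc i) lt = +-mono-≤-< (h zero) (∑-mono-< (h ∘ suc) i lt)

∑-const : ∀ m c → ∑ {m} (λ _ → c) ≡ m * c
∑-const zero    c = refl
∑-const (suc m) c = cong (_+_ c) (∑-const m c)

allF anyF : ∀ {m} → (Fin m → Bool) → Bool
allF {zero}  f = true
allF {suc m} f = f zero ∧ allF (f ∘ suc)
anyF {zero}  f = false
anyF {suc m} f = f zero ∨ anyF (f ∘ suc)

allF-true : ∀ {m} (f : Fin m → Bool) → allF f ≡ true → ∀ i → f i ≡ true
allF-true f p zero with f zero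
... | true = refl
allF-true f p (suc i) with f zero
... | true = allF-true (f ∘ suc) p i

true-allF : ∀ {m} (f : Fin m → Bool) → (∀ i → f i ≡ true) → allF f ≡ true
true-allF {zero}  f h = refl
true-allF {suc m} f h rewrite h zero = true-allF (f ∘ suc) (h ∘ suc)

allF-cong : ∀ {m} {f g : Fin m → Bool} → (∀ i → f i ≡ g i) → allF f ≡ allF g
allF-cong {zero}  h = refl
allF-cong {suc m} h = cong₂ _∧_ (h zero) (allF-cong (h ∘ suc))

anyF-cong : ∀ {m} {f g : Fin m → Bool} → (∀ i → f i ≡ g i) → anyF f ≡ anyF g
anyF-cong {zero}  h = refl
anyF-cong {suc m} h = cong₂ _∨_ (h zero) (anyF-cong (h ∘ suc))

anyF-true : ∀ {m} (f : Fin m → Bool) → anyF f ≡ true → ∃[ i ] f i ≡ true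
anyF-true {suc m} f p with f zero in eq
... | true  = zero , eq
... | false = map suc (λ q → q) (anyF-true (f ∘ suc) p)

anyF-false : ∀ {m} (f : Fin m → Bool) → anyF f ≡ false → ∀ i → f i ≡ false
anyF-false f p zero with f zero
... | false = refl
anyF-false f p (suc i) with f zero
... | false = anyF-false (f ∘ suc) p i

prepend : ∀ {m} → (Fin m → Bool) → (ℕ → Bool) → ℕ → Bool
prepend {zero}  v α p       = α p
prepend {suc m} v α zero    = v zero
prepend {suc m} v α (suc p) = prepend (v ∘ suc) α p

prepend-toℕ : ∀ {m} (v : Fin m → Bool) α i → prepend v α (toℕ i) ≡ v i
prepend-toℕ v α zero    = refl
prepend-toℕ v α (suc i) = prepend-toℕ (v ∘ suc) α i

prepend-+ : ∀ {m} (v : Fin m → Bool) α p → prepend v α (m + p) ≡ α p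
prepend-+ {zero}  v α p = refl
prepend-+ {suc m} v α p = prepend-+ (v ∘ suc) α p

-- The search for replacements as a function.

module Search {ℓ n : ℕ} (O : Oracles ℓ n) where

  fits : (Fin ℓ → Subset n) → ℕ → Bool
  fits S e = allF λ i → not (has (S i) e) ∧ O i (S i ⊕ e)

  -- 0 if there is no fitting element below m, otherwise the successor of one.
  pick : (Fin ℓ → Subset n) → ℕ → ℕ
  pick S zero    = 0
  pick S (suc m) = if fits S m then suc m else pick S m

  pick-cong : ∀ {S S′} → (∀ i → S′ i ≡ S i) → ∀ m → pick S′ m ≡ pick S m
  pick-cong h zero    = refl
  pick-cong {S} {S′} h (suc m)
    rewrite allF-cong {f = λ i → not (has (S′ i) m) ∧ O i (S′ i ⊕ m)}
                      (λ i → cong (λ X → not (has X m) ∧ O i (X ⊕ m)) (h i))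
          | pick-cong {S} {S′} h m = refl

  pick-fits : ∀ S m {e} → pick S m ≡ suc e → fits S e ≡ true × e < m
  pick-fits S (suc m) p with fits S m in eq
  pick-fits S (suc m) refl | true = eq , ≤-refl
  ... | false = map (λ q → q) m≤n⇒m≤1+n (pick-fits S m p)

  fits-pick : ∀ S m {e} → fits S e ≡ true → e < m → pick S m ≢ 0
  fits-pick S (suc m) {e} q lt p with fits S m in eq
  ... | false with e ≟ m
  ...   | yes refl with () ← trans (sym q) eq
  ...   | no e≢m = fits-pick S m q (≤∧≢⇒< (≤-pred lt) e≢m) p

  -- The first argument is a result of `pick`, the second tells whether some advice bit is set. No
  -- bit set means that e lies in none of the hyperplanes: it replaces the deleted element for good,
  -- and in `growS` all sets restart from the enlarged T.
  growT : ℕ → Bool → Subset n → Subset n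
  growT zero    b T = T
  growT (suc e) b T = if b then T else T ⊕ e

  growS : ℕ → Bool → (Fin ℓ → Bool) → Subset n → (Fin ℓ → Subset n) → Fin ℓ → Subset n
  growS zero    b v T S i = S i
  growS (suc e) b v T S i = if b then (if v i then S i ⊕ e else S i) else T ⊕ e

  growS-cong : ∀ {p p′ b b′ v v′ T S S′ i} → p′ ≡ p → b′ ≡ b → v′ i ≡ v i → S′ i ≡ S i →
               growS p′ b′ v′ T S′ i ≡ growS p b v T S i
  growS-cong {zero}  refl refl v≡ S≡ = S≡
  growS-cong {suc e} refl refl v≡ S≡ rewrite v≡ | S≡ = refl

  -- A round spends ℓ bits of α even if `pick` finds nothing, so the place of each bit is fixed in
  -- advance.
  walk : ℕ → (ℕ → Bool) → Subset n → (Fin ℓ → Subset n) → Subset n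
  walk zero    α T S = T
  walk (suc w) α T S =
    walk w (λ p → α (ℓ + p)) (growT (pick S n) (anyF {ℓ} (α ∘ toℕ)) T)
                             (growS (pick S n) (anyF {ℓ} (α ∘ toℕ)) (α ∘ toℕ) T S)

  blocked : Subset n → ℕ → Bool
  blocked T zero    = true
  blocked T (suc m) = blocked T m ∧ (has T m ∨ allF (λ i → not (O i (T ⊕ m))))

  accepts : Subset n → Bool
  accepts T = allF (λ i → O i T) ∧ blocked T n

  blocked-true : ∀ T m → blocked T m ≡ true →
    ∀ {e} → e < m → has T e ≡ false → ∀ i → O i (T ⊕ e) ≡ false
  blocked-true T (suc m) p {e} lt q i with blocked T m in eq
  ... | true with e ≟ m
  ...   | no e≢m = blocked-true T m eq (≤∧≢⇒< (≤-pred lt) e≢m) q i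
  ...   | yes refl rewrite q with O i (T ⊕ e) in r
  ...     | false = refl
  ...     | true with () ← trans (sym (allF-true _ p i)) (cong not r)

  true-blocked : ∀ T m → (∀ {e} → e < m → has T e ≡ false → ∀ i → O i (T ⊕ e) ≡ false) →
    blocked T m ≡ true
  true-blocked T zero    h = refl
  true-blocked T (suc m) h rewrite true-blocked T m (λ lt → h (m≤n⇒m≤1+n lt))
    with has T m in eq
  ... | true  = refl
  ... | false = true-allF _ λ i → cong not (h ≤-refl eq i)

-- Bases and hyperplanes of a matroid.

module MatroidLemmas {n : ℕ} (M : Matroid n) where
  open Matroid M

  indep⇒does : ∀ {S} → Indep S → does (indep? S) ≡ true
  indep⇒does {S} p with indep? S
  ... | yes _ = refl
  ... | no ¬p = contradiction p ¬p

  does⇒indep : ∀ {S} → does (indep? S) ≡ true → Indep S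
  does⇒indep {S} p with indep? S
  ... | yes q = q

  ¬indep⇒does : ∀ {S} → ¬ Indep S → does (indep? S) ≡ false
  ¬indep⇒does {S} p with indep? S
  ... | yes q = contradiction q p
  ... | no _  = refl

  does⇒¬indep : ∀ {S} → does (indep? S) ≡ false → ¬ Indep S
  does⇒¬indep {S} p with indep? S
  ... | no q = q

  indep-⊑ : ∀ {A B} → Indep A → B ⊑ A → Indep B
  indep-⊑ p h = ⊆-indep p (⊑⇒⊆ h)

  augment : ∀ {A B} → Indep A → Indep B → ∣ B ∣ < ∣ A ∣ →
            ∃[ e ] (has A e ≡ true × has B e ≡ false × Indep (B ⊕ e))
  augment {A} {B} p q lt with e , e∈ , e∉ , r ← augmentation p q lt =
    toℕ e , ∈⇒has e∈ , ∉⇒has B e∉ , subst Indep (∪⁅⁆≡⊕ B e) r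

  -- Bases are handled through their size, because exchanging one element for another keeps the size
  -- and only independence remains to be shown.
  IsMaximum : Subset n → Set
  IsMaximum B = Indep B × (∀ C → Indep C → ∣ C ∣ ≤ ∣ B ∣)

  basis⇒maximum : ∀ {B} → IsBasis B → IsMaximum B
  basis⇒maximum {B} (b , max) = b , λ C c → ≮⇒≥ λ lt → grow C c lt
    where
    grow : ∀ C → Indep C → ¬ ∣ B ∣ < ∣ C ∣
    grow C c lt with e , p , q , r ← augment c b lt
      with () ← trans (sym q) (subst (λ X → has X e ≡ true) (max r (⊑⇒⊆ (⊑-⊕ B e)))
                                 (has-⊕ B (has⇒< C p)))

  maximum-blocks : ∀ {B} → IsMaximum B → ∀ {e} → e < n → has B e ≡ false → ¬ Indep (B ⊕ e)
  maximum-blocks {B} (_ , max) e< q r =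
    <⇒≱ (≤-reflexive (sym (∣⊕∣ B e< q))) (max _ r)

  -- S lies in the hyperplane spanned by B ⊖ d.
  Below : Subset n → ℕ → Subset n → Set
  Below B d S = ∀ x → has S x ≡ true → has (B ⊖ d) x ≡ true ⊎ ¬ Indep (B ⊖ d ⊕ x)

  below-⊑ : ∀ {B d S} → S ⊑ B ⊖ d → Below B d S
  below-⊑ h x p = inj₁ (at h x p)

  below-⊕ : ∀ {B d S e} → Below B d S →
    has (B ⊖ d) e ≡ true ⊎ ¬ Indep (B ⊖ d ⊕ e) → Below B d (S ⊕ e)
  below-⊕ {S = S} {e} h q x p with x ≟ e
  ... | yes refl = q
  ... | no x≢e   = h x (trans (sym (has-⊕-≢ S x≢e)) p)

  module _ {B d} (B-max : IsMaximum B) (d∈B : has B d ≡ true) where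

    -- Otherwise S is larger than `B ⊖ d` and augments it by some x in S; but `Below` says that no
    -- element of S outside `B ⊖ d` can be added.
    below-size : ∀ {S} → Indep S → Below B d S → ∣ S ∣ < ∣ B ∣
    below-size {S} s h = ≤-trans (s≤s (≮⇒≥ too-big)) (≤-reflexive (∣⊖∣ B d∈B))
      where
      too-big : ¬ ∣ B ⊖ d ∣ < ∣ S ∣
      too-big lt with augment s (indep-⊑ (proj₁ B-max) (⊖-⊑ B d)) lt
      ... | x , p , q , r with h x p
      ...   | inj₁ q′ with () ← trans (sym q) q′
      ...   | inj₂ r′ = r′ r

    -- Adding d to `B ⊖ d` gives B back, which is independent, so d is outside the hyperplane.
    below-avoids : ∀ {S} → Below B d S → has S d ≡ false
    below-avoids {S} h with has S d in eq
    ... | false = refl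
    ... | true with h d eq
    ...   | inj₁ q with () ← trans (sym q) (has-⊖ B d)
    ...   | inj₂ r = contradiction (subst Indep (sym (⊖⊕ B d∈B)) (proj₁ B-max)) r

    -- Augment S from B repeatedly. An element other than d belongs to `B ⊖ d`, so the set stays in
    -- the hyperplane and smaller than B; hence d is added sooner or later. Here m bounds the
    -- augmentations left.
    below-extends : ∀ m {S} → ∣ B ∣ ≤ ∣ S ∣ + m → Indep S → Below B d S → Indep (S ⊕ d)
    below-extends zero {S} le s h =
      contradiction (≤-trans le (≤-reflexive (+-identityʳ ∣ S ∣))) (<⇒≱ (below-size s h))
    below-extends (suc m) {S} le s h with augment (proj₁ B-max) s (below-size s h)
    ... | x , p , q , r with x ≟ d
    ...   | yes refl = r
    ...   | no x≢d = indep-⊑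
      (below-extends m (≤-trans le (≤-reflexive (trans (+-suc ∣ S ∣ m)
          (cong (_+ m) (sym (∣⊕∣ S (has⇒< B p) q))))))
        r (below-⊕ {S = S} {x} h (inj₁ (trans (has-⊖-≢ B x≢d) p))))
      (⊕-mono-⊑ (⊑-⊕ S x))

-- Existence of advice that leads to a common basis.

module _ {ℓ n : ℕ} (M : Instance ℓ n) where
  open Search (oracles M)
  private module L i = MatroidLemmas (M i)

  CommonMaximum : Subset n → Set
  CommonMaximum B = ∀ i → L.IsMaximum i B

  common-basis⇒maximum : ∀ {B} → (∀ i → Matroid.IsBasis (M i) B) → CommonMaximum B
  common-basis⇒maximum h i = L.basis⇒maximum i (h i)

  maximum⇒accepts : ∀ {B} → CommonMaximum B → accepts B ≡ true
  maximum⇒accepts {B} h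
    rewrite true-allF (λ i → oracles M i B) (λ i → L.indep⇒does i (proj₁ (h i))) =
    true-blocked B n λ e< q i → L.¬indep⇒does i (L.maximum-blocks i (h i) e< q)

  accepts⇒common-basis : ∀ {B} → accepts B ≡ true → ∀ i → Matroid.IsBasis (M i) B
  accepts⇒common-basis {B} p i with allF (λ i → oracles M i B) in eq
  ... | true = b , λ {C} c h → sym (⊑-∣≥∣⇒≡ (⊆⇒⊑ h) (≮⇒≥ (too-big c h)))
    where
    b = L.does⇒indep i (allF-true _ eq i)
    too-big : ∀ {C} → Matroid.Indep (M i) C → B ⊆ C → ¬ ∣ B ∣ < ∣ C ∣
    too-big {C} c h lt with e , q , r ← ∣<∣⇒∃ B C lt =
      L.does⇒¬indep i (blocked-true B n p (has⇒< C q) r i)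
        (L.indep-⊑ i c (⊕-⊑ {e = e} (⊆⇒⊑ h) q))

  -- The advice has to work for all α′ and S′ that agree pointwise with the given ones, α′ on the
  -- first `W * ℓ` bits only. This stands in for function extensionality and lets the advice be read
  -- off a finite string.
  Completes : ℕ → Subset n → (Fin ℓ → Subset n) → Set
  Completes W T S = Σ[ α ∈ (ℕ → Bool) ] (∀ α′ S′ → (∀ p → p < W * ℓ → α′ p ≡ α p) → (∀ i → S′ i ≡ S i) →
                             CommonMaximum (walk W α′ T S′))

  module _ (ℓ>0 : 0 < ℓ) (k : ℕ) where

    -- A fitting element would extend a set of maximum size in some matroid, and there is one as ℓ >
    -- 0. Rounds left over after the last replacement are therefore idle.
    maximum-pick : ∀ {T S} → CommonMaximum T → (∀ i → S i ≡ T) → pick S n ≡ 0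
    maximum-pick {T} {S} h S≡ with pick S n in eq
    ... | zero  = refl
    ... | suc e with f , e< ← pick-fits S n eq = ⊥-elim (absurd (fromℕ< ℓ>0))
      where
      absurd : Fin ℓ → ⊥
      absurd i with g ← allF-true _ f i rewrite S≡ i with has T e in q
      ... | false = L.maximum-blocks i (h i) e< q (L.does⇒indep i g)

    walk-stays : ∀ W {T S} α → pick S n ≡ 0 → walk W α T S ≡ T
    walk-stays zero    α p = refl
    walk-stays (suc w) {T} {S} α p rewrite p = walk-stays w {T} {S} (λ q → α (ℓ + q)) p

    -- Proved together with `phase`, with W as the budget of rounds: T lacks r elements of B, and
    -- each costs at most `ℓ * k` rounds. The element d handed to `phase` is known to the proof
    -- only, not to the search.
    start : ∀ W r {T B S} → CommonMaximum B → T ⊑ B → ∣ B ∣ ≡ ∣ T ∣ + r → r ≤ k →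
            r * (ℓ * k) ≤ W → (∀ i → S i ≡ T) → Completes W T S

    -- The sum of the deficits `∣ B ∣ ∸ ∣ S i ∣` bounds the rounds until d is replaced. It is
    -- positive throughout, since sets in a hyperplane stay smaller than B. The term `r * (ℓ * k)`
    -- is reserved for the elements still missing afterwards.
    phase : ∀ W r {T B S d} → CommonMaximum B → has B d ≡ true → T ⊑ B ⊖ d →
            ∣ B ∣ ≡ ∣ T ∣ + suc r → suc r ≤ k →
            (∀ i → Matroid.Indep (M i) (S i)) → (∀ i → L.Below i B d (S i)) →
            ∑ (λ i → ∣ B ∣ ∸ ∣ S i ∣) + r * (ℓ * k) ≤ W → Completes W T S

    start W zero {T} {B} {S} max T⊑B size _ _ S≡ = (λ _ → false) , λ α′ S′ _ S′≡ →
      subst CommonMaximum (sym (walk-stays W {T} {S′} α′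
        (maximum-pick T-max (λ i → trans (S′≡ i) (S≡ i))))) T-max
      where
      T-max = subst CommonMaximum
        (sym (⊑-∣≥∣⇒≡ T⊑B (≤-reflexive (trans size (+-identityʳ ∣ T ∣))))) max
    start W (suc r) {T} {B} {S} max T⊑B size r≤ W≥ S≡
      with d , d∈ , d∉ ← ∣<∣⇒∃ T B (≤-trans (m<m+n ∣ T ∣ z<s) (≤-reflexive (sym size))) =
      phase W r max d∈ (⊑-⊖ T⊑B d∉) size r≤
        (λ i → subst (Matroid.Indep (M i)) (sym (S≡ i)) (L.indep-⊑ i (proj₁ (max i)) T⊑B))
        (λ i → subst (L.Below i B d) (sym (S≡ i)) (L.below-⊑ i (⊑-⊖ T⊑B d∉)))
        (≤-trans (+-monoˡ-≤ (r * (ℓ * k)) deficit) W≥)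
      where
      deficit : ∑ (λ i → ∣ B ∣ ∸ ∣ S i ∣) ≤ ℓ * k
      deficit = ≤-trans (∑-mono {g = λ _ → suc r} λ i → ≤-reflexive
          (trans (cong₂ _∸_ size (cong ∣_∣ (S≡ i))) (m+n∸m≡n ∣ T ∣ (suc r))))
        (≤-trans (≤-reflexive (∑-const ℓ (suc r))) (*-monoʳ-≤ ℓ r≤))

    phase W r {T} {B} {S} {d} max d∈B T⊑H size r≤ ind below W≥ = go W W≥
      where
      size< : ∀ i → ∣ S i ∣ < ∣ B ∣
      size< i = L.below-size i (max i) d∈B (ind i) (below i)

      room : 0 < ∑ (λ i → ∣ B ∣ ∸ ∣ S i ∣)
      room = ≤-trans (≤-trans ℓ>0 (≤-reflexive (sym (trans (∑-const ℓ 1) (*-identityʳ ℓ)))))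
        (∑-mono {f = λ _ → 1} λ i → m<n⇒0<n∸m (size< i))

      -- As d fits, `pick` succeeds, though it may return another element.
      d-fits : fits S d ≡ true
      d-fits = true-allF _ λ i → trans
        (cong (λ b → not b ∧ oracles M i (S i ⊕ d)) (L.below-avoids i (max i) d∈B {S i} (below i)))
        (L.indep⇒does i (L.below-extends i (max i) d∈B ∣ B ∣ (m≤n+m ∣ B ∣ ∣ S i ∣) (ind i) (below i)))

      go : ∀ W → ∑ (λ i → ∣ B ∣ ∸ ∣ S i ∣) + r * (ℓ * k) ≤ W → Completes W T S
      go zero    W≥ = contradiction (≤-trans room (≤-trans (m≤m+n _ _) W≥)) λ ()
      go (suc w) W≥ with pick S n in eq
      ... | zero  = contradiction eq (fits-pick S n d-fits (has⇒< B d∈B))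
      ... | suc e with e-fits , e<n ← pick-fits S n eq = by-cases (anyF v) refl
        where
        -- Does e lie in the hyperplane of the i-th matroid?
        v : Fin ℓ → Bool
        v i = has (B ⊖ d) e ∨ not (oracles M i (B ⊖ d ⊕ e))

        fresh : ∀ i → has (S i) e ≡ false
        fresh i with has (S i) e | allF-true _ e-fits i
        ... | false | _ = refl

        grows : ∀ i → Matroid.Indep (M i) (S i ⊕ e)
        grows i with has (S i) e | allF-true _ e-fits i
        ... | false | g = L.does⇒indep i g

        covered : ∀ i → v i ≡ true → has (B ⊖ d) e ≡ true ⊎ ¬ Matroid.Indep (M i) (B ⊖ d ⊕ e)
        covered i p with has (B ⊖ d) e
        ... | true  = inj₁ refl
        ... | false with oracles M i (B ⊖ d ⊕ e) in q
        ...   | false = inj₂ (L.does⇒¬indep i q)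

        exposed : ∀ i → v i ≡ false → has (B ⊖ d) e ≡ false × Matroid.Indep (M i) (B ⊖ d ⊕ e)
        exposed i p with has (B ⊖ d) e
        ... | false with oracles M i (B ⊖ d ⊕ e) in q
        ...   | true = refl , L.does⇒indep i q

        extend : ∀ {T₁ S₁} → growT (suc e) (anyF v) T ≡ T₁ →
                 (∀ i → growS (suc e) (anyF v) v T S i ≡ S₁ i) →
                 Completes w T₁ S₁ → Completes (suc w) T S
        extend {T₁} {S₁} T₁≡ S₁≡ (α , h) = prepend v α , result
          where
          result : ∀ α′ S′ → (∀ p → p < suc w * ℓ → α′ p ≡ prepend v α p) → (∀ i → S′ i ≡ S i) →
                   CommonMaximum (walk (suc w) α′ T S′)
          result α′ S′ α≡ S′≡ = subst CommonMaximum
            (cong (λ T → walk w (λ p → α′ (ℓ + p)) T S″) (sym T≡))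
            (h (λ p → α′ (ℓ + p)) S″
              (λ p p< → trans (α≡ (ℓ + p) (+-monoʳ-< ℓ p<)) (prepend-+ v α p))
              (λ i → trans (S″≡ i) (S₁≡ i)))
            where
            v≡ : ∀ i → α′ (toℕ i) ≡ v i
            v≡ i = trans (α≡ (toℕ i) (≤-trans (toℕ<n i) (m≤m+n ℓ (w * ℓ)))) (prepend-toℕ v α i)
            p≡ : pick S′ n ≡ suc e
            p≡ = trans (pick-cong S′≡ n) eq
            S″ : Fin ℓ → Subset n
            S″ = growS (pick S′ n) (anyF {ℓ} (α′ ∘ toℕ)) (α′ ∘ toℕ) T S′
            T≡ : growT (pick S′ n) (anyF {ℓ} (α′ ∘ toℕ)) T ≡ T₁
            T≡ = trans (cong₂ (λ p b → growT p b T) p≡ (anyF-cong v≡)) T₁≡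
            S″≡ : ∀ i → S″ i ≡ growS (suc e) (anyF v) v T S i
            S″≡ i = growS-cong {v = v} {α′ ∘ toℕ} {T} {S} {S′} p≡ (anyF-cong v≡) (v≡ i) (S′≡ i)

        by-cases : ∀ b → anyF v ≡ b → Completes (suc w) T S
        -- Here e lies in some hyperplane. Exactly the sets S i of those matroids grow, they remain
        -- in their hyperplanes, and the drop of the deficit pays for the round.
        by-cases true ev = extend {T} {λ i → if v i then S i ⊕ e else S i}
          (cong (λ b → growT (suc e) b T) ev) (λ i → cong (λ b → growS (suc e) b v T S i) ev)
          (phase w r max d∈B T⊑H size r≤ ind′ below′
            (≤-pred (≤-trans (+-monoˡ-< (r * (ℓ * k)) decreases) W≥)))
          where
          ind′ : ∀ i → Matroid.Indep (M i) (if v i then S i ⊕ e else S i)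
          ind′ i with v i
          ... | true  = grows i
          ... | false = ind i
          below′ : ∀ i → L.Below i B d (if v i then S i ⊕ e else S i)
          below′ i with v i in q
          ... | true  = L.below-⊕ i {S = S i} (below i) (covered i q)
          ... | false = below i
          shrinks : ∀ i → v i ≡ true →
            ∣ B ∣ ∸ ∣ if v i then S i ⊕ e else S i ∣ < ∣ B ∣ ∸ ∣ S i ∣
          shrinks i q rewrite q | ∣⊕∣ (S i) e<n (fresh i) = ∸-monoʳ-< ≤-refl (size< i)
          shrinks′ : ∀ i → ∣ B ∣ ∸ ∣ if v i then S i ⊕ e else S i ∣ ≤ ∣ B ∣ ∸ ∣ S i ∣
          shrinks′ i with v i in q
          ... | true  = ∸-monoʳ-≤ ∣ B ∣ (⊑⇒∣≤∣ (⊑-⊕ (S i) e))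
          ... | false = ≤-refl
          decreases : ∑ (λ i → ∣ B ∣ ∸ ∣ if v i then S i ⊕ e else S i ∣) < ∑ (λ i → ∣ B ∣ ∸ ∣ S i ∣)
          decreases with i , q ← anyF-true v ev = ∑-mono-< shrinks′ i (shrinks i q)
        -- Here e lies in no hyperplane, so `B ⊖ d ⊕ e` is independent everywhere and has the size
        -- of B. It takes the place of B and contains `T ⊕ e`; the deficit, still positive, pays for
        -- the round.
        by-cases false ev = extend {T ⊕ e} {λ _ → T ⊕ e}
          (cong (λ b → growT (suc e) b T) ev) (λ i → cong (λ b → growS (suc e) b v T S i) ev)
          (start w r max′ (⊕-mono-⊑ T⊑H) size′ (≤-trans (n≤1+n r) r≤)
            (≤-pred (≤-trans (+-monoˡ-≤ (r * (ℓ * k)) room) W≥)) (λ _ → refl))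
          where
          e∉H = proj₁ (exposed (fromℕ< ℓ>0) (anyF-false v ev _))
          same : ∣ B ⊖ d ⊕ e ∣ ≡ ∣ B ∣
          same = trans (∣⊕∣ (B ⊖ d) e<n e∉H) (∣⊖∣ B d∈B)
          max′ : CommonMaximum (B ⊖ d ⊕ e)
          max′ i = proj₂ (exposed i (anyF-false v ev i)) ,
            λ C c → ≤-trans (proj₂ (max i) C c) (≤-reflexive (sym same))
          e∉T : has T e ≡ false
          e∉T with has T e in q
          ... | false = refl
          ... | true with () ← trans (sym e∉H) (at T⊑H e q)
          size′ : ∣ B ⊖ d ⊕ e ∣ ≡ ∣ T ⊕ e ∣ + r
          size′ = trans same (trans size (trans (+-suc ∣ T ∣ r)
                    (cong (_+ r) (sym (∣⊕∣ T e<n e∉T)))))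

-- Binary digits and the increment.

odd : ℕ → Bool
odd zero    = false
odd (suc t) = not (odd t)

bitOf : ℕ → ℕ → Bool
bitOf zero    t = odd t
bitOf (suc i) t = bitOf i ⌊ t /2⌋

ones : ℕ → ℕ → Bool
ones zero    t = true
ones (suc m) t = ones m t ∧ bitOf m t

⌊suc/2⌋ : ∀ t → ⌊ suc t /2⌋ ≡ (if odd t then suc ⌊ t /2⌋ else ⌊ t /2⌋)
⌊suc/2⌋ zero = refl
⌊suc/2⌋ (suc t) rewrite ⌊suc/2⌋ t with odd t
... | true  = refl
... | false = refl

ones-low : ∀ m t → ones (suc m) t ≡ odd t ∧ ones m ⌊ t /2⌋
ones-low zero    t = sym (∧-identityʳ (odd t))
ones-low (suc m) t = trans (cong (_∧ bitOf m ⌊ t /2⌋) (ones-low m t)) (∧-assoc (odd t) _ _)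

-- The carry reaches digit i exactly if all lower digits are 1.
bitOf-suc : ∀ i t → bitOf i (suc t) ≡ bitOf i t xor ones i t
bitOf-suc zero    t = xor-comm true (odd t)
bitOf-suc (suc i) t rewrite ones-low i t | ⌊suc/2⌋ t with odd t
... | true  = bitOf-suc i ⌊ t /2⌋
... | false = sym (xor-identityʳ _)

⌊2*/2⌋ : ∀ h → ⌊ h + h /2⌋ ≡ h
⌊2*/2⌋ h = sym (n≡⌊n+n/2⌋ h)

odd-double : ∀ h → odd (h + h) ≡ false
odd-double zero = refl
odd-double (suc h) rewrite +-suc h h | odd-double h = refl

halves : ∀ t → t ≡ bit (odd t) + (⌊ t /2⌋ + ⌊ t /2⌋)
halves zero = refl
halves (suc t) with odd t | ⌊suc/2⌋ t | halves t
... | true  | e | h rewrite e = cong suc (trans h (sym (+-suc ⌊ t /2⌋ ⌊ t /2⌋)))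
... | false | e | h rewrite e = cong suc h

bitOf-0 : ∀ x → bitOf x 0 ≡ false
bitOf-0 zero    = refl
bitOf-0 (suc x) = bitOf-0 x

fromBits : ℕ → (ℕ → Bool) → ℕ
fromBits zero    b = 0
fromBits (suc m) b = bit (b 0) + (fromBits m (b ∘ suc) + fromBits m (b ∘ suc))

fromBits< : ∀ m b → fromBits m b < 2 ^ m
fromBits< zero    b = s≤s z≤n
fromBits< (suc m) b rewrite 2*-double (2 ^ m) = bound (b 0) (fromBits< m (b ∘ suc))
  where
  bound : ∀ c {h x} → h < x → bit c + (h + h) < x + x
  bound false p = +-mono-< p p
  bound true  {h} {x} p = ≤-trans (≤-reflexive (cong suc (sym (+-suc h h)))) (+-mono-≤ p p)

bitOf-fromBits : ∀ m b {i} → i < m → bitOf i (fromBits m b) ≡ b i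
bitOf-fromBits (suc m) b {zero} _ with b 0
... | true  = cong not (odd-double (fromBits m (b ∘ suc)))
... | false = odd-double (fromBits m (b ∘ suc))
bitOf-fromBits (suc m) b {suc i} (s≤s p) = trans (cong (bitOf i) half) (bitOf-fromBits m (b ∘ suc) p)
  where
  h = fromBits m (b ∘ suc)
  half : ⌊ bit (b 0) + (h + h) /2⌋ ≡ h
  half with b 0
  ... | false = ⌊2*/2⌋ h
  ... | true rewrite ⌊suc/2⌋ (h + h) | odd-double h = ⌊2*/2⌋ h

-- The increment overflows only at `2 ^ m` minus 1. This is how the enumeration notices that it is
-- finished.
ones⇒last : ∀ m {t} → t < 2 ^ m → ones m t ≡ true → suc t ≡ 2 ^ m
ones⇒last zero    (s≤s z≤n) p = refl
ones⇒last (suc m) {t} lt p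
  rewrite ones-low m t | 2*-double (2 ^ m) with odd t | halves t
... | true | h = trans (cong suc h) (trans (cong suc (sym (+-suc ⌊ t /2⌋ ⌊ t /2⌋)))
    (cong₂ _+_ e e))
  where
  e = ones⇒last m (≰⇒> λ le → <⇒≱ lt (≤-trans (+-mono-≤ le le)
        (≤-trans (n≤1+n _) (≤-reflexive (sym h))))) p

last⇒ones : ∀ m {t} → suc t ≡ 2 ^ m → ones m t ≡ true
last⇒ones zero    refl = refl
last⇒ones (suc m) {t} e rewrite ones-low m t | 2*-double (2 ^ m) with odd t in o | halves t
... | true | h = last⇒ones m (trans (sym (⌊2*/2⌋ (suc ⌊ t /2⌋)))
        (trans (cong ⌊_/2⌋ (trans (cong suc (trans (+-suc ⌊ t /2⌋ ⌊ t /2⌋) (sym h))) e)) (⌊2*/2⌋ (2 ^ m))))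
... | false | h with () ← trans (sym (trans (cong odd e) (odd-double (2 ^ m)))) (cong not o)

-- Parity sums and the covering code.

⨁ : ℕ → (ℕ → Bool) → Bool
⨁ zero    f = false
⨁ (suc m) f = ⨁ m f xor f m

⨁-cong : ∀ m {f g} → (∀ r → r < m → f r ≡ g r) → ⨁ m f ≡ ⨁ m g
⨁-cong zero    h = refl
⨁-cong (suc m) h = cong₂ _xor_ (⨁-cong m (λ r p → h r (m≤n⇒m≤1+n p))) (h m ≤-refl)

⨁-change : ∀ m {f g r b} → r < m → g r ≡ f r xor b → (∀ r′ → r′ ≢ r → g r′ ≡ f r′) →
           ⨁ m g ≡ ⨁ m f xor b
⨁-change (suc m) {f} {g} {r} {b} p e h with r ≟ m
... | yes refl = trans (cong₂ _xor_ (⨁-cong m (λ r′ q → h r′ (<⇒≢ q))) e)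
                       (sym (xor-assoc (⨁ m f) (f r) b))
... | no r≢m = trans (cong₂ _xor_ (⨁-change m (≤∧≢⇒< (≤-pred p) r≢m) e h) (h m (r≢m ∘ sym)))
  (trans (xor-assoc (⨁ m f) b (f m)) (trans (cong (⨁ m f xor_) (xor-comm b (f m)))
    (sym (xor-assoc (⨁ m f) (f m) b))))

-- Positions below g = k s hold the check bits of the k blocks, s for each;
-- group γ consists of the g positions from g + γ g on, and block j of the
-- groups j N, …, j N + N - 1.

module Code (k s N g : ℕ) where

  position : ℕ → ℕ → ℕ
  position γ r = g + (γ * g + r)

  groupParity : ∀ {n} → Subset n → ℕ → Bool
  groupParity X γ = ⨁ g λ r → has X (position γ r)

  -- Bit i of the sum, modulo 2, of the labels of the odd groups of block j: a Hamming syndrome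
  -- whose coordinates are parities of groups instead of single elements. Only positions from g on
  -- enter, so a codeword is determined by its part there.
  check : ∀ {n} → Subset n → ℕ → ℕ → Bool
  check X j i = ⨁ N λ λ′ → groupParity X (j * N + λ′) ∧ bitOf i λ′

  Codeword : ∀ {n} → Subset n → Set
  Codeword X = ∀ {j i} → j < k → i < s → has X (j * s + i) ≡ check X j i

  position-unique : ∀ {γ γ′ r r′} → r < g → r′ < g → position γ r ≡ position γ′ r′ → γ ≡ γ′ × r ≡ r′
  position-unique {γ} {γ′} p q e = cell-unique γ γ′ p q (+-cancelˡ-≡ g _ _ e)

  module _ {n} (X : Subset n) {γ r} (r<g : r < g) (hit : has X (position γ r) ≡ true) where

    groupParity-⊖ : groupParity (X ⊖ position γ r) γ ≡ groupParity X γ xor true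
    groupParity-⊖ = ⨁-change g r<g
      (trans (has-⊖ X (position γ r)) (sym (cong (_xor true) hit)))
      λ r′ r′≢r → has-⊖-≢ X λ e → r′≢r (+-cancelˡ-≡ (γ * g) _ _ (+-cancelˡ-≡ g _ _ e))

    groupParity-⊖-≢ : ∀ {γ′} → γ′ ≢ γ → groupParity (X ⊖ position γ r) γ′ ≡ groupParity X γ′
    groupParity-⊖-≢ {γ′} γ′≢γ = ⨁-cong g λ r′ r′<g →
      has-⊖-≢ X λ e → γ′≢γ (proj₁ (position-unique {γ′} {γ} r′<g r<g e))

  -- A deletion flips the parity of one group, which adds the label of that group to the syndrome of
  -- its block.
  check-⊖ : ∀ {n} (X : Subset n) {j λ′ r} → λ′ < N → r < g →
    has X (position (j * N + λ′) r) ≡ true →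
    ∀ i → check (X ⊖ position (j * N + λ′) r) j i ≡ check X j i xor bitOf i λ′
  check-⊖ X {j} {λ′} λ<N r<g hit i = ⨁-change N λ<N
    (trans (cong (_∧ bitOf i λ′) (groupParity-⊖ X {j * N + λ′} r<g hit))
      (∧-distribʳ-xor (bitOf i λ′) (groupParity X (j * N + λ′)) true))
    λ λ″ λ″≢ → cong (_∧ bitOf i λ″) (groupParity-⊖-≢ X {j * N + λ′} r<g hit (λ e → λ″≢ (+-cancelˡ-≡ (j * N) _ _ e)))

  check-⊖-≢ : ∀ {n} (X : Subset n) {j λ′ r} → λ′ < N → r < g →
    has X (position (j * N + λ′) r) ≡ true →
    ∀ {j′} i → j′ ≢ j → check (X ⊖ position (j * N + λ′) r) j′ i ≡ check X j′ i
  check-⊖-≢ X {j} {λ′} λ<N r<g hit {j′} i j′≢j = ⨁-cong N λ λ″ λ″<N → cong (_∧ bitOf i λ″)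
    (groupParity-⊖-≢ X {j * N + λ′} r<g hit λ e → j′≢j (proj₁ (cell-unique j′ j λ″<N λ<N e)))

  module _ {n} (N≡ : N ≡ 2 ^ s) (g≡ : g ≡ k * s) (B : Subset n)
    (hit : ∀ γ → γ < k * N → ∃[ r ] (r < g × has B (position γ r) ≡ true)) where

    -- All deletions are at positions from g on, so the stored check bits remain those of B (`low`).
    -- Later deletions concern other blocks and leave repaired checks alone, and by `high` the
    -- blocks not yet treated still contain the elements that `hit` provides.
    record Stage (j : ℕ) (X : Subset n) : Set where
      field
        inside : X ⊑ B
        checks : ∀ {j′ i} → j′ < j → i < s → check X j′ i ≡ has B (j′ * s + i)
        low    : ∀ {e} → e < g → has X e ≡ has B e
        high   : ∀ {j′ λ′ r} → j ≤ j′ → λ′ < N → r < g →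
                 has X (position (j′ * N + λ′) r) ≡ has B (position (j′ * N + λ′) r)
        size   : ∣ B ∣ ≡ ∣ X ∣ + j

    open Stage

    -- Deleting one element of the group whose label is the error of the
    -- j-th check repairs that check.
    stage : ∀ j → j ≤ k → ∃[ X ] Stage j X
    stage zero    _   = B , record
      { inside = within λ _ p → p ; checks = λ () ; low = λ _ → refl ; high = λ _ _ _ → refl
      ; size = sym (+-identityʳ ∣ B ∣) }
    stage (suc j) j<k with X , st ← stage j (<⇒≤ j<k) = X ⊖ d , st′
      where
      error : ℕ → Bool
      error i = check X j i xor has B (j * s + i)
      -- Every number of s bits labels a group, 0 included. If the check is already right the label
      -- is 0, and deleting from group 0 changes no check bit; so each block loses exactly one
      -- element.
      label = fromBits s error
      label<N : label < N
      label<N = subst (label <_) (sym N≡) (fromBits< s error)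
      γ<kN : j * N + label < k * N
      γ<kN = ≤-trans (+-monoʳ-< (j * N) label<N)
        (≤-trans (≤-reflexive (+-comm (j * N) N)) (*-monoˡ-≤ N j<k))
      r   = proj₁ (hit (j * N + label) γ<kN)
      r<g = proj₁ (proj₂ (hit (j * N + label) γ<kN))
      d   = position (j * N + label) r
      d∈X : has X d ≡ true
      d∈X = trans (high st ≤-refl label<N r<g) (proj₂ (proj₂ (hit (j * N + label) γ<kN)))
      st′ : Stage (suc j) (X ⊖ d)
      st′ .inside = ⊑-trans (⊖-⊑ X d) (inside st)
      st′ .checks {j′} {i} j′< i<s with j′ ≟ j
      ... | no j′≢j = trans (check-⊖-≢ X {j} label<N r<g d∈X i j′≢j)
                            (checks st (≤∧≢⇒< (≤-pred j′<) j′≢j) i<s)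
      ... | yes refl = trans (check-⊖ X {j} label<N r<g d∈X i)
        (trans (cong (check X j i xor_) (bitOf-fromBits s error i<s))
          (trans (sym (xor-assoc (check X j i) (check X j i) _))
            (cong (_xor has B (j * s + i)) (xor-same (check X j i)))))
      st′ .low {e} e<g = trans (has-⊖-≢ X (<⇒≢ (≤-trans e<g (m≤m+n g _)))) (low st e<g)
      st′ .high {j′} j<j′ λ<N r′<g = trans
        (has-⊖-≢ X λ e → <⇒≢ j<j′ (sym (proj₁ (cell-unique j′ j λ<N label<N
          (proj₁ (position-unique {j′ * N + _} {j * N + label} r′<g r<g e))))))
        (high st (<⇒≤ j<j′) λ<N r′<g)
      st′ .size = trans (size st) (trans (cong (_+ j) (sym (∣⊖∣ X d∈X))) (sym (+-suc ∣ X ⊖ d ∣ j)))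

    cover : ∃[ X ] (X ⊑ B × Codeword X × ∣ B ∣ ≡ ∣ X ∣ + k)
    cover with X , st ← stage k ≤-refl =
      X , inside st , (λ {j} {i} j<k i<s → trans
        (low st (subst (j * s + i <_) (sym g≡)
          (≤-trans (+-monoʳ-< (j * s) i<s) (≤-trans (≤-reflexive (+-comm (j * s) s)) (*-monoˡ-≤ s j<k)))))
        (sym (checks st j<k i<s))) , size st

-- The text of the algorithm.

pattern $out  = 0
pattern $n    = 1
pattern $k    = 2
pattern $s    = 3
pattern $N    = 4
pattern $g    = 5
pattern $W    = 6
pattern $n-g  = 7
pattern $L    = 8
pattern $more = 9
pattern $i    = 10
pattern $pos  = 11
pattern $x    = 12
pattern $y    = 13
pattern $z    = 14
pattern $ok   = 15
pattern $a    = 16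
pattern $b    = 17
pattern $q    = 18
pattern $c    = 19
pattern $p    = 20
pattern $any  = 21
pattern $e    = 22

pattern tape  = 0
pattern label = 1
pattern cand  = 2

span : ∀ {ℓ} → Fin ℓ → ℕ
span i = 3 + toℕ i

module _ {ℓ : ℕ} where

  bumpInit : Com ℓ
  bumpInit = $ok :=# 1 ∙ $i :=# 0

  bumpStep : ℕ → Com ℓ
  bumpStep j =
    cond $ok ( $x ← j [ $i ]
             ∙ cond $x ($x :=# 0) ($x :=# 1 ∙ $ok :=# 0)
             ∙ j [ $i ]← $x ) nop
    ∙ incr $i

  -- Binary increment with the carry in `$ok`. A carry left at the end is an overflow, which
  -- `setMore` turns into the end of the enumeration.
  bump : ℕ → ℕ → Com ℓ
  bump j m = bumpInit ∙ loop m (bumpStep j)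

  -- `$pos` is left behind the last bit copied. In `attempt` this is where the advice begins.
  copyStep zeroStep spread : Com ℓ
  copyStep = $x ← tape [ $pos ] ∙ cand [ $i ]← $x ∙ incr $i ∙ incr $pos
  zeroStep = $x :=# 0 ∙ cand [ $i ]← $x ∙ incr $i
  spread   = $i :=# 0 ∙ $pos :=# 0 ∙ loop $a copyStep ∙ loop $g zeroStep ∙ loop $b copyStep

  askAll : Com ℓ
  askAll = each λ i → ask $x i cand ∙ cond $x nop ($ok :=# 0)

  askNone : Com ℓ
  askNone = each λ i → ask $x i cand ∙ cond $x ($ok :=# 0) nop

  verifyStep verify : Com ℓ
  verifyStep =
    $x ← cand [ $e ]
    ∙ cond $x nop ( $x :=# 1 ∙ cand [ $e ]← $x
                  ∙ askNone
                  ∙ $x :=# 0 ∙ cand [ $e ]← $x )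
    ∙ incr $e
  verify = $ok :=# 1 ∙ askAll ∙ $e :=# 0 ∙ loop $n verifyStep ∙ cond $ok ($out :=# 1) nop

  -- `$q` runs once through the groups from position g on, while the array `label` counts the groups
  -- of the current block in binary. The check bits start at 0 and absorb the label of each odd
  -- group.
  clearLabel parityStep flipStep flipLabel group block encode : Com ℓ
  clearLabel = $i :=# 0 ∙ loop $s ($x :=# 0 ∙ label [ $i ]← $x ∙ incr $i)
  parityStep = $x ← cand [ $q ] ∙ cond $x (cond $z ($z :=# 0) ($z :=# 1)) nop ∙ incr $q
  flipStep =
    $x ← label [ $i ]
    ∙ cond $x ($y ← cand [ $e ] ∙ cond $y ($y :=# 0) ($y :=# 1) ∙ cand [ $e ]← $y) nop
    ∙ incr $i ∙ incr $e
  flipLabel = $i :=# 0 ∙ $e := $c ∙ loop $s flipStep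
  group  = $z :=# 0 ∙ loop $g parityStep ∙ cond $z flipLabel nop ∙ bump label $s
  block  = clearLabel ∙ loop $N group ∙ loop $s (incr $c)
  encode = $q := $g ∙ $c :=# 0 ∙ loop $k block

  resetStep fitStep growStep : Fin ℓ → Com ℓ
  resetStep i = $x ← cand [ $i ] ∙ span i [ $i ]← $x ∙ incr $i
  fitStep i =
    $x ← span i [ $e ]
    ∙ cond $x ($ok :=# 0)
        ( $x :=# 1 ∙ span i [ $e ]← $x
        ∙ ask $y i (span i)
        ∙ cond $y nop ($ok :=# 0)
        ∙ $x :=# 0 ∙ span i [ $e ]← $x )
  growStep i = $x ← tape [ $pos ] ∙ incr $pos ∙
    cond $x (cond $p (span i [ $e ]← $x ∙ $any :=# 1) nop) nop

  -- Whether any advice bit is set is known only after all ℓ bits have been read, so the sets grow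
  -- first and `conclude` decides about a replacement afterwards.
  reset fit findStep find conclude grow search : Com ℓ
  reset = each λ i → $i :=# 0 ∙ loop $n (resetStep i)
  fit = $ok :=# 1 ∙ each fitStep
  findStep = fit ∙ cond $ok ($p := $e ∙ incr $p) nop ∙ incr $e
  find = $p :=# 0 ∙ $e :=# 0 ∙ loop $n findStep
  conclude = cond $p (cond $any nop ($x :=# 1 ∙ cand [ $e ]← $x ∙ reset)) nop
  grow = $any :=# 0 ∙ $e := $p ∙ decr $e ∙ each growStep ∙ conclude
  search = reset ∙ loop $W (find ∙ grow)

  -- A string is decoded in every way it might be meant, with each window of g consecutive positions
  -- as the missed group and as a codeword with advice. This saves the bits that would say which;
  -- `verify` discards wrong results.
  windowStep windows attempt setMore body : Com ℓ
  windowStep = spread ∙ verify ∙ incr $a ∙ decr $b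
  windows = $a :=# 0 ∙ $b := $n-g ∙ loop $n windowStep
  attempt = $a :=# 0 ∙ $b := $n-g ∙ spread ∙ encode ∙ search ∙ verify
  setMore = cond $ok ($more :=# 0) ($more :=# 1)
  body = windows ∙ attempt ∙ bump tape $L ∙ setMore

upd-same : ∀ f j a → upd f j a j ≡ a
upd-same f j a rewrite ≡ᵇ-refl j = refl

put-same : ∀ n a {y} v → y < n → put n a y v y ≡ v
put-same n a {y} v p rewrite ≡ᵇ-refl y | <⇒<ᵇ-true p = refl

put-≢ : ∀ n a {y y′} v → y′ ≢ y → put n a y v y′ ≡ a y′
put-≢ n a {y} {y′} v p rewrite ≢⇒≡ᵇ-false y′ y p = refl

-- Counting, copying and verifying.

module Routines {ℓ n : ℕ} (O : Oracles ℓ n) where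

  module _ (j t len : ℕ) (len≤n : len ≤ n) where

    record Bumping (i : ℕ) (s : Store) : Set where
      field
        index : var s $i ≡ i
        carry : var s $ok ≡ bit (ones i t)
        done  : ∀ {x} → x < i → arr s j x ≡ bit (bitOf x (suc t))
        todo  : ∀ {x} → i ≤ x → x < len → arr s j x ≡ bit (bitOf x t)

    open Bumping

    bump-step : ∀ i s → i < len → Bumping i s → Bumping (suc i) (exec O (bumpStep j) s)
    bump-step i s i< h = record { index = ix ; carry = ca ; done = dn ; todo = td }
      where
      cell : arr s j (var s $i) ≡ bit (bitOf i t)
      cell = trans (cong (arr s j) (index h)) (todo h ≤-refl i<)
      ix : var (exec O (bumpStep j) s) $i ≡ suc i
      ix rewrite carry h with ones i t
      ... | false = cong suc (index h)
      ... | true rewrite cell with bitOf i t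
      ...   | true  = cong suc (index h)
      ...   | false = cong suc (index h)
      ca : var (exec O (bumpStep j) s) $ok ≡ bit (ones (suc i) t)
      ca rewrite carry h with ones i t in eq
      ... | false = trans (carry h) (cong bit eq)
      ... | true rewrite cell with bitOf i t
      ...   | true  = trans (carry h) (cong bit eq)
      ...   | false = refl
      new : arr (exec O (bumpStep j) s) j i ≡ bit (bitOf i (suc t))
      new rewrite carry h | bitOf-suc i t with ones i t
      ... | false rewrite xor-identityʳ (bitOf i t) = todo h ≤-refl i<
      ... | true rewrite cell with bitOf i t
      ...   | true  rewrite index h | upd-same (arr s) j (put n (arr s j) i 0) = put-same n (arr s j) 0 (≤-trans i< len≤n)
      ...   | false rewrite index h | upd-same (arr s) j (put n (arr s j) i 1) = put-same n (arr s j) 1 (≤-trans i< len≤n)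
      old : ∀ {x} → x ≢ i → arr (exec O (bumpStep j) s) j x ≡ arr s j x
      old x≢ rewrite carry h with ones i t
      ... | false = refl
      ... | true rewrite cell with bitOf i t
      ...   | true  rewrite index h | upd-same (arr s) j (put n (arr s j) i 0) = put-≢ n (arr s j) 0 x≢
      ...   | false rewrite index h | upd-same (arr s) j (put n (arr s j) i 1) = put-≢ n (arr s j) 1 x≢
      dn : ∀ {x} → x < suc i → arr (exec O (bumpStep j) s) j x ≡ bit (bitOf x (suc t))
      dn {x} x< with x ≟ i
      ... | yes refl = new
      ... | no x≢i   = trans (old x≢i) (done h (≤∧≢⇒< (≤-pred x<) x≢i))
      td : ∀ {x} → suc i ≤ x → x < len → arr (exec O (bumpStep j) s) j x ≡ bit (bitOf x t)
      td i<x x< = trans (old (<⇒≢ i<x ∘ sym)) (todo h (<⇒≤ i<x) x<)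

    bump-spec : ∀ m s → var (exec O (bumpInit) s) m ≡ len → (∀ {x} → x < len → arr s j x ≡ bit (bitOf x t)) →
      Bumping len (exec O (bump j m) s)
    bump-spec m s e h = loop-ind O Bumping m (bumpStep j) (exec O (bumpInit) s) e len≤n bump-step
      record { index = refl ; carry = refl ; done = λ () ; todo = λ _ → h }

  set : (ℕ → ℕ) → Subset n
  set a = ⟦ a ⟧

  ⟦put⟧-⊕ : ∀ a e v → set (put n a e (suc v)) ≡ set a ⊕ e
  ⟦put⟧-⊕ a e v = has-ext same
    where
    same : ∀ x → x < n → has (set (put n a e (suc v))) x ≡ has (set a ⊕ e) x
    same x x<n with x ≟ e
    ... | yes refl = trans (has-⟦⟧ (put n a x (suc v)) x<n)
      (trans (cong (λ y → not (y ≡ᵇ 0)) (put-same n a (suc v) x<n)) (sym (has-⊕ (set a) x<n)))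
    ... | no x≢e = trans (has-⟦⟧ (put n a e (suc v)) x<n)
      (trans (cong (λ y → not (y ≡ᵇ 0)) (put-≢ n a (suc v) x≢e))
        (sym (trans (has-⊕-≢ (set a) x≢e) (has-⟦⟧ a x<n))))

  ⟦put⟧-⊖ : ∀ a e → set (put n a e 0) ≡ set a ⊖ e
  ⟦put⟧-⊖ a e = has-ext same
    where
    same : ∀ x → x < n → has (set (put n a e 0)) x ≡ has (set a ⊖ e) x
    same x x<n with x ≟ e
    ... | yes refl = trans (has-⟦⟧ (put n a x 0) x<n)
      (trans (cong (λ y → not (y ≡ᵇ 0)) (put-same n a 0 x<n)) (sym (has-⊖ (set a) x)))
    ... | no x≢e = trans (has-⟦⟧ (put n a e 0) x<n)
      (trans (cong (λ y → not (y ≡ᵇ 0)) (put-≢ n a 0 x≢e))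
        (sym (trans (has-⊖-≢ (set a) x≢e) (has-⟦⟧ a x<n))))

  record Copying (a₀ p₀ : ℕ) (s₀ : Store) (r : ℕ) (s : Store) : Set where
    field
      index  : var s $i ≡ a₀ + r
      source : var s $pos ≡ p₀ + r
      copied : ∀ {x} → x < r → arr s cand (a₀ + x) ≡ arr s₀ tape (p₀ + x)
      before : ∀ {x} → x < a₀ → arr s cand x ≡ arr s₀ cand x

  copy-spec : ∀ x s₀ a₀ p₀ {m} → var s₀ x ≡ m → a₀ + m ≤ n → var s₀ $i ≡ a₀ → var s₀ $pos ≡ p₀ →
    Copying a₀ p₀ s₀ m (exec O (loop x copyStep) s₀)
  copy-spec x s₀ a₀ p₀ {m} x≡ le i≡ p≡ = proj₁
    (loop-ind O (λ r s → Copying a₀ p₀ s₀ r s × arr s tape ≡ arr s₀ tape) x copyStep s₀ x≡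
      (≤-trans (m≤n+m m a₀) le) step
      (record { index = trans i≡ (sym (+-identityʳ a₀)) ; source = trans p≡ (sym (+-identityʳ p₀))
              ; copied = λ () ; before = λ _ → refl } , refl))
    where
    step : ∀ r s → r < m → Copying a₀ p₀ s₀ r s × arr s tape ≡ arr s₀ tape →
      Copying a₀ p₀ s₀ (suc r) (exec O copyStep s) × arr (exec O copyStep s) tape ≡ arr s₀ tape
    step r s r<m (h , t≡) = record
      { index  = trans (cong suc index) (sym (+-suc a₀ r))
      ; source = trans (cong suc source) (sym (+-suc p₀ r))
      ; copied = new
      ; before = λ {x} x< → trans (cong (λ i → put n (arr s cand) i v x) index)
                   (trans (put-≢ n (arr s cand) v (<⇒≢ (≤-trans x< (m≤m+n a₀ r)))) (before x<))
      } , t≡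
      where
      open Copying h
      v = arr s tape (var s $pos)
      new : ∀ {x} → x < suc r →
        put n (arr s cand) (var s $i) v (a₀ + x) ≡ arr s₀ tape (p₀ + x)
      new {x} x< rewrite index with x ≟ r
      ... | yes refl = trans (put-same n (arr s cand) v (≤-trans (+-monoʳ-< a₀ r<m) le))
                             (cong₂ (λ a p → a p) t≡ source)
      ... | no x≢r = trans (put-≢ n (arr s cand) v (x≢r ∘ +-cancelˡ-≡ a₀ _ _))
                           (copied (≤∧≢⇒< (≤-pred x<) x≢r))

  record Zeroing (a₀ : ℕ) (s₀ : Store) (r : ℕ) (s : Store) : Set where
    field
      index  : var s $i ≡ a₀ + r
      zeroed : ∀ {x} → x < r → arr s cand (a₀ + x) ≡ 0
      before : ∀ {x} → x < a₀ → arr s cand x ≡ arr s₀ cand x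

  zero-spec : ∀ x s₀ a₀ {m} → var s₀ x ≡ m → a₀ + m ≤ n → var s₀ $i ≡ a₀ →
    Zeroing a₀ s₀ m (exec O (loop x zeroStep) s₀)
  zero-spec x s₀ a₀ {m} x≡ le i≡ =
    loop-ind O (Zeroing a₀ s₀) x zeroStep s₀ x≡ (≤-trans (m≤n+m m a₀) le) step
      (record { index = trans i≡ (sym (+-identityʳ a₀)) ; zeroed = λ () ; before = λ _ → refl })
    where
    step : ∀ r s → r < m → Zeroing a₀ s₀ r s → Zeroing a₀ s₀ (suc r) (exec O zeroStep s)
    step r s r<m h = record
      { index  = trans (cong suc index) (sym (+-suc a₀ r))
      ; zeroed = new
      ; before = λ {x} x< → trans (cong (λ i → put n (arr s cand) i 0 x) index)
                   (trans (put-≢ n (arr s cand) 0 (<⇒≢ (≤-trans x< (m≤m+n a₀ r)))) (before x<))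
      }
      where
      open Zeroing h
      new : ∀ {x} → x < suc r → put n (arr s cand) (var s $i) 0 (a₀ + x) ≡ 0
      new {x} x< rewrite index with x ≟ r
      ... | yes refl = put-same n (arr s cand) 0 (≤-trans (+-monoʳ-< a₀ r<m) le)
      ... | no x≢r = trans (put-≢ n (arr s cand) 0 (x≢r ∘ +-cancelˡ-≡ a₀ _ _))
                           (zeroed (≤∧≢⇒< (≤-pred x<) x≢r))

  record Spread (a g b : ℕ) (s s′ : Store) : Set where
    field
      left   : ∀ {x} → x < a → arr s′ cand x ≡ arr s tape x
      gap    : ∀ {x} → x < g → arr s′ cand (a + x) ≡ 0
      right  : ∀ {x} → x < b → arr s′ cand (a + g + x) ≡ arr s tape (a + x)
      source : var s′ $pos ≡ a + b

  spread-spec : ∀ a g b s → a + g + b ≤ n → var s $a ≡ a → var s $g ≡ g → var s $b ≡ b →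
    Spread a g b s (exec O spread s)
  spread-spec a g b s le a≡ g≡ b≡ = record
    { left   = λ {x} x<a → trans (C′.before (≤-trans x<a (m≤m+n a g)))
                 (trans (Z.before x<a) (C.copied x<a))
    ; gap    = λ x<g → trans (C′.before (+-monoʳ-< a x<g)) (Z.zeroed x<g)
    ; right  = λ {x} x<b → trans (C′.copied x<b) (cong (λ t → t (a + x))
                 (trans (frame-arr O (loop $g zeroStep) s₂ _) (frame-arr O (loop $a copyStep) s₁ _)))
    ; source = C′.source }
    where
    s₁ = exec O ($i :=# 0 ∙ $pos :=# 0) s
    s₂ = exec O (loop $a copyStep) s₁
    s₃ = exec O (loop $g zeroStep) s₂
    le₁ : a + g ≤ n
    le₁ = ≤-trans (m≤m+n (a + g) b) le
    c = copy-spec $a s₁ 0 0 a≡ (≤-trans (m≤m+n a g) le₁) refl refl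
    module C = Copying c
    z = zero-spec $g s₂ a (trans (frame O (loop $a copyStep) s₁ _) g≡) le₁ C.index
    module Z = Zeroing z
    c′ = copy-spec $b s₃ (a + g) a
      (trans (frame O (loop $g zeroStep) s₂ _) (trans (frame O (loop $a copyStep) s₁ _) b≡)) le
      Z.index (trans (frame O (loop $g zeroStep) s₂ _) C.source)
    module C′ = Copying c′

  -- For a series of tests that clear `$ok` on failure. The invariant I allows them to alter an
  -- array temporarily.
  all-pass : ∀ {m} (f : Fin m → Store → Store) (b : Fin m → Bool) (I : Store → Set) →
    (∀ i s → I s → I (f i s) × var (f i s) $ok ≡ (if b i then var s $ok else 0)) →
    ∀ s → I s → I (fold-each f s) × var (fold-each f s) $ok ≡ (if allF b then var s $ok else 0)
  all-pass {zero}  f b I h s p = p , refl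
  all-pass {suc m} f b I h s p
    with q , e ← h zero s p
    with r , e′ ← all-pass (f ∘ suc) (b ∘ suc) I (h ∘ suc) (f zero s) q =
    r , trans e′ (both (b zero) (allF (b ∘ suc)) e)
    where
    both : ∀ c d {v} → v ≡ (if c then var s $ok else 0) →
      (if d then v else 0) ≡ (if c ∧ d then var s $ok else 0)
    both true  true  e = e
    both true  false e = refl
    both false true  e = e
    both false false e = refl

  Holds : Subset n → Store → Set
  Holds T s = set (arr s cand) ≡ T

  has-held : ∀ T s {m} → m < n → Holds T s → has T m ≡ not (arr s cand m ≡ᵇ 0)
  has-held T s m<n refl = has-⟦⟧ (arr s cand) m<n

  askAll-spec : ∀ T s → Holds T s → Holds T (exec O askAll s) ×
    var (exec O askAll s) $ok ≡ (if allF (λ i → O i T) then var s $ok else 0)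
  askAll-spec T = all-pass (λ i → (exec O (ask $x i cand ∙ cond $x nop ($ok :=# 0)))) _ (Holds T) step
    where
    step : ∀ i s → Holds T s → Holds T (exec O (ask $x i cand ∙ cond $x nop ($ok :=# 0)) s) ×
      var (exec O (ask $x i cand ∙ cond $x nop ($ok :=# 0)) s) $ok ≡ (if O i T then var s $ok else 0)
    step i s refl with O i ⟦ arr s cand ⟧
    ... | true  = refl , refl
    ... | false = refl , refl

  askNone-spec : ∀ T s → Holds T s → Holds T (exec O askNone s) ×
    var (exec O askNone s) $ok ≡ (if allF (λ i → not (O i T)) then var s $ok else 0)
  askNone-spec T = all-pass (λ i → (exec O (ask $x i cand ∙ cond $x ($ok :=# 0) nop))) _ (Holds T) step
    where
    step : ∀ i s → Holds T s → Holds T (exec O (ask $x i cand ∙ cond $x ($ok :=# 0) nop) s) ×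
      var (exec O (ask $x i cand ∙ cond $x ($ok :=# 0) nop) s) $ok ≡ (if not (O i T) then var s $ok else 0)
    step i s refl with O i ⟦ arr s cand ⟧
    ... | true  = refl , refl
    ... | false = refl , refl

  open Search O

  module _ (T : Subset n) where

    private
      common : Bool
      common = allF λ i → O i T

    record Verifying (m : ℕ) (s : Store) : Set where
      field
        index  : var s $e ≡ m
        so-far : var s $ok ≡ bit (common ∧ blocked T m)
        holds  : Holds T s

    open Verifying

    verify-step : ∀ m s → m < n → Verifying m s → Verifying (suc m) (exec O verifyStep s)
    verify-step m s m<n h with arr s cand (var s $e) in eq
    ... | suc v = record { index = cong suc (index h) ; so-far = trans (so-far h) stays ; holds = holds h }
      where
      in-T : has T m ≡ true
      in-T = trans (has-held T s m<n (holds h))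
        (cong (λ y → not (y ≡ᵇ 0)) (trans (cong (arr s cand) (sym (index h))) eq))
      stays : bit (common ∧ blocked T m) ≡ bit (common ∧ blocked T (suc m))
      stays rewrite in-T | ∧-identityʳ (blocked T m) = refl
    ... | zero = record { index = cong suc e-kept ; so-far = trans passed (decide common (blocked T m) _)
                        ; holds = restored }
      where
      s₁ = exec O ($x :=# 0 ∙ $x :=# 1 ∙ cand [ $e ]← $x) s
      out-T : has T m ≡ false
      out-T = trans (has-held T s m<n (holds h))
        (cong (λ y → not (y ≡ᵇ 0)) (trans (cong (arr s cand) (sym (index h))) eq))
      added : Holds (T ⊕ m) s₁
      added = trans (⟦put⟧-⊕ (arr s cand) (var s $e) 0) (cong₂ _⊕_ (holds h) (index h))
      answer = askNone-spec (T ⊕ m) s₁ added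
      e-kept : var (exec O askNone s₁) $e ≡ m
      e-kept = trans (frame O askNone s₁ _) (index h)
      restored : set (put n (arr (exec O askNone s₁) cand) (var (exec O askNone s₁) $e) 0) ≡ T
      restored = trans (⟦put⟧-⊖ (arr (exec O askNone s₁) cand) (var (exec O askNone s₁) $e))
        (trans (cong₂ _⊖_ (proj₁ answer) e-kept) (⊕⊖ T out-T))
      passed : var (exec O askNone s₁) $ok ≡
        (if allF (λ i → not (O i (T ⊕ m))) then bit (common ∧ blocked T m) else 0)
      passed = trans (proj₂ answer) (cong (λ v → if allF (λ i → not (O i (T ⊕ m))) then v else 0) (so-far h))
      decide : ∀ c d a → (if a then bit (c ∧ d) else 0) ≡ bit (c ∧ (d ∧ (has T m ∨ a)))
      decide c d a rewrite out-T with c | d | a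
      ... | true  | true  | true  = refl
      ... | true  | true  | false = refl
      ... | true  | false | true  = refl
      ... | true  | false | false = refl
      ... | false | _     | true  = refl
      ... | false | _     | false = refl

    verify-spec : ∀ s → var s $n ≡ n → Holds T s →
      var (exec O verify s) $out ≡ (if accepts T then 1 else var s $out)
    verify-spec s n≡ h = verdict
      where
      s₁ = exec O ($ok :=# 1) s
      answer = askAll-spec T s₁ h
      s₂ = exec O (askAll ∙ $e :=# 0) s₁
      loop-v : Verifying n (exec O (loop $n verifyStep) s₂)
      loop-v = loop-ind O Verifying $n verifyStep s₂ (trans (frame O askAll s₁ _) n≡) ≤-refl verify-step
        (record { index = refl ; holds = proj₁ answer ; so-far = trans (proj₂ answer) (first common) })
        where
        first : ∀ c → (if c then 1 else 0) ≡ bit (c ∧ true)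
        first true  = refl
        first false = refl
      out≡ : var (exec O (loop $n verifyStep) s₂) $out ≡ var s $out
      out≡ = frame O ($ok :=# 1 ∙ askAll ∙ $e :=# 0 ∙ loop $n verifyStep) s _
      verdict : var (exec O verify s) $out ≡ (if accepts T then 1 else var s $out)
      verdict with ok≡ ← so-far loop-v rewrite ok≡ with accepts T
      ... | true  = refl
      ... | false = out≡

  on : ℕ → Bool
  on v = not (v ≡ᵇ 0)

  on-bit : ∀ b → on (bit b) ≡ b
  on-bit true  = refl
  on-bit false = refl

  record Params (k s N g W : ℕ) (st : Store) : Set where
    field
      n≡   : var st $n ≡ n
      k≡   : var st $k ≡ k
      s≡   : var st $s ≡ s
      N≡   : var st $N ≡ N
      g≡   : var st $g ≡ g
      W≡   : var st $W ≡ W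
      n-g≡ : var st $n-g ≡ n ∸ g
      L≡   : var st $L ≡ (n ∸ g) + W * ℓ

  SparesParams : Com ℓ → Set
  SparesParams c = SparesVar c $n × SparesVar c $k × SparesVar c $s × SparesVar c $N ×
                   SparesVar c $g × SparesVar c $W × SparesVar c $n-g × SparesVar c $L

  keep-params : ∀ {k s N g W} c st → SparesParams c → Params k s N g W st → Params k s N g W (exec O c st)
  keep-params c st (p₁ , p₂ , p₃ , p₄ , p₅ , p₆ , p₇ , p₈) ps = record
    { n≡ = trans (frame O c st p₁) n≡ ; k≡ = trans (frame O c st p₂) k≡
    ; s≡ = trans (frame O c st p₃) s≡ ; N≡ = trans (frame O c st p₄) N≡
    ; g≡ = trans (frame O c st p₅) g≡ ; W≡ = trans (frame O c st p₆) W≡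
    ; n-g≡ = trans (frame O c st p₇) n-g≡ ; L≡ = trans (frame O c st p₈) L≡ }
    where open Params ps

  -- Recomputing the check bits.

  module Encoding (k s N g W : ℕ) (g≡ks : g ≡ k * s)
    (room : g + (k * N) * g ≤ n) (k≤n : k ≤ n) (s≤n : s ≤ n) (N≤n : 0 < k → N ≤ n)
    (X : Subset n) where

    open Code k s N g

    private
      P : Store → Set
      P = Params k s N g W

    g≤n : g ≤ n
    g≤n = ≤-trans (m≤m+n g _) room

    High : Store → Set
    High st = ∀ {x} → g ≤ x → x < n → on (arr st cand x) ≡ has X x

    module _ (γ : ℕ) (γ<kN : γ < k * N) where

      record Parity (r : ℕ) (st : Store) : Set where
        field
          index  : var st $q ≡ position γ r
          summed : var st $z ≡ bit (⨁ r λ r → has X (position γ r))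
          high   : High st

      parity-step : ∀ r st → r < g → Parity r st → Parity (suc r) (exec O parityStep st)
      parity-step r st r<g h = record { index = ix ; summed = pa ; high = hi }
        where
        open Parity h
        π = ⨁ r λ r → has X (position γ r)
        position< : position γ r < n
        position< = ≤-trans (+-monoʳ-< g (≤-trans (+-monoʳ-< (γ * g) r<g)
          (≤-trans (≤-reflexive (+-comm (γ * g) g)) (*-monoˡ-≤ g γ<kN)))) room
        cell : on (arr st cand (var st $q)) ≡ has X (position γ r)
        cell = trans (cong (on ∘ arr st cand) index) (high (m≤m+n g _) position<)
        ix : var (exec O parityStep st) $q ≡ position γ (suc r)
        ix = trans (cong suc (trans (frame O ($x ← cand [ $q ] ∙ cond $x (cond $z ($z :=# 0) ($z :=# 1)) nop) st _) index))
          (trans (sym (+-suc g _)) (cong (_+_ g) (sym (+-suc (γ * g) r))))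
        pa : var (exec O parityStep st) $z ≡ bit (π xor has X (position γ r))
        pa rewrite sym cell with arr st cand (var st $q)
        ... | zero rewrite xor-identityʳ π = summed
        ... | suc _ rewrite summed with π
        ...   | true  = refl
        ...   | false = refl
        hi : High (exec O parityStep st)
        hi p q rewrite frame-arr O parityStep {cand} st _ = high p q

    module _ (c t : ℕ) (c+s≤n : c + s ≤ n) (st₀ : Store)
      (label≡ : ∀ {x} → x < s → arr st₀ label x ≡ bit (bitOf x t)) where

      record Flipping (i : ℕ) (st : Store) : Set where
        field
          index   : var st $i ≡ i
          target  : var st $e ≡ c + i
          labels  : arr st label ≡ arr st₀ label
          flipped : ∀ {x} → x < i → on (arr st cand (c + x)) ≡ on (arr st₀ cand (c + x)) xor bitOf x t
          others  : ∀ {x} → (∀ {y} → y < i → x ≢ c + y) → arr st cand x ≡ arr st₀ cand x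

      flip-step : ∀ i st → i < s → Flipping i st → Flipping (suc i) (exec O flipStep st)
      flip-step i st i<s h = record
        { index   = trans (cong suc (frame O rest st _)) (cong suc index)
        ; target  = trans (cong suc (frame O rest st _)) (trans (cong suc target) (sym (+-suc c i)))
        ; labels  = trans (frame-arr O flipStep st _) labels
        ; flipped = fl
        ; others  = λ {x} x≢ → trans (old (x≢ ≤-refl)) (others λ y< → x≢ (m≤n⇒m≤1+n y<))
        }
        where
        open Flipping h
        rest : Com ℓ
        rest = $x ← label [ $i ] ∙ cond $x ($y ← cand [ $e ] ∙ cond $y ($y :=# 0) ($y :=# 1) ∙ cand [ $e ]← $y) nop
        lab : arr st label (var st $i) ≡ bit (bitOf i t)
        lab = trans (cong₂ (λ a x → a x) labels index) (label≡ i<s)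
        old : ∀ {x} → x ≢ c + i → arr (exec O flipStep st) cand x ≡ arr st cand x
        old x≢ rewrite lab with bitOf i t
        ... | false = refl
        ... | true with arr st cand (var st $e)
        ...   | zero  rewrite target = put-≢ n (arr st cand) 1 x≢
        ...   | suc _ rewrite target = put-≢ n (arr st cand) 0 x≢
        c+i<n : c + i < n
        c+i<n = ≤-trans (+-monoʳ-< c i<s) c+s≤n
        new : on (arr (exec O flipStep st) cand (c + i)) ≡ on (arr st cand (c + i)) xor bitOf i t
        new rewrite lab | sym target with bitOf i t
        ... | false = sym (xor-identityʳ _)
        ... | true with arr st cand (var st $e)
        ...   | zero  = cong on (put-same n (arr st cand) 1 (subst (_< n) (sym target) c+i<n))
        ...   | suc _ = cong on (put-same n (arr st cand) 0 (subst (_< n) (sym target) c+i<n))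
        fl : ∀ {x} → x < suc i →
          on (arr (exec O flipStep st) cand (c + x)) ≡ on (arr st₀ cand (c + x)) xor bitOf x t
        fl {x} x< with x ≟ i
        ... | yes refl = trans new (cong (λ v → on v xor bitOf i t)
                (others λ y< e → <⇒≢ y< (sym (+-cancelˡ-≡ c _ _ e))))
        ... | no x≢i = trans (cong on (old (x≢i ∘ +-cancelˡ-≡ c _ _))) (flipped (≤∧≢⇒< (≤-pred x<) x≢i))

      flip-spec : var st₀ $s ≡ s → var st₀ $c ≡ c → Flipping s (exec O flipLabel st₀)
      flip-spec s≡ c≡ = loop-ind O Flipping $s flipStep (exec O ($i :=# 0 ∙ $e := $c) st₀) s≡ s≤n flip-step
        (record { index = refl ; target = trans c≡ (sym (+-identityʳ c)) ; labels = refl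
                ; flipped = λ () ; others = λ _ → refl })

    module _ (j : ℕ) (j<k : j < k) where

      partial : ℕ → ℕ → Bool
      partial t i = ⨁ t λ λ′ → groupParity X (j * N + λ′) ∧ bitOf i λ′

      js+s≤g : j * s + s ≤ g
      js+s≤g = ≤-trans (≤-reflexive (+-comm (j * s) s)) (≤-trans (*-monoˡ-≤ s j<k) (≤-reflexive (sym g≡ks)))

      module _ (st₀ : Store) where

        -- While the check bits of block j are built up, the rest of `cand` stays as in st₀
        -- (`others`), so that the parities read off are those of X.
        record Grouping (t : ℕ) (st : Store) : Set where
          field
            params : P st
            index  : var st $q ≡ position (j * N + t) 0
            base   : var st $c ≡ j * s
            labels : ∀ {x} → x < s → arr st label x ≡ bit (bitOf x t)
            checks : ∀ {i} → i < s → on (arr st cand (j * s + i)) ≡ partial t i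
            others : ∀ {x} → (∀ {y} → y < s → x ≢ j * s + y) → arr st cand x ≡ arr st₀ cand x

        group-step : High st₀ → ∀ t st → t < N → Grouping t st → Grouping (suc t) (exec O group st)
        group-step high₀ t st t<N h = record
          { params = keep-params group st _ params
          ; index  = trans (frame O (cond $z flipLabel nop ∙ bump label $s) st₁ _)
              (trans (Parity.index par) (shift (j * N) t))
          ; base   = trans (frame O group st _) base
          ; labels = λ {x} x<s → Bumping.done bumped x<s
          ; checks = λ i<s → trans (cong (λ a → on (a (j * s + _))) (frame-arr O (bump label $s) st₂ _)) (ch i<s)
          ; others = λ {x} x≢ → trans (cong (λ a → a x) (frame-arr O (bump label $s) st₂ _)) (ot x≢)
          }
          where
          open Grouping h
          γ = j * N + t
          γ<kN : γ < k * N
          γ<kN = ≤-trans (+-monoʳ-< (j * N) t<N)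
            (≤-trans (≤-reflexive (+-comm (j * N) N)) (*-monoˡ-≤ N j<k))
          shift : ∀ a b → position (a + b) g ≡ position (a + suc b) 0
          shift a b = cong (_+_ g) (trans (+-comm ((a + b) * g) g)
            (trans (cong (_* g) (sym (+-suc a b))) (sym (+-identityʳ _))))
          high : High st
          high {x} g≤x x<n = trans (cong on (others λ y<s e → <⇒≱ (≤-trans (+-monoʳ-< (j * s) y<s) js+s≤g)
              (≤-trans g≤x (≤-reflexive e)))) (high₀ g≤x x<n)
          st₁ = exec O ($z :=# 0 ∙ loop $g parityStep) st
          par : Parity γ γ<kN g st₁
          par = loop-ind O (Parity γ γ<kN) $g parityStep (exec O ($z :=# 0) st) (Params.g≡ params) g≤n
            (parity-step γ γ<kN) (record { index = index ; summed = refl ; high = high })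
          cand₁ : arr st₁ cand ≡ arr st cand
          cand₁ = frame-arr O (loop $g parityStep) (exec O ($z :=# 0) st) _
          label₁ : ∀ {x} → x < s → arr st₁ label x ≡ bit (bitOf x t)
          label₁ {x} x<s = trans (cong (λ a → a x) (frame-arr O (loop $g parityStep) (exec O ($z :=# 0) st) _)) (labels x<s)
          s≡₁ : var st₁ $s ≡ s
          s≡₁ = Params.s≡ (keep-params ($z :=# 0 ∙ loop $g parityStep) st _ params)
          base₁ : var st₁ $c ≡ j * s
          base₁ = trans (frame O (loop $g parityStep) (exec O ($z :=# 0) st) _) base
          st₂ = exec O (cond $z flipLabel nop) st₁
          fl : Flipping (j * s) t (≤-trans js+s≤g g≤n) st₁ label₁ s (exec O flipLabel st₁)
          fl = flip-spec (j * s) t (≤-trans js+s≤g g≤n) st₁ label₁ s≡₁ base₁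
          ch : ∀ {i} → i < s → on (arr st₂ cand (j * s + i)) ≡ partial t i xor (groupParity X γ ∧ bitOf i t)
          ch {i} i<s rewrite Parity.summed par with groupParity X γ
          ... | true  = trans (Flipping.flipped fl i<s)
                (cong (_xor bitOf i t) (trans (cong (λ a → on (a (j * s + i))) cand₁) (checks i<s)))
          ... | false = trans (cong (λ a → on (a (j * s + i))) cand₁)
                (trans (checks i<s) (sym (xor-identityʳ _)))
          ot : ∀ {x} → (∀ {y} → y < s → x ≢ j * s + y) → arr st₂ cand x ≡ arr st₀ cand x
          ot {x} x≢ rewrite Parity.summed par with groupParity X γ
          ... | true  = trans (Flipping.others fl x≢) (trans (cong (λ a → a x) cand₁) (others x≢))
          ... | false = trans (cong (λ a → a x) cand₁) (others x≢)
          label₂ : ∀ {x} → x < s → arr st₂ label x ≡ bit (bitOf x t)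
          label₂ {x} x<s = trans (cong (λ a → a x) (frame-arr O (cond $z flipLabel nop) st₁ _)) (label₁ x<s)
          bumped : Bumping label t s s≤n s (exec O (bump label $s) st₂)
          bumped = bump-spec label t s s≤n $s st₂
            (trans (frame O (cond $z flipLabel nop) st₁ _) s≡₁) label₂

    record Cleared (m : ℕ) (st : Store) : Set where
      field
        index : var st $i ≡ m
        clear : ∀ {x} → x < m → arr st label x ≡ 0

    clear-spec : ∀ st → P st → Cleared s (exec O clearLabel st)
    clear-spec st ps = loop-ind O Cleared $s ($x :=# 0 ∙ label [ $i ]← $x ∙ incr $i) (exec O ($i :=# 0) st)
      (Params.s≡ ps) s≤n step (record { index = refl ; clear = λ () })
      where
      step : ∀ m st → m < s → Cleared m st → Cleared (suc m) (exec O ($x :=# 0 ∙ label [ $i ]← $x ∙ incr $i) st)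
      step m st m<s h = record { index = cong suc index ; clear = cl }
        where
        open Cleared h
        cl : ∀ {x} → x < suc m → put n (arr st label) (var st $i) 0 x ≡ 0
        cl {x} x< rewrite index with x ≟ m
        ... | yes refl = put-same n (arr st label) 0 (≤-trans m<s s≤n)
        ... | no x≢m   = trans (put-≢ n (arr st label) 0 x≢m) (clear (≤∧≢⇒< (≤-pred x<) x≢m))

    -- `flipLabel` toggles, so it yields the syndrome only if the check bits of a block are 0 when
    -- the block is reached; hence `fresh`.
    record Blocks (j : ℕ) (st : Store) : Set where
      field
        params : P st
        index  : var st $q ≡ position (j * N) 0
        base   : var st $c ≡ j * s
        checks : ∀ {j′ i} → j′ < j → i < s → on (arr st cand (j′ * s + i)) ≡ check X j′ i
        fresh  : ∀ {x} → j * s ≤ x → x < g → arr st cand x ≡ 0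
        high   : High st

    block-step : ∀ j st → j < k → Blocks j st → Blocks (suc j) (exec O block st)
    block-step j st j<k h = record
      { params = keep-params block st _ params
      ; index  = trans (frame O (loop $s (incr $c)) st₂ _) (trans (Grouping.index gr)
                   (cong (λ γ → position γ 0) (+-comm (j * N) N)))
      ; base   = trans (advance (j * s) (Grouping.base gr)) (+-comm (j * s) s)
      ; checks = ch
      ; fresh  = λ {x} p x<g → trans (after x) (trans
          (Grouping.others gr λ y<s e → <⇒≱ (+-monoʳ-< (j * s) y<s)
            (≤-trans (≤-reflexive (+-comm (j * s) s)) (≤-trans p (≤-reflexive e))))
          (trans (early x) (fresh (≤-trans (m≤n+m (j * s) s) p) x<g)))
      ; high   = λ {x} g≤x x<n → trans (cong on (trans (after x) (trans
          (Grouping.others gr λ y<s e → <⇒≱ (≤-trans (+-monoʳ-< (j * s) y<s) (js+s≤g j j<k))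
            (≤-trans g≤x (≤-reflexive e)))
          (early x)))) (high g≤x x<n)
      }
      where
      open Blocks h
      st₁ = exec O clearLabel st
      st₂ = exec O (loop $N group) st₁
      early : ∀ x → arr st₁ cand x ≡ arr st cand x
      early x = cong (λ a → a x) (frame-arr O clearLabel st _)
      after : ∀ x → arr (exec O block st) cand x ≡ arr st₂ cand x
      after x = cong (λ a → a x) (frame-arr O (loop $s (incr $c)) st₂ _)
      high₁ : High st₁
      high₁ {x} p q = trans (cong on (early x)) (high p q)
      gr : Grouping j j<k st₁ N st₂
      gr = loop-ind O (Grouping j j<k st₁) $N group st₁
        (Params.N≡ (keep-params clearLabel st _ params)) (N≤n (≤-trans z<s j<k))
        (group-step j j<k st₁ high₁)
        (record
          { params = keep-params clearLabel st _ params
          ; index  = trans (frame O clearLabel st _) (trans index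
              (cong (λ γ → position γ 0) (sym (+-identityʳ (j * N)))))
          ; base   = trans (frame O clearLabel st _) base
          ; labels = λ {x} x<s → trans (Cleared.clear (clear-spec st params) x<s)
                       (sym (cong bit (bitOf-0 x)))
          ; checks = λ {i} i<s → cong on (trans (early (j * s + i))
                       (fresh (m≤m+n (j * s) i) (≤-trans (+-monoʳ-< (j * s) i<s) (js+s≤g j j<k))))
          ; others = λ _ → refl })
      advance : ∀ b → var st₂ $c ≡ b → var (exec O (loop $s (incr $c)) st₂) $c ≡ b + s
      advance b e = loop-ind O (λ m st → var st $c ≡ b + m) $s (incr $c) st₂
        (Params.s≡ (Grouping.params gr)) s≤n
        (λ m st _ e → trans (cong suc e) (sym (+-suc b m))) (trans e (sym (+-identityʳ b)))
      ch : ∀ {j′ i} → j′ < suc j → i < s → on (arr (exec O block st) cand (j′ * s + i)) ≡ check X j′ i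
      ch {j′} {i} j′< i<s with j′ ≟ j
      ... | yes refl = trans (cong on (after (j * s + i))) (Grouping.checks gr i<s)
      ... | no j′≢j = trans (cong on (trans (after (j′ * s + i)) (trans
          (Grouping.others gr λ y<s e → j′≢j (proj₁ (cell-unique j′ j i<s y<s e)))
          (early (j′ * s + i)))))
        (checks (≤∧≢⇒< (≤-pred j′<) j′≢j) i<s)

    encode-spec : ∀ st → P st → High st → (∀ {x} → x < g → arr st cand x ≡ 0) → Codeword X →
      Holds X (exec O encode st)
    encode-spec st ps high₀ zero₀ code = has-ext λ e e<n →
      trans (has-⟦⟧ (arr (exec O encode st) cand) e<n) (value e e<n)
      where
      blocks : Blocks k (exec O encode st)
      blocks = loop-ind O Blocks $k block (exec O ($q := $g ∙ $c :=# 0) st) (Params.k≡ ps) k≤n block-step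
        (record { params = keep-params ($q := $g ∙ $c :=# 0) st _ ps
                ; index = trans (Params.g≡ ps) (sym (+-identityʳ g)) ; base = refl
                ; checks = λ () ; fresh = λ _ → zero₀ ; high = high₀ })
      split : ∀ k {e} → e < k * s → ∃[ j ] ∃[ i ] (j < k × i < s × e ≡ j * s + i)
      split (suc k) {e} e< with e <? s
      ... | yes e<s = 0 , e , z<s , e<s , refl
      ... | no e≮s with j , i , j<k , i<s , e≡ ← split k {e ∸ s}
                (+-cancelˡ-< s _ _ (subst (_< s + k * s) (sym (m+[n∸m]≡n (≮⇒≥ e≮s))) e<)) =
        suc j , i , s≤s j<k , i<s ,
        trans (sym (m+[n∸m]≡n (≮⇒≥ e≮s))) (trans (cong (_+_ s) e≡) (sym (+-assoc s (j * s) i)))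
      value : ∀ e → e < n → on (arr (exec O encode st) cand e) ≡ has X e
      value e e<n with e <? g
      ... | no e≮g = Blocks.high blocks (≮⇒≥ e≮g) e<n
      ... | yes e<g with j , i , j<k , i<s , refl ← split k (subst (e <_) g≡ks e<g) =
        trans (Blocks.checks blocks j<k i<s) (sym (code j<k i<s))

-- The search program follows the function `walk`.

upd-≢ : ∀ f {j j′} a → j′ ≢ j → upd f j a j′ ≡ f j′
upd-≢ f {j} {j′} a p rewrite ≢⇒≡ᵇ-false j′ j p = refl

span-≢ : ∀ {ℓ} {i i′ : Fin ℓ} → i′ ≢ i → span i′ ≢ span i
span-≢ i′≢i e = i′≢i (toℕ-injective (+-cancelˡ-≡ 3 _ _ e))

-- Associated in the order in which the program accumulates `$any`, unlike `anyF`.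
anyBelow : ℕ → (ℕ → Bool) → Bool
anyBelow zero    α = false
anyBelow (suc m) α = anyBelow m α ∨ α m

anyBelow-front : ∀ m α → anyBelow (suc m) α ≡ α 0 ∨ anyBelow m (α ∘ suc)
anyBelow-front zero    α = sym (∨-identityʳ (α 0))
anyBelow-front (suc m) α =
  trans (cong (_∨ α (suc m)) (anyBelow-front m α)) (∨-assoc (α 0) _ _)

anyF-toℕ : ∀ m α → anyF {m} (α ∘ toℕ) ≡ anyBelow m α
anyF-toℕ zero    α = refl
anyF-toℕ (suc m) α = trans (cong (α 0 ∨_) (anyF-toℕ m (α ∘ suc))) (sym (anyBelow-front m α))

branch-elim : ∀ {A : Set} (P : A → Set) {v a b} → (∀ {w} → v ≡ suc w → P a) → (v ≡ 0 → P b) →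
              P (branch v a b)
branch-elim P {zero}  f g = g refl
branch-elim P {suc w} f g = f refl

module Searching {ℓ n : ℕ} (O : Oracles ℓ n) where
  open Routines O
  open Search O

  Spans : (Fin ℓ → Subset n) → Store → Set
  Spans S s = ∀ i → set (arr s (span i)) ≡ S i

  spans-upd : ∀ {f} {S S′ : Fin ℓ → Subset n} (i : Fin ℓ) a → (∀ i → set (f (span i)) ≡ S i) → set a ≡ S′ i →
    (∀ {i′} → i′ ≢ i → S i′ ≡ S′ i′) → ∀ i′ → set (upd f (span i) a (span i′)) ≡ S′ i′
  spans-upd {f} i a h e same i′ with i′ ≟ᶠ i
  ... | yes refl = trans (cong set (upd-same f (span i) a)) e
  ... | no i′≢i  = trans (cong set (upd-≢ f a (span-≢ i′≢i))) (trans (h i′) (same i′≢i))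

  fit-spec : ∀ S e s → e < n → Spans S s → var s $e ≡ e →
    Spans S (exec O fit s) × var (exec O fit s) $ok ≡ bit (fits S e)
  fit-spec S e s e<n spans e≡ = proj₁ (proj₁ answer) , proj₂ answer
    where
    Inv : Store → Set
    Inv s = Spans S s × var s $e ≡ e
    step : ∀ i s → Inv s → Inv (exec O (fitStep i) s) × var (exec O (fitStep i) s) $ok ≡
      (if not (has (S i) e) ∧ O i (S i ⊕ e) then var s $ok else 0)
    step i s (spans , refl) with arr s (span i) (var s $e) in eq
    ... | suc _ = (spans , refl) , sym (cong
          (λ b → if not b ∧ O i (S i ⊕ var s $e) then var s $ok else 0) member)
      where
      member : has (S i) (var s $e) ≡ true
      member = trans (cong (λ T → has T (var s $e)) (sym (spans i)))
        (trans (has-⟦⟧ (arr s (span i)) e<n) (cong on eq))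
    ... | zero = result
      where
      e′ = var s $e
      non-member : has (S i) e′ ≡ false
      non-member = trans (cong (λ T → has T e′) (sym (spans i)))
        (trans (has-⟦⟧ (arr s (span i)) e<n) (cong on eq))
      a₁ = put n (arr s (span i)) e′ 1
      f₁ = upd (arr s) (span i) a₁
      added : set (f₁ (span i)) ≡ S i ⊕ e′
      added = trans (cong set (upd-same (arr s) (span i) a₁))
        (trans (⟦put⟧-⊕ (arr s (span i)) e′ 0) (cong (_⊕ e′) (spans i)))
      restored : ∀ i′ → set (upd f₁ (span i) (put n (f₁ (span i)) e′ 0) (span i′)) ≡ S i′
      restored i′ with i′ ≟ᶠ i
      ... | yes refl = trans (cong set (upd-same f₁ (span i) _))
        (trans (⟦put⟧-⊖ (f₁ (span i)) e′) (trans (cong (_⊖ e′) added) (⊕⊖ (S i) non-member)))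
      ... | no i′≢i = trans (cong set (trans (upd-≢ f₁ _ (span-≢ i′≢i)) (upd-≢ (arr s) a₁ (span-≢ i′≢i)))) (spans i′)
      s₁ = exec O ($x :=# 0 ∙ $x :=# 1 ∙ span i [ $e ]← $x) s
      s₂ = exec O (ask $y i (span i) ∙ cond $y nop ($ok :=# 0) ∙ $x :=# 0 ∙ span i [ $e ]← $x) s₁
      result : Inv s₂ × var s₂ $ok ≡ (if not (has (S i) e′) ∧ O i (S i ⊕ e′) then var s $ok else 0)
      result rewrite non-member | added with O i (S i ⊕ e′)
      ... | true  = (restored , refl) , refl
      ... | false = (restored , refl) , refl

    answer : Inv (exec O fit s) × var (exec O fit s) $ok ≡ bit (fits S e)
    answer = all-pass (λ i → exec O (fitStep i)) _ Inv step (exec O ($ok :=# 1) s) (spans , e≡)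

  module _ (S : Fin ℓ → Subset n) where

    record Finding (m : ℕ) (s : Store) : Set where
      field
        index  : var s $e ≡ m
        choice : var s $p ≡ pick S m
        spans  : Spans S s

    find-step : ∀ m s → m < n → Finding m s → Finding (suc m) (exec O findStep s)
    find-step m s m<n h = record { index = ix ; choice = ch ; spans = sp }
      where
      open Finding h
      answer = fit-spec S m s m<n spans index
      index₁ : var (exec O fit s) $e ≡ m
      index₁ = trans (frame O fit s _) index
      ix : var (exec O findStep s) $e ≡ suc m
      ix = cong suc (trans (frame O (cond $ok ($p := $e ∙ incr $p) nop) (exec O fit s) _) index₁)
      ch : var (exec O findStep s) $p ≡ pick S (suc m)
      ch rewrite proj₂ answer with fits S m
      ... | true  = cong suc index₁
      ... | false = trans (frame O fit s _) choice
      sp : Spans S (exec O findStep s)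
      sp i = trans (cong set (frame-arr O (cond $ok ($p := $e ∙ incr $p) nop ∙ incr $e) (exec O fit s) _))
                   (proj₁ answer i)

    find-spec : ∀ s → var s $n ≡ n → Spans S s → Finding n (exec O find s)
    find-spec s n≡ spans = loop-ind O Finding $n findStep (exec O ($p :=# 0 ∙ $e :=# 0) s) n≡ ≤-refl find-step
      (record { index = refl ; choice = refl ; spans = spans })

  ≢⇒T-not : ∀ {x y} → x ≢ y → T (not (x ≡ᵇ y))
  ≢⇒T-not {x} {y} p rewrite ≢⇒≡ᵇ-false x y p = tt

  reset-one : ∀ i s → var s $n ≡ n → ∀ {x} → x < n →
    arr (exec O ($i :=# 0 ∙ loop $n (resetStep i)) s) (span i) x ≡ arr s cand x
  reset-one i s n≡ x<n = proj₂ (loop-ind O Copied $n (resetStep i) (exec O ($i :=# 0) s) n≡ ≤-refl step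
    (refl , refl , λ ())) .proj₂ x<n
    where
    Copied : ℕ → Store → Set
    Copied m s′ = var s′ $i ≡ m × arr s′ cand ≡ arr s cand ×
                  (∀ {x} → x < m → arr s′ (span i) x ≡ arr s cand x)
    step : ∀ m s′ → m < n → Copied m s′ → Copied (suc m) (exec O (resetStep i) s′)
    step m s′ m<n (i≡ , c≡ , h) = cong suc i≡ , c≡ , copied
      where
      v = arr s′ cand (var s′ $i)
      a = put n (arr s′ (span i)) (var s′ $i) v
      copied : ∀ {x} → x < suc m → upd (arr s′) (span i) a (span i) x ≡ arr s cand x
      copied {x} x< = trans (cong (λ a → a x) (upd-same (arr s′) (span i) a)) cell
        where
        cell : a x ≡ arr s cand x
        cell rewrite i≡ with x ≟ m
        ... | yes refl = trans (put-same n (arr s′ (span i)) _ m<n) (cong (λ a → a m) c≡)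
        ... | no x≢m   = trans (put-≢ n (arr s′ (span i)) _ x≢m) (h (≤∧≢⇒< (≤-pred x<) x≢m))

  reset-spec : ∀ T s → var s $n ≡ n → Holds T s → Spans (λ _ → T) (exec O reset s)
  reset-spec T s n≡ h i = proj₂ (proj₂ (each-ind Done (λ i → (exec O ($i :=# 0 ∙ loop $n (resetStep i)))) step
    (n≡ , h , λ _ ()))) i (toℕ<n i)
    where
    Done : ℕ → Store → Set
    Done m s = var s $n ≡ n × Holds T s × (∀ i → toℕ i < m → set (arr s (span i)) ≡ T)
    step : ∀ i s → Done (toℕ i) s → Done (suc (toℕ i)) (exec O ($i :=# 0 ∙ loop $n (resetStep i)) s)
    step i s (n≡ , h , d) = trans (frame O c s _) n≡ , trans (cong set (frame-arr O c s _)) h , done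
      where
      c : Com ℓ
      c = $i :=# 0 ∙ loop $n (resetStep i)
      done : ∀ i′ → toℕ i′ < suc (toℕ i) → set (arr (exec O c s) (span i′)) ≡ T
      done i′ lt with i′ ≟ᶠ i
      ... | yes refl = trans (tabulate-cong λ e → cong on (reset-one i s n≡ (toℕ<n e))) h
      ... | no i′≢i = trans (cong set (frame-arr O c s (tt , tt , ≢⇒T-not (span-≢ i′≢i) , tt)))
        (d i′ (≤∧≢⇒< (≤-pred lt) (i′≢i ∘ toℕ-injective)))

  <ᵇ-suc-≢ : ∀ x y → x ≢ y → (x <ᵇ suc y) ≡ (x <ᵇ y)
  <ᵇ-suc-≢ zero    zero    p = contradiction refl p
  <ᵇ-suc-≢ zero    (suc y) p = refl
  <ᵇ-suc-≢ (suc x) zero    p = refl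
  <ᵇ-suc-≢ (suc x) (suc y) p = <ᵇ-suc-≢ x y (p ∘ cong suc)

  module _ (t₀ : ℕ → ℕ) (pos : ℕ) (α : ℕ → Bool) (α≡ : ∀ {x} → x < ℓ → α x ≡ on (t₀ (pos + x)))
    (S : Fin ℓ → Subset n) (p : ℕ) where

    -- The sets after m of the ℓ bits have been read. The factor `on p` covers a failed `pick`, when
    -- the bits are consumed without effect.
    grown : ℕ → Fin ℓ → Subset n
    grown m i = if (toℕ i <ᵇ m) ∧ (on p ∧ α (toℕ i)) then S i ⊕ pred p else S i

    record Growing (m : ℕ) (s : Store) : Set where
      field
        choice : var s $p ≡ p
        index  : var s $e ≡ pred p
        source : var s $pos ≡ pos + m
        tape≡  : arr s tape ≡ t₀
        any≡   : var s $any ≡ bit (on p ∧ anyBelow m α)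
        spans  : Spans (grown m) s

    grow-step : ∀ i s → Growing (toℕ i) s → Growing (suc (toℕ i)) (exec O (growStep i) s)
    grow-step i s h = record
      { choice = trans (frame O (growStep i) s _) choice
      ; index  = trans (frame O (growStep i) s _) index
      ; source = trans (frame O (cond $x (cond $p (span i [ $e ]← $x ∙ $any :=# 1) nop) nop) s₁ _)
                   (trans (cong suc source) (sym (+-suc pos (toℕ i))))
      ; tape≡  = trans (frame-arr O (growStep i) s _) tape≡
      ; any≡   = an
      ; spans  = sp
      }
      where
      open Growing h
      s₁ = exec O ($x ← tape [ $pos ] ∙ incr $pos) s
      x≡ : on (arr s tape (var s $pos)) ≡ α (toℕ i)
      x≡ = trans (cong₂ (λ t x → on (t x)) tape≡ source) (sym (α≡ (toℕ<n i)))
      an : var (exec O (growStep i) s) $any ≡ bit (on p ∧ (anyBelow (toℕ i) α ∨ α (toℕ i)))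
      an rewrite sym x≡ with arr s tape (var s $pos)
      ... | zero rewrite ∨-identityʳ (anyBelow (toℕ i) α) = any≡
      ... | suc _ = branch-elim (λ st → var st $any ≡ bit (on p ∧ (anyBelow (toℕ i) α ∨ true)))
        (λ q → sym (cong bit (cong₂ _∧_ (cong on (trans (sym choice) q)) (∨-zeroʳ (anyBelow (toℕ i) α)))))
        (λ q → trans any≡ (trans (cong (λ p → bit (on p ∧ anyBelow (toℕ i) α)) (trans (sym choice) q))
                 (cong (λ p → bit (on p ∧ (anyBelow (toℕ i) α ∨ true))) (sym (trans (sym choice) q)))))
      same : (on p ∧ α (toℕ i)) ≡ false → ∀ i′ → grown (toℕ i) i′ ≡ grown (suc (toℕ i)) i′
      same q i′ with i′ ≟ᶠ i
      ... | yes refl rewrite q | ∧-zeroʳ (toℕ i <ᵇ toℕ i) | ∧-zeroʳ (toℕ i <ᵇ suc (toℕ i)) = refl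
      ... | no i′≢i rewrite <ᵇ-suc-≢ (toℕ i′) (toℕ i) (i′≢i ∘ toℕ-injective) = refl
      other : ∀ {i′} → i′ ≢ i → grown (toℕ i) i′ ≡ grown (suc (toℕ i)) i′
      other {i′} i′≢i rewrite <ᵇ-suc-≢ (toℕ i′) (toℕ i) (i′≢i ∘ toℕ-injective) = refl
      before′ : set (arr s (span i)) ≡ S i
      before′ = trans (spans i) (cong (λ b → if b ∧ (on p ∧ α (toℕ i)) then S i ⊕ pred p else S i)
                  (≥⇒<ᵇ-false {toℕ i} ≤-refl))
      sp : Spans (grown (suc (toℕ i))) (exec O (growStep i) s)
      sp with arr s tape (var s $pos) | x≡
      ... | zero  | α-i = λ i′ → trans (spans i′)
              (same (trans (cong (on p ∧_) (sym α-i)) (∧-zeroʳ (on p))) i′)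
      ... | suc v | α-i = branch-elim (Spans (grown (suc (toℕ i))))
        (λ q → spans-upd {f = arr s} i (put n (arr s (span i)) (var s $e) (suc v)) spans
          (trans (⟦put⟧-⊕ (arr s (span i)) (var s $e) v) (trans (cong₂ _⊕_ before′ index)
            (sym (cong₂ (λ b c → if b ∧ c then S i ⊕ pred p else S i)
              (<⇒<ᵇ-true {toℕ i} ≤-refl) (cong₂ _∧_ (cong on (trans (sym choice) q)) (sym α-i))))))
          other)
        (λ q i′ → trans (spans i′) (same (cong (λ p → on p ∧ α (toℕ i)) (trans (sym choice) q)) i′))

  conclude-spec : ∀ p b v T S s → var s $n ≡ n → var s $p ≡ p → var s $e ≡ pred p →
    var s $any ≡ bit (on p ∧ b) → Holds T s →
    (∀ i → set (arr s (span i)) ≡ (if on p ∧ v i then S i ⊕ pred p else S i)) →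
    Holds (growT p b T) (exec O conclude s) × Spans (growS p b v T S) (exec O conclude s)
  conclude-spec zero    b     v T S s n≡ p≡ e≡ a≡ holds spans rewrite p≡ = holds , spans
  conclude-spec (suc e) true  v T S s n≡ p≡ e≡ a≡ holds spans rewrite p≡ | a≡ = holds , spans
  conclude-spec (suc e) false v T S s n≡ p≡ e≡ a≡ holds spans rewrite p≡ | a≡ =
    trans (cong set (frame-arr O reset s′ _)) added , reset-spec (T ⊕ e) s′ n≡ added
    where
    s′ = exec O ($x :=# 1 ∙ cand [ $e ]← $x) s
    added : Holds (T ⊕ e) s′
    added = trans (⟦put⟧-⊕ (arr s cand) (var s $e) 0) (cong₂ _⊕_ holds e≡)

  module _ (W : ℕ) where

    record Searches (t₀ : ℕ → ℕ) (T : Subset n) (S : Fin ℓ → Subset n) (pos : ℕ) (s : Store) : Set where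
      field
        n≡     : var s $n ≡ n
        tape≡  : arr s tape ≡ t₀
        source : var s $pos ≡ pos
        holds  : Holds T s
        spans  : Spans S s

    module _ {t₀ : ℕ → ℕ} {T : Subset n} {S : Fin ℓ → Subset n} {pos : ℕ} {α : ℕ → Bool}
      (α≡ : ∀ {x} → x < ℓ → α x ≡ on (t₀ (pos + x))) where

      private
        p = pick S n
        b = anyF {ℓ} (α ∘ toℕ)

      finish : ∀ s → Growing t₀ pos α α≡ S p ℓ s → var s $n ≡ n → Holds T s →
        Searches t₀ (growT p b T) (growS p b (α ∘ toℕ) T S) (pos + ℓ) (exec O conclude s)
      finish s gr n≡ holds = record
        { n≡ = trans (frame O conclude s _) n≡
        ; tape≡ = trans (frame-arr O conclude s _) (Growing.tape≡ gr)
        ; source = trans (frame O conclude s _) (Growing.source gr)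
        ; holds = proj₁ outcome
        ; spans = proj₂ outcome }
        where
        outcome : Holds (growT p b T) (exec O conclude s) × Spans (growS p b (α ∘ toℕ) T S) (exec O conclude s)
        outcome = conclude-spec p b (α ∘ toℕ) T S s n≡ (Growing.choice gr) (Growing.index gr)
          (trans (Growing.any≡ gr) (cong (λ b → bit (on p ∧ b)) (sym (anyF-toℕ ℓ α)))) holds
          λ i → trans (Growing.spans gr i)
            (cong (λ b → if b ∧ (on p ∧ α (toℕ i)) then S i ⊕ pred p else S i) (<⇒<ᵇ-true (toℕ<n i)))

      middle : ∀ s → Growing t₀ pos α α≡ S p 0 s → var s $n ≡ n → Holds T s →
        Searches t₀ (growT p b T) (growS p b (α ∘ toℕ) T S) (pos + ℓ) (exec O (each growStep ∙ conclude) s)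
      middle s gr n≡ holds = finish (exec O (each growStep) s)
        (each-ind (Growing t₀ pos α α≡ S p) (λ i → exec O (growStep i)) (grow-step t₀ pos α α≡ S p) gr)
        (trans (frame O (each growStep) s _) n≡)
        (trans (cong set (frame-arr O (each growStep) s _)) holds)

      begin-grow : ∀ s → Searches t₀ T S pos s → Finding S n s →
        Searches t₀ (growT p b T) (growS p b (α ∘ toℕ) T S) (pos + ℓ) (exec O grow s)
      begin-grow s h found = middle (exec O ($any :=# 0 ∙ $e := $p ∙ decr $e) s)
        (record { choice = Finding.choice found ; index = cong pred (Finding.choice found)
                ; source = trans source (sym (+-identityʳ pos))
                ; tape≡ = tape≡
                ; any≡ = sym (cong bit (∧-zeroʳ (on p)))
                ; spans = spans }) n≡ holds
        where open Searches h

      search-step : ∀ s → Searches t₀ T S pos s →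
        Searches t₀ (growT p b T) (growS p b (α ∘ toℕ) T S) (pos + ℓ) (exec O (find ∙ grow) s)
      search-step s h = begin-grow (exec O find s) (record
        { n≡ = trans (frame O find s _) n≡
        ; tape≡ = trans (frame-arr O find s _) tape≡
        ; source = trans (frame O find s _) source
        ; holds = trans (cong set (frame-arr O find s _)) holds
        ; spans = Finding.spans found }) found
        where
        open Searches h
        found = find-spec S s n≡ spans

    search-loop : ∀ w {t₀ T S pos α s} → (∀ {x} → x < w * ℓ → α x ≡ on (t₀ (pos + x))) →
      Searches t₀ T S pos s → Holds (walk w α T S) (iterate (exec O (find ∙ grow)) s w)
    search-loop zero    α≡ h = Searches.holds h
    search-loop (suc w) {t₀} {pos = pos} {α} α≡ h = search-loop w {α = λ p → α (ℓ + p)}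
      (λ {x} x< → trans (α≡ (+-monoʳ-< ℓ x<)) (cong (on ∘ t₀) (sym (+-assoc pos ℓ x))))
      (search-step (λ x< → α≡ (≤-trans x< (m≤m+n ℓ (w * ℓ)))) _ h)

    search-spec : ∀ {T α} s → var s $n ≡ n → var s $W ≡ W → W ≤ n → Holds T s →
      (∀ {x} → x < W * ℓ → α x ≡ on (arr s tape (var s $pos + x))) →
      Holds (walk W α T (λ _ → T)) (exec O search s)
    search-spec {T} s n≡ W≡ W≤n holds α≡ = subst (Holds _)
      (sym (loop-unfold O $W (find ∙ grow) (exec O reset s) (trans (frame O reset {$W} s _) W≡) W≤n))
      (search-loop W α≡ (record
        { n≡ = trans (frame O reset s _) n≡
        ; tape≡ = frame-arr O reset s _
        ; source = frame O reset s _
        ; holds = trans (cong set (frame-arr O reset s _)) holds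
        ; spans = reset-spec T s n≡ holds }))

-- One round of the enumeration.

module Bodies {ℓ n : ℕ} (M : Instance ℓ n) (k s N g W : ℕ) where

  open Routines (oracles M)
  open Searching (oracles M)
  open Search (oracles M)
  open Code k s N g

  record Sound (st : Store) : Set where
    constructor sound
    field verdict : (var st $out ≡ 0) ⊎ (var st $out ≡ 1 × HasCommonBasis M)

  -- A verdict 1 is never withdrawn and always comes with a common basis. Both hold for any contents
  -- of the tape, which is why meaningless strings do no harm.
  record Progress (st st′ : Store) : Set where
    field
      sound′ : Sound st → Sound st′
      keep   : var st $out ≡ 1 → var st′ $out ≡ 1

  open Progress

  progress-trans : ∀ {st st′ st″} → Progress st st′ → Progress st′ st″ → Progress st st″
  progress-trans p q = record { sound′ = sound′ q ∘ sound′ p ; keep = keep q ∘ keep p }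

  progress-same : ∀ {st st′} → var st′ $out ≡ var st $out → Progress st st′
  progress-same e = record
    { sound′ = λ { (sound (inj₁ z)) → sound (inj₁ (trans e z))
                 ; (sound (inj₂ (z , b))) → sound (inj₂ (trans e z , b)) }
    ; keep = trans e }

  verify-progress : ∀ st → var st $n ≡ n → Progress st (exec (oracles M) verify st)
  verify-progress st n≡ = go (verify-spec (set (arr st cand)) st n≡ refl)
    where
    go : ∀ {st′} → var st′ $out ≡ (if accepts (set (arr st cand)) then 1 else var st $out) →
         Progress st st′
    go e with accepts (set (arr st cand)) in eq
    ... | false = progress-same e
    ... | true  = record
      { sound′ = λ _ → sound (inj₂ (e , _ , accepts⇒common-basis M eq)) ; keep = λ _ → e }

  verify-success : ∀ {T} st → var st $n ≡ n → Holds T st → CommonMaximum M T →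
    var (exec (oracles M) verify st) $out ≡ 1
  verify-success {T} st n≡ holds max = trans (verify-spec T st n≡ holds)
    (cong (λ b → if b then 1 else var st $out) (maximum⇒accepts M max))

  private
    P : Store → Set
    P = Params k s N g W

  -- The string is B with a window of g zeros cut out, so the part right of the window is shifted by
  -- g. The loop in `windows` visits the origins below n, whence `origin<n`.
  record WindowOf (B : Subset n) (τ : ℕ → Bool) : Set where
    field
      max   : CommonMaximum M B
      origin : ℕ
      inside : origin + g ≤ n
      origin<n : origin < n
      gap   : ∀ {x} → x < g → has B (origin + x) ≡ false
      left  : ∀ {x} → x < origin → τ x ≡ has B x
      right : ∀ {x} → origin + x < n ∸ g → τ (origin + x) ≡ has B (origin + g + x)

  -- The bits of X from g on are followed by the advice. The common basis reached by `walk` may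
  -- differ from the one from which X was obtained.
  record CodeOf (X : Subset n) (τ : ℕ → Bool) : Set where
    field
      codeword : Codeword X
      high     : ∀ {x} → x < n ∸ g → τ x ≡ has X (g + x)
      max      : CommonMaximum M (walk W (λ x → τ (n ∸ g + x)) X (λ _ → X))

  spread-window : ∀ {B τ} (w : WindowOf B τ) st → P st →
    var st $a ≡ WindowOf.origin w → var st $b ≡ n ∸ g ∸ WindowOf.origin w →
    (∀ {x} → x < n ∸ g → on (arr st tape x) ≡ τ x) → Holds B (exec (oracles M) spread st)
  spread-window {B} {τ} w st ps a≡ b≡ τ≡ = has-ext λ e e<n →
    trans (has-⟦⟧ (arr (exec (oracles M) spread st) cand) e<n) (value e e<n)
    where
    open WindowOf w renaming (origin to a)
    b = n ∸ g ∸ a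
    a≤n-g : a ≤ n ∸ g
    a≤n-g = ≤-trans (≤-reflexive (sym (m+n∸n≡m a g))) (∸-monoˡ-≤ g inside)
    g≤n : g ≤ n
    g≤n = ≤-trans (m≤n+m g a) inside
    total : a + g + b ≡ n
    total = trans (cong (_+ b) (+-comm a g)) (trans (+-assoc g a b)
      (trans (cong (_+_ g) (m+[n∸m]≡n a≤n-g)) (m+[n∸m]≡n g≤n)))
    sp : Spread a g b st (exec (oracles M) spread st)
    sp = spread-spec a g b st (≤-reflexive total) a≡ (Params.g≡ ps) b≡
    value : ∀ e → e < n → on (arr (exec (oracles M) spread st) cand e) ≡ has B e
    value e e<n with e <? a
    ... | yes e<a = trans (cong on (Spread.left sp e<a))
      (trans (τ≡ (≤-trans e<a a≤n-g)) (left e<a))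
    ... | no e≮a with x , refl ← m≤n⇒∃[o]m+o≡n (≮⇒≥ e≮a) with x <? g
    ...   | yes x<g = trans (cong on (Spread.gap sp x<g)) (sym (gap x<g))
    ...   | no x≮g with y , refl ← m≤n⇒∃[o]m+o≡n (≮⇒≥ x≮g) =
      subst (λ e → on (arr (exec (oracles M) spread st) cand e) ≡ has B e) (+-assoc a g y)
        (trans (cong on (Spread.right sp y<b)) (trans (τ≡ a+y<) (right a+y<)))
      where
      y<b : y < b
      y<b = +-cancelˡ-< (a + g) _ _ (subst₂ _<_ (sym (+-assoc a g y)) (sym total) e<n)
      a+y< : a + y < n ∸ g
      a+y< = subst (a + y <_) (m+[n∸m]≡n a≤n-g) (+-monoʳ-< a y<b)

  module _ (st₀ : Store) where

    -- For m beyond `n ∸ g` the variable `$b` stays 0 and the candidate has no meaning. `progress`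
    -- holds regardless, while `success` speaks of genuine windows only.
    record Sliding (m : ℕ) (st : Store) : Set where
      field
        params   : P st
        start≡   : var st $a ≡ m
        rest≡    : var st $b ≡ n ∸ g ∸ m
        tape≡    : arr st tape ≡ arr st₀ tape
        progress : Progress st₀ st
        success  : ∀ {B τ} (w : WindowOf B τ) → WindowOf.origin w < m →
                   (∀ {x} → x < n ∸ g → on (arr st₀ tape x) ≡ τ x) → var st $out ≡ 1

    window-verified : ∀ m st → Sliding m st → Progress st (exec (oracles M) (spread ∙ verify) st) ×
      (∀ {B τ} (w : WindowOf B τ) → WindowOf.origin w < suc m →
         (∀ {x} → x < n ∸ g → on (arr st₀ tape x) ≡ τ x) → var (exec (oracles M) (spread ∙ verify) st) $out ≡ 1)
    window-verified m st h = prog , succ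
      where
      open Sliding h
      st₁ = exec (oracles M) spread st
      n≡₁ : var st₁ $n ≡ n
      n≡₁ = trans (frame (oracles M) spread st _) (Params.n≡ params)
      prog : Progress st (exec (oracles M) verify st₁)
      prog = progress-trans (progress-same (frame (oracles M) spread st _)) (verify-progress st₁ n≡₁)
      succ : ∀ {B τ} (w : WindowOf B τ) → WindowOf.origin w < suc m →
         (∀ {x} → x < n ∸ g → on (arr st₀ tape x) ≡ τ x) → var (exec (oracles M) verify st₁) $out ≡ 1
      succ {B} {τ} w lt τ≡ with WindowOf.origin w ≟ m
      ... | no  ≢m = keep prog (success w (≤∧≢⇒< (≤-pred lt) ≢m) τ≡)
      ... | yes a≡m = verify-success st₁ n≡₁
        (spread-window w st params (trans start≡ (sym a≡m))
          (trans rest≡ (cong (n ∸ g ∸_) (sym a≡m)))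
          (λ {x} x< → trans (cong (λ t → on (t x)) tape≡) (τ≡ x<)))
        (WindowOf.max w)

    window-step : ∀ m st → m < n → Sliding m st → Sliding (suc m) (exec (oracles M) windowStep st)
    window-step m st _ h = record
      { params   = keep-params windowStep st _ params
      ; start≡   = cong suc (trans (frame (oracles M) (spread ∙ verify) st _) start≡)
      ; rest≡    = trans (cong pred (trans (frame (oracles M) (spread ∙ verify) st _) rest≡))
                     (pred[m∸n]≡m∸[1+n] (n ∸ g) m)
      ; tape≡    = trans (frame-arr (oracles M) windowStep st _) tape≡
      ; progress = progress-trans progress (progress-trans (proj₁ verified)
                     (progress-same (frame (oracles M) (incr $a ∙ decr $b) (exec (oracles M) (spread ∙ verify) st) _)))
      ; success  = λ w lt τ≡ → trans (frame (oracles M) (incr $a ∙ decr $b) (exec (oracles M) (spread ∙ verify) st) _)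
                     (proj₂ verified w lt τ≡)
      }
      where
      open Sliding h
      verified = window-verified m st h

  windows-spec : ∀ st → P st → Sliding st n (exec (oracles M) windows st)
  windows-spec st ps = loop-ind (oracles M) (Sliding st) $n windowStep (exec (oracles M) ($a :=# 0 ∙ $b := $n-g) st)
    (Params.n≡ ps) ≤-refl (window-step st)
    (record { params = keep-params ($a :=# 0 ∙ $b := $n-g) st _ ps
            ; start≡ = refl ; rest≡ = Params.n-g≡ ps ; tape≡ = refl
            ; progress = progress-same refl ; success = λ _ () })

  tapeLength : ℕ
  tapeLength = n ∸ g + W * ℓ

  Good : (ℕ → Bool) → Set
  Good τ = (∃[ B ] WindowOf B τ) ⊎ (∃[ X ] CodeOf X τ)

  module _ (g≡ks : g ≡ k * s) (room : g + (k * N) * g ≤ n) (k≤n : k ≤ n) (s≤n : s ≤ n)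
    (N≤n : 0 < k → N ≤ n) (W≤n : W ≤ n) (L≤n : tapeLength ≤ n) where

    private
      module E X = Encoding k s N g W g≡ks room k≤n s≤n N≤n X

      g≤n : g ≤ n
      g≤n = ≤-trans (m≤m+n g _) room

    encoded : ∀ {X τ} → CodeOf X τ → ∀ st {st₁} → P st₁ → Spread 0 g (n ∸ g) st st₁ →
      (∀ {x} → x < n ∸ g → on (arr st tape x) ≡ τ x) → Holds X (exec (oracles M) encode st₁)
    encoded {X} {τ} c st {st₁} ps sp τ≡ = E.encode-spec X st₁ ps high₁ (Spread.gap sp) codeword
      where
      open CodeOf c
      high₁ : E.High X st₁
      high₁ g≤x x<n with y , refl ← m≤n⇒∃[o]m+o≡n g≤x = trans (cong on (Spread.right sp y<)) (trans (τ≡ y<) (high y<))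
        where
        y< : y < n ∸ g
        y< = +-cancelˡ-< g _ _ (subst (g + y <_) (sym (m+[n∸m]≡n g≤n)) x<n)

    searched : ∀ {X τ} → CodeOf X τ → ∀ st → P st → Holds X st → var st $pos ≡ n ∸ g →
      (∀ {x} → x < tapeLength → on (arr st tape x) ≡ τ x) →
      ∃[ T ] (CommonMaximum M T × Holds T (exec (oracles M) search st))
    searched {X} {τ} c st ps holds pos≡ τ≡ = _ , CodeOf.max c ,
      search-spec W st (Params.n≡ ps) (Params.W≡ ps) W≤n holds
        λ {x} x< → sym (trans (cong (λ p → on (arr st tape (p + x))) pos≡) (τ≡ (+-monoʳ-< (n ∸ g) x<)))

    attempt-end : ∀ st → P st → Progress st (exec (oracles M) (search ∙ verify) st) ×
      (∀ {X τ} → CodeOf X τ → Holds X st → var st $pos ≡ n ∸ g →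
        (∀ {x} → x < tapeLength → on (arr st tape x) ≡ τ x) → var (exec (oracles M) (search ∙ verify) st) $out ≡ 1)
    attempt-end st ps = progress-trans (progress-same (frame (oracles M) search st _)) (verify-progress (exec (oracles M) search st) n≡′) ,
      λ c holds pos≡ τ≡ → let T , max , h = searched c st ps holds pos≡ τ≡ in
        verify-success (exec (oracles M) search st) n≡′ h max
      where
      n≡′ : var (exec (oracles M) search st) $n ≡ n
      n≡′ = trans (frame (oracles M) search st _) (Params.n≡ ps)

    attempt-encode : ∀ st → P st → Progress st (exec (oracles M) (encode ∙ search ∙ verify) st) ×
      (∀ {X τ} → CodeOf X τ → ∀ st₀ → Spread 0 g (n ∸ g) st₀ st →
        (∀ {x} → x < tapeLength → on (arr st₀ tape x) ≡ τ x) → arr st tape ≡ arr st₀ tape →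
        var (exec (oracles M) (encode ∙ search ∙ verify) st) $out ≡ 1)
    attempt-encode st ps =
      progress-trans (progress-same (frame (oracles M) encode st _)) (proj₁ (attempt-end (exec (oracles M) encode st) ps′)) ,
      λ c st₀ sp τ≡ t≡ → proj₂ (attempt-end (exec (oracles M) encode st) ps′) c
        (encoded c st₀ ps sp (λ x< → τ≡ (≤-trans x< (m≤m+n (n ∸ g) (W * ℓ)))))
        (trans (frame (oracles M) encode st _) (Spread.source sp))
        (λ {x} x< → trans (cong (λ t → on (t x)) (trans (frame-arr (oracles M) encode st _) t≡)) (τ≡ x<))
      where
      ps′ : P (exec (oracles M) encode st)
      ps′ = keep-params encode st _ ps

    attempt-spec : ∀ st → P st → Progress st (exec (oracles M) attempt st) ×
      (∀ {X τ} → CodeOf X τ → (∀ {x} → x < tapeLength → on (arr st tape x) ≡ τ x) →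
         var (exec (oracles M) attempt st) $out ≡ 1)
    attempt-spec st ps =
      progress-trans (progress-same (frame (oracles M) spread st₁ _)) (proj₁ (attempt-encode (exec (oracles M) spread st₁) ps₂)) ,
      λ c τ≡ → proj₂ (attempt-encode (exec (oracles M) spread st₁) ps₂) c st₁
        (spread-spec 0 g (n ∸ g) st₁ (≤-reflexive (m+[n∸m]≡n g≤n)) refl (Params.g≡ ps) (Params.n-g≡ ps))
        τ≡ (frame-arr (oracles M) spread st₁ _)
      where
      st₁ = exec (oracles M) ($a :=# 0 ∙ $b := $n-g) st
      ps₂ : P (exec (oracles M) spread st₁)
      ps₂ = keep-params ($a :=# 0 ∙ $b := $n-g ∙ spread) st _ ps

    -- Strings are numbered by their binary value. For t the number of all strings, `valid` and
    -- `tried` together give the verdict.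
    record Main (t : ℕ) (st : Store) : Set where
      field
        params : P st
        bits   : ∀ {x} → x < tapeLength → arr st tape x ≡ bit (bitOf x t)
        valid  : Sound st
        tried  : ∀ {t′} → t′ < t → Good (λ x → bitOf x t′) → var st $out ≡ 1

    advance : ∀ t st → P st → (∀ {x} → x < tapeLength → arr st tape x ≡ bit (bitOf x t)) →
      (∀ {x} → x < tapeLength → arr (exec (oracles M) (bump tape $L ∙ setMore) st) tape x ≡ bit (bitOf x (suc t))) ×
      var (exec (oracles M) (bump tape $L ∙ setMore) st) $more ≡ bit (not (ones tapeLength t))
    advance t st ps bits = (λ {x} x< → trans (cong (λ a → a x) (frame-arr (oracles M) setMore st₁ _)) (Bumping.done b x<)) ,
      more
      where
      st₁ = exec (oracles M) (bump tape $L) st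
      b : Bumping tape t tapeLength L≤n tapeLength st₁
      b = bump-spec tape t tapeLength L≤n $L st (Params.L≡ ps) bits
      more : var (exec (oracles M) setMore st₁) $more ≡ bit (not (ones tapeLength t))
      more = after st₁ (Bumping.carry b)
        where
        after : ∀ {c} st → var st $ok ≡ bit c → var (exec (oracles M) setMore st) $more ≡ bit (not c)
        after {true}  st e rewrite e = refl
        after {false} st e rewrite e = refl

    body-end : ∀ t st st₂ → Main t st → P st₂ → arr st₂ tape ≡ arr st tape → Progress st st₂ →
      (Good (λ x → bitOf x t) → var st₂ $out ≡ 1) →
      Main (suc t) (exec (oracles M) (bump tape $L ∙ setMore) st₂) ×
      var (exec (oracles M) (bump tape $L ∙ setMore) st₂) $more ≡ bit (not (ones tapeLength t))
    body-end t st st₂ h ps₂ tape₂ prog current = record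
      { params = keep-params (bump tape $L ∙ setMore) st₂ _ ps₂
      ; bits   = proj₁ moved
      ; valid  = sound′ prog′ valid
      ; tried  = λ {t′} → go t′ }
      , proj₂ moved
      where
      open Main h
      out≡ : var (exec (oracles M) (bump tape $L ∙ setMore) st₂) $out ≡ var st₂ $out
      out≡ = frame (oracles M) (bump tape $L ∙ setMore) st₂ _
      prog′ : Progress st (exec (oracles M) (bump tape $L ∙ setMore) st₂)
      prog′ = progress-trans prog (progress-same out≡)
      moved = advance t st₂ ps₂ (λ {x} x< → trans (cong (λ a → a x) tape₂) (bits x<))
      go : ∀ t′ → t′ < suc t → Good (λ x → bitOf x t′) →
           var (exec (oracles M) (bump tape $L ∙ setMore) st₂) $out ≡ 1
      go t′ lt good with t′ ≟ t
      ... | yes refl = trans out≡ (current good)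
      ... | no t′≢t  = keep prog′ (tried (≤∧≢⇒< (≤-pred lt) t′≢t) good)

    body-middle : ∀ t st st₁ → Main t st → Sliding st n st₁ →
      Main (suc t) (exec (oracles M) (attempt ∙ bump tape $L ∙ setMore) st₁) ×
      var (exec (oracles M) (attempt ∙ bump tape $L ∙ setMore) st₁) $more ≡ bit (not (ones tapeLength t))
    body-middle t st st₁ h slid = body-end t st (exec (oracles M) attempt st₁) h
      (keep-params attempt st₁ _ params₁)
      (trans (frame-arr (oracles M) attempt st₁ _) tape≡)
      (progress-trans progress (proj₁ tried₁)) current
      where
      open Main h
      open Sliding slid renaming (params to params₁)
      tried₁ = attempt-spec st₁ params₁
      current : Good (λ x → bitOf x t) → var (exec (oracles M) attempt st₁) $out ≡ 1
      current (inj₁ (B , w)) = keep (proj₁ tried₁) (success w (WindowOf.origin<n w)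
        λ x< → trans (cong on (bits (≤-trans x< (m≤m+n (n ∸ g) (W * ℓ))))) (on-bit _))
      current (inj₂ (X , c)) = proj₂ tried₁ c
        λ {x} x< → trans (cong (λ a → on (a x)) tape≡) (trans (cong on (bits x<)) (on-bit _))

    body-spec : ∀ t st → Main t st → Main (suc t) (exec (oracles M) body st) ×
      var (exec (oracles M) body st) $more ≡ bit (not (ones tapeLength t))
    body-spec t st h = body-middle t st (exec (oracles M) windows st) h (windows-spec st (Main.params h))

-- Iterated halving and the choice of the parameters.

module _ {A : Set} (f : A → A) where

  iterate-suc : ∀ x m → iterate f x (suc m) ≡ f (iterate f x m)
  iterate-suc x zero    = refl
  iterate-suc x (suc m) = iterate-suc (f x) m

-- Zero exactly if h < `2 ^ a`. The comparison is made by halving h because the power may exceed n,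
-- the cap on all loops.
div2 : ℕ → ℕ → ℕ
div2 a h = iterate ⌊_/2⌋ h a

div2-zero : ∀ a h → div2 a h ≡ 0 → h < 2 ^ a
div2-zero zero    h e = s≤s (≤-reflexive e)
div2-zero (suc a) h e rewrite 2*-double (2 ^ a) = ≤-trans (s≤s (≤-trans (≤-reflexive (halves h))
    (+-monoˡ-≤ _ (bit≤1 (odd h))))) (≤-trans (≤-reflexive (cong suc (sym (+-suc _ _)))) (+-mono-≤ p p))
  where
  p = div2-zero a ⌊ h /2⌋ e
  bit≤1 : ∀ b → bit b ≤ 1
  bit≤1 true  = ≤-refl
  bit≤1 false = z≤n

div2-nonzero : ∀ a h → div2 a h ≢ 0 → 2 ^ a ≤ h
div2-nonzero zero    zero    e = contradiction refl e
div2-nonzero zero    (suc h) e = s≤s z≤n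
div2-nonzero (suc a) h e rewrite 2*-double (2 ^ a) =
  ≤-trans (+-mono-≤ p p) (≤-trans (m≤n+m _ (bit (odd h))) (≤-reflexive (sym (halves h))))
  where p = div2-nonzero a ⌊ h /2⌋ e

div2≤ : ∀ a h → div2 a h ≤ h
div2≤ zero    h = ≤-refl
div2≤ (suc a) h = ≤-trans (div2≤ a ⌊ h /2⌋) (⌊n/2⌋≤n h)

-- n lies between 2 ^ (k scale) and
-- 2 ^ ((k + 1) scale) for k = order n.

module Sizes (ℓ : ℕ) where

  -- In units of k², the advice takes `ℓ * ℓ` and the gain 1, which makes up `rate`. The value of
  -- `scale`, namely 2 * rate + 4, is what `bound` requires. The products are bracketed as the
  -- nested `each` loops of `setS` and `shrink` produce them.
  rate scale : ℕ
  rate  = 1 + ℓ * (ℓ * 1)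
  scale = 6 + ℓ * (ℓ * 2)

  -- Counts the m′ from 1 to m with `2 ^ (m′ * scale) ≤ n`. These form an initial segment, so the
  -- count is the largest of them, or 0.
  level : ℕ → ℕ → ℕ
  level zero    n = 0
  level (suc m) n = if not (div2 (suc m * scale) n ≡ᵇ 0) then suc (level m n) else level m n

  order : ℕ → ℕ
  order n = level n n

  level≤ : ∀ m n → level m n ≤ m
  level≤ zero    n = z≤n
  level≤ (suc m) n with div2 (suc m * scale) n
  ... | zero  = ≤-trans (level≤ m n) (n≤1+n m)
  ... | suc _ = s≤s (level≤ m n)

  level-lower : ∀ m n → level m n ≡ 0 ⊎ 2 ^ (level m n * scale) ≤ n
  level-lower zero    n = inj₁ refl
  level-lower (suc m) n with div2 (suc m * scale) n in eq
  ... | zero  = level-lower m n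
  ... | suc _ = inj₂ (≤-trans (^-monoʳ-≤ 2 (*-monoˡ-≤ scale (s≤s (level≤ m n))))
    (div2-nonzero (suc m * scale) n λ z → 1+n≢0 (trans (sym eq) z)))

  level-upper : ∀ m n → level m n ≡ m ⊎ n < 2 ^ (suc (level m n) * scale)
  level-upper zero    n = inj₁ refl
  level-upper (suc m) n with div2 (suc m * scale) n in eq | level-upper m n
  ... | zero  | inj₁ e = inj₂ (subst (λ k → n < 2 ^ (suc k * scale)) (sym e) (div2-zero (suc m * scale) n eq))
  ... | zero  | inj₂ p = inj₂ p
  ... | suc _ | inj₁ e = inj₁ (cong suc e)
  ... | suc _ | inj₂ p = contradiction
    (div2-nonzero (suc m * scale) n λ z → 1+n≢0 (trans (sym eq) z))
    (<⇒≱ (≤-trans p (^-monoʳ-≤ 2 (*-monoˡ-≤ scale (s≤s (level≤ m n))))))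

  order-lower : ∀ n → order n ≡ 0 ⊎ 2 ^ (order n * scale) ≤ n
  order-lower n = level-lower n n

  order-upper : ∀ n → n < 2 ^ (suc (order n) * scale)
  order-upper n with level-upper n n
  ... | inj₂ p = p
  ... | inj₁ e = ≤-trans (m<2^m n) (^-monoʳ-≤ 2 (≤-trans (≤-reflexive (sym e))
          (≤-trans (n≤1+n (order n)) (m≤m*n (suc (order n)) scale))))

  module _ (n : ℕ) where

    k s N g W : ℕ
    k = order n
    s = k * rate
    N = 2 ^ s
    g = k * s
    W = k * (k * ℓ)

    by-order : ∀ {P : ℕ → Set} → P 0 → (0 < k → 2 ^ (k * scale) ≤ n → P k) → P k
    by-order {P} p₀ p with order-lower n
    ... | inj₁ e = subst P (sym e) p₀
    ... | inj₂ q with k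
    ...   | zero  = p₀
    ...   | suc _ = p z<s q

    k≤n : k ≤ n
    k≤n = level≤ n n

    -- The factors k and `rate` are at most `2 ^ k` and X. This gives the exponent 1 + 3 * k + 2 * k
    -- * rate, and k > 0 turns the 1 into a fourth k.
    bound : ∀ k → 0 < k → k * (k * rate) + (k * 2 ^ (k * rate)) * (k * (k * rate)) ≤ 2 ^ (k * scale)
    bound k k>0 = begin
      G + k * X * G            ≡⟨ refl ⟩
      (1 + k * X) * G          ≤⟨ *-mono-≤ one-more G≤ ⟩
      (2 * (2 ^ k * X)) * (2 ^ k * (2 ^ k * X)) ≡⟨ powers ⟩
      2 ^ (1 + (k + k * rate) + (k + (k + k * rate))) ≤⟨ ^-monoʳ-≤ 2 exponents ⟩
      2 ^ (k * scale)          ∎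
      where
      open ≤-Reasoning
      X = 2 ^ (k * rate)
      G = k * (k * rate)
      k≤2^k : k ≤ 2 ^ k
      k≤2^k = <⇒≤ (m<2^m k)
      rate≤X : rate ≤ X
      rate≤X = ≤-trans (<⇒≤ (m<2^m rate)) (^-monoʳ-≤ 2 (≤-trans (≤-reflexive (sym (*-identityˡ rate))) (*-monoˡ-≤ rate k>0)))
      G≤ : G ≤ 2 ^ k * (2 ^ k * X)
      G≤ = *-mono-≤ k≤2^k (*-mono-≤ k≤2^k rate≤X)
      one-more : 1 + k * X ≤ 2 * (2 ^ k * X)
      one-more = ≤-trans (+-mono-≤ (*-mono-≤ (m^n>0 2 k) (m^n>0 2 (k * rate))) (*-monoˡ-≤ X k≤2^k))
        (≤-reflexive (sym (2*-double (2 ^ k * X))))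
      powers : (2 * (2 ^ k * X)) * (2 ^ k * (2 ^ k * X)) ≡ 2 ^ (1 + (k + k * rate) + (k + (k + k * rate)))
      powers = sym (trans (^-distribˡ-+-* 2 (1 + (k + k * rate)) (k + (k + k * rate)))
        (cong₂ _*_ (cong (2 *_) (^-distribˡ-+-* 2 k (k * rate)))
          (trans (^-distribˡ-+-* 2 k (k + k * rate)) (cong (2 ^ k *_) (^-distribˡ-+-* 2 k (k * rate))))))
      exponents : 1 + (k + k * rate) + (k + (k + k * rate)) ≤ k * scale
      exponents = ≤-trans (+-monoˡ-≤ _ (+-monoˡ-≤ (k + k * rate) k>0)) (≤-reflexive (expand k ℓ))
        where
        expand : ∀ k ℓ → k + (k + k * (1 + ℓ * (ℓ * 1))) + (k + (k + k * (1 + ℓ * (ℓ * 1))))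
                       ≡ k * (6 + ℓ * (ℓ * 2))
        expand = solve-∀

    room : g + (k * N) * g ≤ n
    room = by-order {λ k → k * (k * rate) + (k * 2 ^ (k * rate)) * (k * (k * rate)) ≤ n} z≤n
      λ k>0 le → ≤-trans (bound k k>0) le

    g≤n : g ≤ n
    g≤n = ≤-trans (m≤m+n g _) room

    s≤n : s ≤ n
    s≤n = by-order {λ k → k * rate ≤ n} z≤n λ k>0 _ →
      ≤-trans (≤-trans (≤-reflexive (sym (*-identityˡ s))) (*-monoˡ-≤ s k>0)) g≤n

    -- For n = 0 the order is 0 and N is 1, so the bound needs k > 0.
    N≤n : 0 < k → N ≤ n
    N≤n = by-order {λ k → 0 < k → 2 ^ (k * rate) ≤ n} (λ ()) λ _ le _ →
      ≤-trans (^-monoʳ-≤ 2 (*-monoʳ-≤ k rate≤scale)) le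
      where
      rate≤scale : rate ≤ scale
      rate≤scale = +-mono-≤ (s≤s z≤n) (*-monoʳ-≤ ℓ (*-monoʳ-≤ ℓ (n≤1+n 1)))

    -- The balance of the encoding: of the g bits saved, `W * ℓ` go into the advice and `k * k` are
    -- gained.
    g-split : g ≡ W * ℓ + k * k
    g-split = expand k ℓ
      where
      expand : ∀ k ℓ → k * (k * (1 + ℓ * (ℓ * 1))) ≡ k * (k * ℓ) * ℓ + k * k
      expand = solve-∀

    W≤n : 0 < ℓ → W ≤ n
    W≤n ℓ>0 = ≤-trans (≤-trans (≤-reflexive (sym (*-identityʳ W))) (*-monoʳ-≤ W ℓ>0))
      (≤-trans (≤-trans (m≤m+n (W * ℓ) (k * k)) (≤-reflexive (sym g-split))) g≤n)

    L : ℕ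
    L = n ∸ g + W * ℓ

    L+k² : L + k * k ≡ n
    L+k² = trans (+-assoc (n ∸ g) (W * ℓ) (k * k)) (trans (cong (_+_ (n ∸ g)) (sym g-split)) (m∸n+n≡m g≤n))

    L≤n : L ≤ n
    L≤n = ≤-trans (m≤m+n L (k * k)) (≤-reflexive L+k²)

-- Computing the parameters.

module Start {ℓ : ℕ} where
  open Sizes ℓ

  -- There is no division, so `halve` counts x rounds in which `$y` and `$z`, the halves of the
  -- count rounded down and up, go over into `$z` and `$y` plus 1.
  halveStep halve shrink levelStep : Com ℓ
  halveStep = $i := $y ∙ incr $i ∙ $y := $z ∙ $z := $i
  halve = $y :=# 0 ∙ $z :=# 0 ∙ loop $x halveStep ∙ $x := $y
  shrink = each (λ _ → each λ _ → halve ∙ halve) ∙ halve ∙ halve ∙ halve ∙ halve ∙ halve ∙ halve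
  levelStep = shrink ∙ cond $x (incr $k) nop

  setK setS setN setG setW setRest setL prepare : Com ℓ
  setK    = $k :=# 0 ∙ $x := $n ∙ loop $n levelStep
  setS    = $s :=# 0 ∙ loop $k (each (λ _ → each λ _ → incr $s) ∙ incr $s)
  setN    = $N :=# 1 ∙ loop $s ($y := $N ∙ loop $y (incr $N))
  setG    = $g :=# 0 ∙ loop $k (loop $s (incr $g))
  setW    = $W :=# 0 ∙ loop $k (loop $k (each λ _ → incr $W))
  setRest = $n-g := $n ∙ loop $g (decr $n-g)
  setL    = $L := $n-g ∙ loop $W (each λ _ → incr $L)
  prepare = $n := $out ∙ $out :=# 0 ∙
    setK ∙ setS ∙ setN ∙ setG ∙ setW ∙ setRest ∙ setL ∙ $more :=# 1

  module _ {n : ℕ} (O : Oracles ℓ n) where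
    open Routines O

    halve-spec : ∀ a s → var s $x ≡ div2 a n → var (exec O halve s) $x ≡ div2 (suc a) n
    halve-spec a s x≡ = trans (proj₁ (loop-ind O Halving $x halveStep (exec O ($y :=# 0 ∙ $z :=# 0) s)
        x≡ (div2≤ a n) (λ { m s _ (y≡ , z≡) → z≡ , cong suc y≡ }) (refl , refl)))
      (sym (iterate-suc ⌊_/2⌋ n a))
      where
      Halving : ℕ → Store → Set
      Halving m s = var s $y ≡ ⌊ m /2⌋ × var s $z ≡ ⌊ suc m /2⌋

    shrink-spec : ∀ a s → var s $x ≡ div2 a n → var (exec O shrink s) $x ≡ div2 (scale + a) n
    shrink-spec a s x≡ =
      halve-spec (5 + b) s₅ (halve-spec (4 + b) s₄ (halve-spec (3 + b) s₃
        (halve-spec (2 + b) s₂ (halve-spec (1 + b) s₁ (halve-spec b s₀ outer)))))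
      where
      b = ℓ * (ℓ * 2) + a
      s₀ = exec O (each (λ _ → each λ _ → halve ∙ halve)) s
      s₁ = exec O halve s₀
      s₂ = exec O halve s₁
      s₃ = exec O halve s₂
      s₄ = exec O halve s₃
      s₅ = exec O halve s₄
      inner : ∀ a s → var s $x ≡ div2 a n → var (exec O (each (λ _ → halve ∙ halve)) s) $x ≡ div2 (ℓ * 2 + a) n
      inner a s x≡ = each-ind {m = ℓ} (λ m s → var s $x ≡ div2 (m * 2 + a) n) (λ _ → exec O (halve ∙ halve)) {s}
        (λ i s e → halve-spec (suc (toℕ i * 2 + a)) (exec O halve s) (halve-spec (toℕ i * 2 + a) s e)) x≡
      outer : var s₀ $x ≡ div2 b n
      outer = each-ind {m = ℓ} (λ m s → var s $x ≡ div2 (m * (ℓ * 2) + a) n)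
        (λ _ → (exec O (each (λ _ → halve ∙ halve)))) {s}
        (λ i s e → trans (inner (toℕ i * (ℓ * 2) + a) s e)
          (cong (λ c → div2 c n) (sym (+-assoc (ℓ * 2) (toℕ i * (ℓ * 2)) a)))) x≡

    count-step : ∀ m s → var s $x ≡ div2 (suc m * scale) n → var s $k ≡ level m n →
      let s′ = exec O (cond $x (incr $k) nop) s in
      var s′ $x ≡ div2 (suc m * scale) n × var s′ $k ≡ level (suc m) n
    count-step m s x≡ k≡ = trans (frame O (cond $x (incr $k) nop) s _) x≡ , counted
      where
      counted : var (exec O (cond $x (incr $k) nop) s) $k ≡ level (suc m) n
      counted rewrite x≡ with div2 (suc m * scale) n
      ... | zero  = k≡
      ... | suc _ = cong suc k≡

    level-step : ∀ m s → var s $x ≡ div2 (m * scale) n × var s $k ≡ level m n →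
      var (exec O levelStep s) $x ≡ div2 (suc m * scale) n × var (exec O levelStep s) $k ≡ level (suc m) n
    level-step m s (x≡ , k≡) = count-step m (exec O shrink s) (shrink-spec (m * scale) s x≡)
      (trans (frame O shrink s _) k≡)

    setK-spec : ∀ s → var s $n ≡ n → var (exec O setK s) $k ≡ order n
    setK-spec s n≡ = proj₂ (loop-ind O (λ m s → var s $x ≡ div2 (m * scale) n × var s $k ≡ level m n)
      $n levelStep (exec O ($k :=# 0 ∙ $x := $n) s) n≡ ≤-refl (λ m s _ → level-step m s) (n≡ , refl))

    -- Without multiplication, products arise as nested loops of increments; d is the total that one
    -- run adds to y.
    Adds : Com ℓ → ℕ → (Store → Set) → ℕ → Set
    Adds c y I d = ∀ s v → I s → var s y ≡ v → I (exec O c s) × var (exec O c s) y ≡ d + v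

    loop-adds : ∀ x c {y I d m} → m ≤ n → (∀ s → I s → var s x ≡ m) → Adds c y I d →
      Adds (loop x c) y I (m * d)
    loop-adds x c {y} {I} {d} m≤n x≡ h s v i y≡ =
      loop-ind O (λ r s → I s × var s y ≡ r * d + v) x c s (x≡ s i) m≤n
        (λ r s _ (i , e) → let i′ , e′ = h s (r * d + v) i e in i′ , trans e′ (sym (+-assoc d (r * d) v)))
        (i , y≡)

    each-adds : ∀ c {y I d} → Adds c y I d → Adds (each λ _ → c) y I (ℓ * d)
    each-adds c {y} {I} {d} h s v i y≡ =
      each-ind {m = ℓ} (λ r s → I s × var s y ≡ r * d + v) (λ _ → exec O c)
        (λ r s (i , e) → let i′ , e′ = h s (toℕ r * d + v) i e in
          i′ , trans e′ (sym (+-assoc d (toℕ r * d) v)))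
        (i , y≡)

    setS-spec : ∀ s {k} → k ≤ n → var s $k ≡ k → var (exec O setS s) $s ≡ k * rate
    setS-spec s {k} k≤n k≡ = trans (proj₂ (loop-adds $k (each (λ _ → each λ _ → incr $s) ∙ incr $s) {I = λ s → var s $k ≡ k} k≤n (λ _ e → e)
      (λ s v i e → let i′ , e′ = each-adds (each λ _ → incr $s) {I = λ s → var s $k ≡ k} (each-adds (incr $s) {I = λ s → var s $k ≡ k}
                          (λ s v i e → i , cong suc e)) s v i e in i′ , cong suc e′)
      (exec O ($s :=# 0) s) 0 k≡ refl)) (+-identityʳ (k * rate))

    -- N is doubled by a loop of N increments, which is cut off at n; hence the bound on the powers
    -- below `2 ^ m`.
    setN-spec : ∀ s {m} → (∀ {i} → i < m → 2 ^ i ≤ n) → m ≤ n → var s $s ≡ m → var (exec O setN s) $N ≡ 2 ^ m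
    setN-spec s pow≤ m≤n s≡ = loop-ind O (λ i s → var s $N ≡ 2 ^ i) $s ($y := $N ∙ loop $y (incr $N))
      (exec O ($N :=# 1) s) s≡ m≤n (λ i s i<m e → double i s i<m e) refl
      where
      double : ∀ i s → i < _ → var s $N ≡ 2 ^ i → var (exec O ($y := $N ∙ loop $y (incr $N)) s) $N ≡ 2 ^ suc i
      double i s i<m e = trans
        (loop-ind O (λ r s → var s $N ≡ 2 ^ i + r) $y (incr $N) (exec O ($y := $N) s) e (pow≤ i<m)
          (λ r s _ e → trans (cong suc e) (sym (+-suc (2 ^ i) r))) (trans e (sym (+-identityʳ (2 ^ i)))))
        (sym (2*-double (2 ^ i)))

    setG-spec : ∀ st {k s} → k ≤ n → s ≤ n → var st $k ≡ k → var st $s ≡ s → var (exec O setG st) $g ≡ k * s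
    setG-spec st {k} {s} k≤n s≤n k≡ s≡ = trans
      (proj₂ (loop-adds $k (loop $s (incr $g)) {I = I} k≤n (λ _ → proj₁)
        (loop-adds $s (incr $g) {I = I} s≤n (λ _ → proj₂) (λ st v i e → i , cong suc e))
        (exec O ($g :=# 0) st) 0 (k≡ , s≡) refl))
      (trans (+-identityʳ _) (cong (k *_) (*-identityʳ s)))
      where
      I : Store → Set
      I st = var st $k ≡ k × var st $s ≡ s

    setW-spec : ∀ st {k} → k ≤ n → var st $k ≡ k → var (exec O setW st) $W ≡ k * (k * ℓ)
    setW-spec st {k} k≤n k≡ = trans
      (proj₂ (loop-adds $k (loop $k (each λ _ → incr $W)) {I = I} k≤n (λ _ e → e)
        (loop-adds $k (each λ _ → incr $W) {I = I} k≤n (λ _ e → e) (each-adds (incr $W) {I = I} (λ st v i e → i , cong suc e)))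
        (exec O ($W :=# 0) st) 0 k≡ refl))
      (trans (+-identityʳ _) (cong (λ x → k * (k * x)) (*-identityʳ ℓ)))
      where
      I : Store → Set
      I st = var st $k ≡ k

    setRest-spec : ∀ st {g} → g ≤ n → var st $n ≡ n → var st $g ≡ g → var (exec O setRest st) $n-g ≡ n ∸ g
    setRest-spec st g≤n n≡ g≡ = loop-ind O (λ i st → var st $n-g ≡ n ∸ i) $g (decr $n-g)
      (exec O ($n-g := $n) st) g≡ g≤n (λ i st _ e → trans (cong pred e) (pred[m∸n]≡m∸[1+n] n i)) n≡

    setL-spec : ∀ st {W r} → W ≤ n → var st $W ≡ W → var st $n-g ≡ r → var (exec O setL st) $L ≡ r + W * ℓ
    setL-spec st {W} {r} W≤n W≡ r≡ = trans
      (proj₂ (loop-adds $W (each λ _ → incr $L) {I = I} W≤n (λ _ e → e) (each-adds (incr $L) {I = I} (λ st v i e → i , cong suc e))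
        (exec O ($L := $n-g) st) r W≡ r≡))
      (trans (+-comm _ r) (cong (λ x → r + W * x) (*-identityʳ ℓ)))
      where
      I : Store → Set
      I st = var st $W ≡ W

  module _ (ℓ>0 : 0 < ℓ) {n : ℕ} (O : Oracles ℓ n) where
    open Routines O

    private
      P : Store → Set
      P = Params (k n) (s n) (N n) (g n) (W n)

      record Known (st : Store) : Set where
        field
          n≡ : var st $n ≡ n
          k≡ : var st $k ≡ k n
          s≡ : var st $s ≡ s n
          N≡ : var st $N ≡ N n
          g≡ : var st $g ≡ g n
          W≡ : var st $W ≡ W n

    prepareL : ∀ st → Known st → var st $n-g ≡ n ∸ g n → P (exec O (setL ∙ $more :=# 1) st)
    prepareL st h r≡ = record
      { n≡ = trans (frame O setL st _) n≡ ; k≡ = trans (frame O setL st _) k≡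
      ; s≡ = trans (frame O setL st _) s≡ ; N≡ = trans (frame O setL st _) N≡
      ; g≡ = trans (frame O setL st _) g≡ ; W≡ = trans (frame O setL st _) W≡
      ; n-g≡ = trans (frame O setL st _) r≡ ; L≡ = setL-spec O st (W≤n n ℓ>0) W≡ r≡ }
      where open Known h

    prepareRest : ∀ st → Known st → P (exec O (setRest ∙ setL ∙ $more :=# 1) st)
    prepareRest st h = prepareL (exec O setRest st) (record
      { n≡ = trans (frame O setRest st _) n≡ ; k≡ = trans (frame O setRest st _) k≡
      ; s≡ = trans (frame O setRest st _) s≡ ; N≡ = trans (frame O setRest st _) N≡
      ; g≡ = trans (frame O setRest st _) g≡ ; W≡ = trans (frame O setRest st _) W≡ })
      (setRest-spec O st (g≤n n) n≡ g≡)
      where open Known h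

    prepareW : ∀ st → var st $n ≡ n → var st $k ≡ k n → var st $s ≡ s n → var st $N ≡ N n →
      var st $g ≡ g n → P (exec O (setW ∙ setRest ∙ setL ∙ $more :=# 1) st)
    prepareW st n≡ k≡ s≡ N≡ g≡ = prepareRest (exec O setW st) (record
      { n≡ = trans (frame O setW st _) n≡ ; k≡ = trans (frame O setW st _) k≡
      ; s≡ = trans (frame O setW st _) s≡ ; N≡ = trans (frame O setW st _) N≡
      ; g≡ = trans (frame O setW st _) g≡ ; W≡ = setW-spec O st (k≤n n) k≡ })

    prepareG : ∀ st → var st $n ≡ n → var st $k ≡ k n → var st $s ≡ s n → var st $N ≡ N n →
      P (exec O (setG ∙ setW ∙ setRest ∙ setL ∙ $more :=# 1) st)
    prepareG st n≡ k≡ s≡ N≡ = prepareW (exec O setG st)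
      (trans (frame O setG st _) n≡) (trans (frame O setG st _) k≡) (trans (frame O setG st _) s≡)
      (trans (frame O setG st _) N≡) (setG-spec O st (k≤n n) (s≤n n) k≡ s≡)

    prepareN : ∀ st → var st $n ≡ n → var st $k ≡ k n → var st $s ≡ s n →
      P (exec O (setN ∙ setG ∙ setW ∙ setRest ∙ setL ∙ $more :=# 1) st)
    prepareN st n≡ k≡ s≡ = prepareG (exec O setN st)
      (trans (frame O setN st _) n≡) (trans (frame O setN st _) k≡) (trans (frame O setN st _) s≡)
      (setN-spec O st pow≤ (s≤n n) s≡)
      where
      pow≤ : ∀ {i} → i < s n → 2 ^ i ≤ n
      pow≤ i<s = ≤-trans (^-monoʳ-≤ 2 (<⇒≤ i<s)) (N≤n n (k>0 (k n) (≤-trans z<s i<s)))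
        where
        k>0 : ∀ k → 0 < k * rate → 0 < k
        k>0 (suc k) _ = z<s

    prepareS : ∀ st → var st $n ≡ n → var st $k ≡ k n →
      P (exec O (setS ∙ setN ∙ setG ∙ setW ∙ setRest ∙ setL ∙ $more :=# 1) st)
    prepareS st n≡ k≡ = prepareN (exec O setS st)
      (trans (frame O setS st _) n≡) (trans (frame O setS st _) k≡) (setS-spec O st (k≤n n) k≡)

    prepare-spec : ∀ st → var st $out ≡ n → P (exec O prepare st)
    prepare-spec st out≡ = prepareS (exec O setK st′) (trans (frame O setK st′ _) out≡) (setK-spec O st′ out≡)
      where
      st′ = exec O ($n := $out ∙ $out :=# 0) st

  module _ {n : ℕ} (O : Oracles ℓ n) where

    prepare-out : ∀ st → var (exec O prepare st) $out ≡ 0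
    prepare-out st = frame O (setK ∙ setS ∙ setN ∙ setG ∙ setW ∙ setRest ∙ setL ∙ $more :=# 1) {$out}
      (exec O ($n := $out ∙ $out :=# 0) st) _

    prepare-more : ∀ st → var (exec O prepare st) $more ≡ 1
    prepare-more st = refl

    prepare-arr : ∀ {j} st → arr (exec O prepare st) j ≡ arr st j
    prepare-arr st = frame-arr O prepare st _

  prepare-then : 0 < ℓ → ∀ {n} (O : Oracles ℓ n) (R : Store → Set) →
    (∀ st → Routines.Params O (k n) (s n) (N n) (g n) (W n) st → var st $out ≡ 0 → var st $more ≡ 1 →
       (∀ x → arr st tape x ≡ 0) → R st) →
    ∀ st → var st $out ≡ n → (∀ x → arr st tape x ≡ 0) → R (exec O prepare st)
  prepare-then ℓ>0 O R f st out≡ blank = f (exec O prepare st) (prepare-spec ℓ>0 O st out≡)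
    (prepare-out O st) (prepare-more O st)
    (λ x → trans (cong (λ a → a x) (prepare-arr O {tape} st)) (blank x))

-- Running through all strings.

search-below : ∀ {P Q : ℕ → Set} → (∀ x → P x ⊎ Q x) → ∀ m →
  (∀ x → x < m → P x) ⊎ (∃[ x ] (x < m × Q x))
search-below d zero = inj₁ λ _ ()
search-below d (suc m) with d m | search-below d m
... | inj₂ q | _               = inj₂ (m , ≤-refl , q)
... | inj₁ _ | inj₂ (x , p , q) = inj₂ (x , m≤n⇒m≤1+n p , q)
search-below {P} d (suc m) | inj₁ p | inj₁ h = inj₁ below
  where
  below : ∀ x → x < suc m → P x
  below x lt with x ≟ m
  ... | yes refl = p
  ... | no x≢m   = h x (≤∧≢⇒< (≤-pred lt) x≢m)

true-or-false : ∀ b → b ≡ false ⊎ b ≡ true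
true-or-false false = inj₁ refl
true-or-false true  = inj₂ refl

-- A `loop` is capped at n rounds, so the enumeration is a `while` of the machine itself. The
-- present round treats string t and m more follow it; when m is 0 all digits of t are 1, and the
-- overflow clears `$more`.
repeat-run : ∀ {ℓ n} (O : Oracles ℓ n) (c : Com ℓ) (I : ℕ → Store → Set) L →
  (∀ t st → I t st → I (suc t) (exec O c st) × var (exec O c st) $more ≡ bit (not (ones L t))) →
  ∀ m t {st s} → m + suc t ≡ 2 ^ L → I t st → Models O st s → var st $more ≡ 1 →
  Runs O (while dbl $more loop compile 0 c end) s (1 + suc m * (1 + cost n c))
    (λ s′ → ∃[ st′ ] (Models O st′ s′ × I (2 ^ L) st′))
repeat-run {n = n} O c I L step m t {st} {s} e h r more
  with runs {t₁} {s₁} p t≤ (r₁ , _) ← compile-correct O 0 c r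
     | h₁ , more₁ ← step t st h
  = continue m e
  where
  looping : reg s (dbl $more) ≢ 0
  looping z = 1+n≢0 (trans (sym more) (trans (sym (Models.vars r $more)) z))
  not-last : ∀ m → suc m + suc t ≡ 2 ^ L → ones L t ≡ false
  not-last m e with ones L t in eq
  ... | false = refl
  ... | true  = contradiction
    (ones⇒last L (≤-trans (m≤n+m (suc t) (suc m)) (≤-reflexive e)) eq)
    (<⇒≢ (≤-trans (s≤s (m≤n+m (suc t) m)) (≤-reflexive e)))
  continue : ∀ m → m + suc t ≡ 2 ^ L →
    Runs O (while dbl $more loop compile 0 c end) s (1 + suc m * (1 + cost n c))
      (λ s′ → ∃[ st′ ] (Models O st′ s′ × I (2 ^ L) st′))
  continue zero e = runs
    (⇓loop looping p (⇓done (trans (Models.vars r₁ $more)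
      (trans more₁ (cong (λ b → bit (not b)) (last⇒ones L e))))))
    (≤-trans (s≤s (+-monoˡ-≤ 1 t≤)) (≤-reflexive (cong suc (trans (+-comm (cost n c) 1)
      (sym (+-identityʳ (1 + cost n c)))))))
    (_ , r₁ , subst (λ t → I t _) e h₁)
  continue (suc m) e
    with runs q u≤ result ← repeat-run O c I L step m (suc t) (trans (+-suc m (suc t)) e) h₁ r₁
           (trans more₁ (cong (λ b → bit (not b)) (not-last m e)))
    = runs (⇓loop looping p q)
        (s≤s (≤-trans (+-mono-≤ t≤ u≤) (≤-reflexive (+-suc (cost n c) (suc m * (1 + cost n c))))))
        result

enumeration-run : ∀ {ℓ n} (O : Oracles ℓ n) (a c : Com ℓ) (I : ℕ → Store → Set) L {Q : State → Set} →
  (∀ t st → I t st → I (suc t) (exec O c st) × var (exec O c st) $more ≡ bit (not (ones L t))) →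
  (∀ {st s} → Models O st s → I (2 ^ L) st → Q s) →
  (J : Store → Set) → (∀ st → J st → I 0 st × var st $more ≡ 1) →
  ∀ {st s} → Models O st s → J (exec O a st) →
  Runs O (compile 0 a ⨾ while dbl $more loop compile 0 c end) s
    (cost n a + (1 + 2 ^ L * (1 + cost n c))) Q
enumeration-run {n = n} O a c I L step q J init {st} r j =
  then-run O {Q = Models O (exec O a st)} (weaken O ≤-refl proj₁ (compile-correct O 0 a r)) λ r →
    weaken O (≤-reflexive (cong (λ m → 1 + m * (1 + cost n c)) suc-pred-2^)) (λ (st , r , i) → q r i)
      (repeat-run O c I L step (pred (2 ^ L)) 0 (trans (+-comm (pred (2 ^ L)) 1) suc-pred-2^) (proj₁ (init _ j)) r (proj₂ (init _ j)))
  where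
  suc-pred-2^ : suc (pred (2 ^ L)) ≡ 2 ^ L
  suc-pred-2^ = suc-pred (2 ^ L) {{>-nonZero (m^n>0 2 L)}}

-- Completeness of the encoding, and the running time.

module Algorithm (ℓ : ℕ) (ℓ>0 : 0 < ℓ) where
  open Sizes ℓ
  open Start

  module _ {n : ℕ} (M : Instance ℓ n) where
    open Bodies M (k n) (s n) (N n) (g n) (W n)
    open Code (k n) (s n) (N n) (g n)
    open Search (oracles M)

    missed⇒good : ∀ {B} → CommonMaximum M B → ∀ {γ} → γ < k n * N n →
      (∀ r → r < g n → has B (position γ r) ≡ false) →
      ∃[ t ] (t < 2 ^ L n × Good (λ x → bitOf x t))
    missed⇒good {B} max {γ} γ< missed = fromBits (L n) b , fromBits< (L n) b , inj₁ (B , record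
      { max      = max
      ; origin   = a
      ; inside   = a+g≤n
      ; origin<n = ≤-trans (m<m+n a (g>0 (k n) γ<)) a+g≤n
      ; gap      = λ {x} x<g → trans (cong (has B) (+-assoc (g n) (γ * g n) x)) (missed x x<g)
      ; left     = λ {x} x<a → trans (bitOf-fromBits (L n) b (≤-trans x<a (≤-trans a≤n-g n-g≤L)))
                     (cong (λ c → if c then has B x else has B (g n + x)) (<⇒<ᵇ-true x<a))
      ; right    = λ {x} lt → trans (bitOf-fromBits (L n) b (≤-trans lt n-g≤L))
                     (trans (cong (λ c → if c then has B (a + x) else has B (g n + (a + x)))
                              (≥⇒<ᵇ-false {a + x} (m≤m+n a x)))
                       (cong (has B) (trans (sym (+-assoc (g n) a x)) (cong (_+ x) (+-comm (g n) a)))))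
      })
      where
      a = g n + γ * g n
      n-g≤L : n ∸ g n ≤ L n
      n-g≤L = m≤m+n (n ∸ g n) (W n * ℓ)
      a+g≤n : a + g n ≤ n
      a+g≤n = ≤-trans (≤-reflexive (trans (+-assoc (g n) (γ * g n) (g n))
          (cong (λ x → g n + x) (+-comm (γ * g n) (g n)))))
        (≤-trans (+-monoʳ-≤ (g n) (*-monoˡ-≤ (g n) γ<)) (room n))
      a≤n-g : a ≤ n ∸ g n
      a≤n-g = ≤-trans (≤-reflexive (sym (m+n∸n≡m a (g n)))) (∸-monoˡ-≤ (g n) a+g≤n)
      g>0 : ∀ k → γ < k * N n → 0 < k * (k * rate)
      g>0 (suc k) _ = z<s
      -- B without the window from a on. From `n ∸ g` on the bits are padding in the place of the
      -- advice.
      b : ℕ → Bool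
      b x = if x <ᵇ a then has B x else has B (g n + x)

    codeword⇒good : ∀ {X} → Codeword X → Completes M (W n) X (λ _ → X) →
      ∃[ t ] (t < 2 ^ L n × Good (λ x → bitOf x t))
    codeword⇒good {X} code (α , complete) = fromBits (L n) b , fromBits< (L n) b , inj₂ (X , record
      { codeword = code
      ; high     = λ {x} lt → trans (bitOf-fromBits (L n) b (≤-trans lt (m≤m+n (n ∸ g n) (W n * ℓ))))
          (cong (λ c → if c then has X (g n + x) else α (x ∸ (n ∸ g n))) (<⇒<ᵇ-true lt))
      ; max      = complete _ (λ _ → X)
          (λ p lt → trans (bitOf-fromBits (L n) b (+-monoʳ-< (n ∸ g n) lt))
            (trans (cong (λ c → if c then has X (g n + (n ∸ g n + p)) else α ((n ∸ g n + p) ∸ (n ∸ g n)))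
                     (≥⇒<ᵇ-false {n ∸ g n + p} (m≤m+n (n ∸ g n) p)))
              (cong α (m+n∸m≡n (n ∸ g n) p))))
          (λ _ → refl) })
      where
      -- The g check bits are left out, since `encode` recomputes them, and the advice follows.
      b : ℕ → Bool
      b x = if x <ᵇ (n ∸ g n) then has X (g n + x) else α (x ∸ (n ∸ g n))

    hit⇒good : ∀ {B} → CommonMaximum M B →
      (∀ γ → γ < k n * N n → ∃[ r ] (r < g n × has B (position γ r) ≡ true)) →
      ∃[ t ] (t < 2 ^ L n × Good (λ x → bitOf x t))
    hit⇒good {B} max hit with X , X⊑B , code , size ← cover refl refl B hit =
      codeword⇒good code (start M ℓ>0 (k n) (W n) (k n) max X⊑B size ≤-refl
        (≤-reflexive (cong (k n *_) (*-comm ℓ (k n)))) (λ _ → refl))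

    -- For order 0 there is no group to miss, and the codeword case applies with X equal to B and no
    -- advice.
    good-exists : HasCommonBasis M → ∃[ t ] (t < 2 ^ L n × Good (λ x → bitOf x t))
    good-exists (B , basis) with search-below
      {λ γ → ∃[ r ] (r < g n × has B (position γ r) ≡ true)}
      {λ γ → ∀ r → r < g n → has B (position γ r) ≡ false}
      (λ γ → swap (search-below (λ r → true-or-false (has B (position γ r))) (g n)))
      (k n * N n)
    ... | inj₁ hit              = hit⇒good (common-basis⇒maximum M basis) hit
    ... | inj₂ (γ , γ< , missed) = missed⇒good (common-basis⇒maximum M basis) γ< missed

    State-at : ℕ → Store → Set
    State-at = Main refl (room n) (k≤n n) (s≤n n) (N≤n n) (W≤n n ℓ>0) (L≤n n)

  -- Register 0 is also the variable `$out`, so its initial content n is saved first: in `rn` for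
  -- the addressing, and by `prepare` in `$n`.
  program : Program ℓ
  program = rn ≔copy 0 ⨾ compile 0 (prepare {ℓ}) ⨾ while dbl $more loop compile 0 (body {ℓ}) end

  module _ {n : ℕ} (M : Instance ℓ n) where
    open Bodies M (k n) (s n) (N n) (g n) (W n)

    blank : Store
    blank = ⟨ (λ _ → 0) [ 0 ↦ n ] , (λ _ _ → 0) ⟩

    blank-models : Models (oracles M) blank (setReg (initial n) rn (reg (initial n) 0))
    blank-models = record { vars = vs ; size = refl ; cells = λ _ _ _ → refl ; out = λ _ _ _ → refl }
      where
      vs : ∀ x → reg (setReg (initial n) rn (reg (initial n) 0)) (dbl x) ≡ var blank x
      vs zero    = refl
      vs (suc x) = refl

    judge : ∀ {st v} → v ≡ var st $out → Sound st → (HasCommonBasis M → var st $out ≡ 1) → Verdict M v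
    judge v≡ (sound (inj₂ (out≡ , basis))) _ = inj₁ (basis , trans v≡ out≡)
    judge v≡ (sound (inj₁ out≡)) tried = inj₂ ((λ basis → 1+n≢0 (trans (sym (tried basis)) out≡)) , trans v≡ out≡)

    record Ready (st : Store) : Set where
      field
        main  : State-at M 0 st
        more≡ : var st $more ≡ 1

    ready : Ready (exec (oracles M) prepare blank)
    ready = let r = prepare-then ℓ>0 (oracles M) Ready begin-ready blank refl (λ _ → refl) in r
      where
      begin-ready : ∀ st → Routines.Params (oracles M) (k n) (s n) (N n) (g n) (W n) st → var st $out ≡ 0 →
        var st $more ≡ 1 → (∀ x → arr st tape x ≡ 0) → Ready st
      begin-ready st params out≡ more≡ tape≡ = record
        { main = record { params = params ; bits = λ {x} _ → trans (tape≡ x) (sym (cong bit (bitOf-0 x)))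
                        ; valid = sound (inj₁ out≡) ; tried = λ () }
        ; more≡ = more≡ }

    verdict : ∀ {st s} → Models (oracles M) st s → State-at M (2 ^ L n) st → Verdict M (reg s 0)
    verdict r h = judge (Models.vars r $out) (Main.valid h)
      λ basis → let t , t< , good = good-exists M basis in Main.tried h t< good

    enumeration : ∀ {s} → Models (oracles M) blank s →
      Runs (oracles M) (compile 0 (prepare {ℓ}) ⨾ while dbl $more loop compile 0 (body {ℓ}) end) s
        (cost n (prepare {ℓ}) + (1 + 2 ^ L n * (1 + cost n (body {ℓ})))) (λ s → Verdict M (reg s 0))
    enumeration r = enumeration-run (oracles M) prepare body (State-at M) (L n)
      (body-spec refl (room n) (k≤n n) (s≤n n) (N≤n n) (W≤n n ℓ>0) (L≤n n))
      verdict Ready (λ st h → Ready.main h , Ready.more≡ h) r ready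

    run : Runs (oracles M) program (initial n)
      (1 + (cost n (prepare {ℓ}) + (1 + 2 ^ L n * (1 + cost n (body {ℓ}))))) (λ s → Verdict M (reg s 0))
    run = then-run (oracles M) {b = 1} {b′ = cost n (prepare {ℓ}) + (1 + 2 ^ L n * (1 + cost n (body {ℓ})))}
      {Q = Models (oracles M) blank} (runs ⇓copy ≤-refl blank-models) enumeration

  abstract
    polyBound : PolyBounded (λ n → 3 + (cost n (prepare {ℓ}) + cost n (body {ℓ})))
    polyBound = poly-+ {λ _ → 3} {λ n → cost n (prepare {ℓ}) + cost n (body {ℓ})} (poly-const 3)
      (poly-+ {λ n → cost n (prepare {ℓ})} {λ n → cost n (body {ℓ})} (cost-poly (prepare {ℓ})) (cost-poly (body {ℓ})))

  -- By `order-upper`, 2 + n is at most 2 to the power 1 + (k + 1) * scale. A polynomial of exponent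
  -- `degree` thus costs at most (k + 1) * overhead further bits.
  degree overhead : ℕ
  degree   = proj₁ polyBound
  overhead = (1 + scale) * degree

  -- Negative as long as the polynomial factor outweighs the bits saved, hence an integer.
  gain : ℕ → ℤ
  gain n = + (k n * k n) - + (suc (k n) * overhead)

  time-bound : ∀ n a b → 3 + (a + b) ≤ (2 + n) ^ degree →
    1 + (a + (1 + 2 ^ L n * (1 + b))) ≤ 2 ^ (L n + suc (k n) * overhead)
  time-bound n a b poly = begin
    1 + (a + (1 + X * (1 + b)))  ≤⟨ s≤s (+-mono-≤ (m≤m*n′ a) (+-monoˡ-≤ _ (m^n>0 2 (L n)))) ⟩
    1 + (X * a + (X + X * (1 + b))) ≤⟨ +-monoˡ-≤ _ (m^n>0 2 (L n)) ⟩
    X + (X * a + (X + X * (1 + b))) ≡⟨ collect X a b ⟩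
    X * (3 + (a + b))            ≤⟨ *-monoʳ-≤ X poly ⟩
    X * (2 + n) ^ d              ≤⟨ *-monoʳ-≤ X (^-monoˡ-≤ d 2+n≤) ⟩
    X * (2 ^ (1 + suc (k n) * scale)) ^ d ≡⟨ cong (X *_) (^-*-assoc 2 (1 + suc (k n) * scale) d) ⟩
    X * 2 ^ ((1 + suc (k n) * scale) * d) ≤⟨ *-monoʳ-≤ X (^-monoʳ-≤ 2 exponent) ⟩
    X * 2 ^ (suc (k n) * overhead) ≡⟨ sym (^-distribˡ-+-* 2 (L n) (suc (k n) * overhead)) ⟩
    2 ^ (L n + suc (k n) * overhead) ∎
    where
    open ≤-Reasoning
    X = 2 ^ L n
    d = degree
    m≤m*n′ : ∀ m → m ≤ X * m
    m≤m*n′ m = ≤-trans (≤-reflexive (sym (*-identityˡ m))) (*-monoˡ-≤ m (m^n>0 2 (L n)))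
    collect : ∀ X a b → X + (X * a + (X + X * (1 + b))) ≡ X * (3 + (a + b))
    collect = solve-∀
    2+n≤ : 2 + n ≤ 2 ^ (1 + suc (k n) * scale)
    2+n≤ = ≤-trans (+-mono-≤ (m^n>0 2 (suc (k n) * scale)) (order-upper n))
      (≤-reflexive (sym (2*-double (2 ^ (suc (k n) * scale)))))
    exponent : (1 + suc (k n) * scale) * d ≤ suc (k n) * overhead
    exponent = ≤-trans (*-monoˡ-≤ d (s≤s (m≤n+m (suc (k n) * scale) (k n))))
      (≤-reflexive (regroup (k n) scale d))
      where
      regroup : ∀ k c d → (1 + (k + suc k * c)) * d ≡ suc k * ((1 + c) * d)
      regroup = solve-∀

  exponent≡ : ∀ n → + n - gain n ≡ + (L n + suc (k n) * overhead)
  exponent≡ n = trans (cong (λ m → + m - gain n) (sym (L+k² n)))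
    (cancel (+ L n) (+ (k n * k n)) (+ (suc (k n) * overhead)))
    where
    cancel : ∀ a b e → a ℤ.+ b - (b - e) ≡ a ℤ.+ e
    cancel = solveℤ-∀

  -- The logarithm is at most (k + 1) * scale, hence at most 2 * k * scale, and for large n the gain
  -- is at least half of k². The factors 4 and 2 make up the 8.
  gain-large : gain ∈Ω log²
  gain-large = 8 * (scale * scale) , 2 ^ (suc k₀ * scale) , z<s , large
    where
    -- For an order K above k₀ the loss, at most 2 * K * overhead, is at most half of `K * K`. The
    -- threshold on n forces the order above k₀ by `order-upper`.
    k₀ = 4 * overhead
    large : ∀ n → 2 ^ (suc k₀ * scale) ≤ n → + log² n ℤ.≤ + (8 * (scale * scale)) ℤ.* gain n
    large n n≥ = subst (λ h → + log² n ℤ.≤ + (8 * (scale * scale)) ℤ.* h) (sym gain≡)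
      (subst (+ log² n ℤ.≤_) (ℤ.pos-* (8 * (scale * scale)) x) (ℤ.+≤+ bound′))
      where
      open ≤-Reasoning
      K = k n
      e = suc K * overhead
      x = K * K ∸ e
      k₀<K : k₀ < K
      k₀<K = ≰⇒> λ K≤k₀ → <⇒≱ (order-upper n)
        (≤-trans (^-monoʳ-≤ 2 (*-monoˡ-≤ scale (s≤s K≤k₀))) n≥)
      suc-K≤ : suc K ≤ 2 * K
      suc-K≤ = ≤-trans (+-monoˡ-≤ K (≤-trans z<s k₀<K)) (≤-reflexive (sym (2*-double K)))
      2e≤ : e + e ≤ K * K
      2e≤ = begin
        e + e                        ≤⟨ +-mono-≤ (*-monoˡ-≤ overhead suc-K≤) (*-monoˡ-≤ overhead suc-K≤) ⟩
        2 * K * overhead + 2 * K * overhead ≡⟨ four K overhead ⟩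
        K * k₀                       ≤⟨ *-monoʳ-≤ K (<⇒≤ k₀<K) ⟩
        K * K                        ∎
        where
        four : ∀ K d → 2 * K * d + 2 * K * d ≡ K * (4 * d)
        four = solve-∀
      e≤ : e ≤ K * K
      e≤ = ≤-trans (m≤m+n e e) 2e≤
      gain≡ : gain n ≡ + x
      gain≡ = trans (ℤ.m-n≡m⊖n (K * K) e) (ℤ.⊖-≥ e≤)
      K²≤ : K * K ≤ x + x
      K²≤ = begin
        K * K         ≡⟨ sym (m∸n+n≡m e≤) ⟩
        x + e         ≤⟨ +-monoʳ-≤ x (m+n≤o⇒m≤o∸n e 2e≤) ⟩
        x + x         ∎
      log≤ : ⌊log₂ n ⌋ ≤ suc K * scale
      log≤ = ≤-trans (⌊log₂⌋-mono-≤ (<⇒≤ (order-upper n))) (≤-reflexive (⌊log₂[2^n]⌋≡n (suc K * scale)))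
      bound′ : log² n ≤ 8 * (scale * scale) * x
      bound′ = begin
        log² n                        ≤⟨ ^-monoˡ-≤ 2 (≤-trans log≤ (*-monoˡ-≤ scale suc-K≤)) ⟩
        (2 * K * scale) ^ 2           ≡⟨ square K scale ⟩
        4 * (scale * scale) * (K * K) ≤⟨ *-monoʳ-≤ (4 * (scale * scale)) K²≤ ⟩
        4 * (scale * scale) * (x + x) ≡⟨ doubled (scale * scale) x ⟩
        8 * (scale * scale) * x       ∎
        where
        square : ∀ K c → (2 * K * c) * ((2 * K * c) * 1) ≡ 4 * (c * c) * (K * K)
        square = solve-∀
        doubled : ∀ c x → 4 * c * (x + x) ≡ 8 * c * x
        doubled = solve-∀

  solves : SolvesMI program (λ n t → t ≤2^ (+ n - gain n))
  solves n M = Runs.time r , Runs.final r , Runs.steps r ,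
    subst (Runs.time r ≤2^_) (sym (exponent≡ n)) (≤-trans (Runs.time≤ r) budget) , Runs.post r
    where
    r = run M
    budget = time-bound n (cost n (prepare {ℓ})) (cost n (body {ℓ})) (proj₂ polyBound n)

theorem1p2 : ∀ (ℓ : ℕ) → 3 ≤ ℓ →
    Σ[ P ∈ Program ℓ ] Σ[ h ∈ (ℕ → ℤ) ]
    (h ∈Ω log² × SolvesMI P (λ n t → t ≤2^ (+ n - h n)))
theorem1p2 ℓ 3≤ℓ = program , gain , gain-large , solves
  where open Algorithm ℓ (≤-trans (s≤s z≤n) 3≤ℓ)
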